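{- Let $R$ be a Dedekind ring with field of fractions $K$, let $1\le e<d$ be integers invertible in $R$, and let $f,g\in R[x]$ be monic polynomials with $\deg(f)=d$ and $\deg(g)=e$. Let $\widehat{\mathscr{P}}$ be the formal neighbourhood of infinity in the path space of the correspondence $g(y)=f(x)$, with shift map $\sigma:\widehat{\mathscr{P}}\to\widehat{\mathscr{P}}$, and let $\widehat{\mathscr{B}}$ be the formal neighbourhood of infinity in the path space of the correspondence $y^e=x^d$, with shift map $\tau:\widehat{\mathscr{B}}\to\widehat{\mathscr{B}}$. Then there is an isomorphism $\Xi:\widehat{\mathscr{P}}\to\widehat{\mathscr{B}}$ of $K$-schemes such that $\Xi\circ\sigma=\tau\circ\Xi$.
   Context: The path space $\mathscr{P}$ of the correspondence $C:g(y)=f(x)$ is the scheme parametrizing infinite forward paths $(x_0,x_1,x_2,\dots)$ in $\mathbb{P}^1$, with homogeneous coordinates $[x_{i,0}:x_{i,1}]$ for $x_i=x_{i,1}/x_{i,0}$, subject to the equations $$x_{i+1,0}^{e}\,x_{i,0}^{d}\bigl(g(x_{i+1,1}/x_{i+1,0})-f(x_{i,1}/x_{i,0})\bigr)=0\qquad(i\ge 0).$$ The map $\pi:\mathscr{P}\to\mathbb{P}^1$ sends a path to $x_0$, and the shift $\sigma:\mathscr{P}\to\mathscr{P}$ sends $(x_0,x_1,\dots)$ to $(x_1,x_2,\dots)$. There is a unique point of $\mathscr{P}$ above $\infty\in\mathbb{P}^1$, namely $(\infty,\infty,\dots)$, and $w_i=x_{i,0}/x_{i,1}=1/x_i$ are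 local coordinates there. The completed local ring $\mathcal{O}_{\mathscr{P},\infty}$ at this point is the following. For $n\ge 0$ let $$S_n=K[[w_0,\dots,w_n]]/\bigl(w_{i+1}^{e}w_i^{d}(g(w_{i+1}^{ -1})-f(w_i^{ -1})):0\le i<n\bigr).$$ Give $w_i$ weight $(d/e)^i$, so that $w_0$ has weight $1$ and there are only finitely many monomials of weight below any given bound. For $X>0$ let $\mathfrak{m}_{n,X}\subseteq S_n$ be the ideal of classes of power series all of whose monomials have weight $>X$. Then $\mathcal{O}_{\mathscr{P},\infty}$ is the completion of $\varinjlim S_n$ with respect to the filtration by the ideals $\bigcup_n\mathfrak{m}_{n,X}$, $X\to\infty$. Set $\widehat{\mathscr{P}}=\operatorname{Spec}(\mathcal{O}_{\mathscr{P},\infty})$. The endomorphism $\sigma$ of $\widehat{\mathscr{P}}$ is the one induced by the continuous $K$-algebra endomorphism $w_i\mapsto w_{i+1}$. In the special case $g(y)=y^e$, $f(x)=x^d$, the path space is denoted $\mathscr{B}$, the corresponding formal scheme $\widehat{\mathscr{B}}=\operatorname{Spec}(\mathcal{O}_{\mathscr{B},\infty})$, and the shift $\tau$; writing $z_i$ for the coordinates in this case, the relations are $z_{i+1}^e=z_i^d$ and $\tau$ is induced by $z_i\mapsto z_{i+1}$. -}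

module Defs where

open import Level using (Level; _⊔_) renaming (suc to lsuc)
open import Algebra.Apartness.Bundles using (HeytingCommutativeRing; HeytingField)
open import Algebra.Bundles using (CommutativeRing; RawRing)
open import Algebra.Core using (Op₂)
import Algebra.Definitions
open import Algebra.Morphism.Bundles using (RingHomomorphism)
import Algebra.Morphism.Construct.Composition as Composition
import Algebra.Morphism.Construct.Identity as Identity
import Algebra.Properties.CommutativeSemigroup
import Algebra.Properties.Group
import Algebra.Properties.Ring
import Algebra.Properties.Semiring.Exp
import Algebra.Properties.Semiring.Mult
import Algebra.Properties.Semiring.Sum
open import Data.Fin.Base using (Fin; zero; suc; toℕ; fromℕ; inject₁)
import Data.Integer.Base as ℤ
import Data.Integer.Properties as ℤₚ
open import Data.Nat.Base as ℕ using (ℕ; zero; suc; _∸_; _≤′_; ≤′-reflexive; ≤′-step; NonZero)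
import Data.Nat.Properties as ℕₚ
open import Data.Product.Base using (Σ; ∃; ∃-syntax; _×_; _,_; proj₁; proj₂)
open import Data.Rational.Base as ℚ using (ℚ; 0ℚ; 1ℚ)
import Data.Rational.Properties as ℚₚ
import Data.Rational.Unnormalised.Base as ℚᵘ
import Data.Rational.Unnormalised.Properties as ℚᵘₚ
open import Data.Sum.Base using (_⊎_)
open import Data.Vec.Base using (Vec; []; _∷_; _∷ʳ_)
open import Data.Vec.Relation.Binary.Pointwise.Inductive using (Pointwise; []; _∷_)
open import Function.Bundles using (Func)
open import Function.Definitions using (Injective)
open import Relation.Binary.Bundles using (Setoid)
open import Relation.Binary.Core using (Rel)
open import Relation.Binary.PropositionalEquality as ≡ using (_≡_)
import Relation.Binary.Reasoning.Setoid
open import Relation.Binary.Structures using (IsEquivalence)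
open import Relation.Nullary.Negation.Core using (¬_)
open import Relation.Unary using (Pred; _∈_; _∉_; _⊆_)

record CommutativeRingLaws {a ℓ} (A : RawRing a ℓ) : Set (a ⊔ ℓ) where
  open RawRing A
  field
    isEquivalence : IsEquivalence _≈_
    +-cong        : ∀ {x y u v} → x ≈ y → u ≈ v → (x + u) ≈ (y + v)
    +-assoc       : ∀ x y z → ((x + y) + z) ≈ (x + (y + z))
    +-comm        : ∀ x y → (x + y) ≈ (y + x)
    +-identityˡ   : ∀ x → (0# + x) ≈ x
    -‿cong        : ∀ {x y} → x ≈ y → (- x) ≈ (- y)
    -‿inverseˡ    : ∀ x → ((- x) + x) ≈ 0#
    *-cong        : ∀ {x y u v} → x ≈ y → u ≈ v → (x * u) ≈ (y * v)
    *-assoc       : ∀ x y z → ((x * y) * z) ≈ (x * (y * z))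
    *-comm        : ∀ x y → (x * y) ≈ (y * x)
    *-identityˡ   : ∀ x → (1# * x) ≈ x
    distribʳ      : ∀ z x y → ((x + y) * z) ≈ ((x * z) + (y * z))

  private
    module E = IsEquivalence isEquivalence

  commutativeRing : CommutativeRing a ℓ
  commutativeRing = record
    { Carrier = Carrier ; _≈_ = _≈_ ; _+_ = _+_ ; _*_ = _*_ ; -_ = -_ ; 0# = 0# ; 1# = 1#
    ; isCommutativeRing = record
      { isRing = record
        { +-isAbelianGroup = record
          { isGroup = record
            { isMonoid = record
              { isSemigroup = record
                { isMagma = record { isEquivalence = isEquivalence ; ∙-cong = +-cong }
                ; assoc = +-assoc }
              ; identity = +-identityˡ , λ x → E.trans (+-comm x 0#) (+-identityˡ x) }
            ; inverse = -‿inverseˡ , λ x → E.trans (+-comm x (- x)) (-‿inverseˡ x)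
            ; ⁻¹-cong = -‿cong }
          ; comm = +-comm }
        ; *-cong = *-cong
        ; *-assoc = *-assoc
        ; *-identity = *-identityˡ , λ x → E.trans (*-comm x 1#) (*-identityˡ x)
        ; distrib = (λ z x y → E.trans (*-comm z (x + y))
                       (E.trans (distribʳ z x y) (+-cong (*-comm x z) (*-comm y z))))
                  , distribʳ }
      ; *-comm = *-comm } }

module RingNotation {a ℓ} (A : CommutativeRing a ℓ) where
  open CommutativeRing A public hiding (zero; distrib)
  open Algebra.Properties.Semiring.Exp semiring public using (_^_; ^-congˡ)
  open Algebra.Properties.Semiring.Sum semiring public
    using (sum; sum-cong-≋; ∑-distrib-+; *-distribˡ-sum; sum-replicate-zero; sum⁺-syntax)
  open Algebra.Properties.Ring ring public
    using (-‿+-comm; -‿distribʳ-*; -‿distribˡ-*; -1*x≈-x; -‿involutive)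
  open Algebra.Properties.CommutativeSemigroup +-commutativeSemigroup public
    using () renaming (interchange to +-medial)
  module ≈-Reasoning = Relation.Binary.Reasoning.Setoid setoid

  x≈y⇒x-y≈0 : ∀ {x y} → x ≈ y → (x - y) ≈ 0#
  x≈y⇒x-y≈0 {x} {y} p = trans (+-congʳ p) (-‿inverseʳ y)

  -0≈0 : (- 0#) ≈ 0#
  -0≈0 = trans (sym (+-identityˡ (- 0#))) (-‿inverseʳ 0#)

  [x+u]-[y+v] : ∀ x u y v → ((x + u) - (y + v)) ≈ ((x - y) + (u - v))
  [x+u]-[y+v] x u y v = trans (+-congˡ (sym (-‿+-comm y v))) (+-medial x u (- y) (- v))

  telescope : ∀ x y z → ((x - y) + (y - z)) ≈ (x - z)
  telescope x y z = begin
    (x - y) + (y - z)      ≈⟨ +-assoc x (- y) (y - z) ⟩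
    x + (- y + (y - z))    ≈⟨ +-congˡ (+-assoc (- y) y (- z)) ⟨
    x + ((- y + y) - z)    ≈⟨ +-congˡ (+-congʳ (-‿inverseˡ y)) ⟩
    x + (0# - z)           ≈⟨ +-congˡ (+-identityˡ (- z)) ⟩
    x - z                  ∎
    where open ≈-Reasoning

  xu-yv : ∀ x u y v → ((x * u) - (y * v)) ≈ ((x * (u - v)) + (v * (x - y)))
  xu-yv x u y v = sym (begin
    (x * (u - v)) + (v * (x - y))              ≈⟨ +-congˡ (*-comm v (x - y)) ⟩
    (x * (u - v)) + ((x - y) * v)              ≈⟨ +-cong (distribˡ x u (- v)) (distribʳ v x (- y)) ⟩
    (x * u + x * - v) + (x * v + - y * v)      ≈⟨ +-cong (+-congˡ (-‿distribʳ-* x v)) (+-congˡ (-‿distribˡ-* y v)) ⟨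
    (x * u - x * v) + (x * v - y * v)          ≈⟨ telescope (x * u) (x * v) (y * v) ⟩
    x * u - y * v                              ∎)
    where open ≈-Reasoning

RingHom : ∀ {a ℓa b ℓb} → CommutativeRing a ℓa → CommutativeRing b ℓb → Set (a ⊔ ℓa ⊔ b ⊔ ℓb)
RingHom A B = RingHomomorphism (CommutativeRing.rawRing A) (CommutativeRing.rawRing B)

module _ {a ℓa b ℓb} (A : CommutativeRing a ℓa) (B : CommutativeRing b ℓb) where
  private
    module A = RingNotation A
    module B = RingNotation B
    module G = Algebra.Properties.Group B.+-group

  ringHom : (f : A.Carrier → B.Carrier) →
            (∀ {x y} → x A.≈ y → f x B.≈ f y) →
            (∀ x y → f (x A.+ y) B.≈ (f x B.+ f y)) →
            (∀ x y → f (x A.* y) B.≈ (f x B.* f y)) →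
            f A.1# B.≈ B.1# →
            RingHom A B
  ringHom f cong +-homo *-homo 1-homo = record
    { ⟦_⟧ = f
    ; isRingHomomorphism = record
      { isSemiringHomomorphism = record
        { isNearSemiringHomomorphism = record
          { +-isMonoidHomomorphism = record
            { isMagmaHomomorphism = record { isRelHomomorphism = record { cong = cong } ; homo = +-homo }
            ; ε-homo = 0-homo }
          ; *-homo = *-homo }
        ; 1#-homo = 1-homo }
      ; -‿homo = λ x → G.inverseˡ-unique (f (A.- x)) (f x)
          (B.trans (B.sym (+-homo (A.- x) x)) (B.trans (cong (A.-‿inverseˡ x)) 0-homo)) } }
    where
    0-homo : f A.0# B.≈ B.0#
    0-homo = G.identityʳ-unique (f A.0#) (f A.0#)
      (B.trans (B.sym (+-homo A.0# A.0#)) (cong (A.+-identityˡ A.0#)))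

  module HomLaws (φ : RingHom A B) where
    open RingHomomorphism φ public using (⟦_⟧; ⟦⟧-cong; +-homo; *-homo; 0#-homo; 1#-homo; -‿homo)

    sub-homo : ∀ x y → ⟦ x A.- y ⟧ B.≈ (⟦ x ⟧ B.- ⟦ y ⟧)
    sub-homo x y = B.trans (+-homo x (A.- y)) (B.+-congˡ (-‿homo y))

    ^-homo : ∀ x n → ⟦ x A.^ n ⟧ B.≈ (⟦ x ⟧ B.^ n)
    ^-homo x zero    = 1#-homo
    ^-homo x (suc n) = B.trans (*-homo x (x A.^ n)) (B.*-congˡ (^-homo x n))

    sum-homo : ∀ {n} (t : Fin n → A.Carrier) → ⟦ A.sum t ⟧ B.≈ B.sum (λ i → ⟦ t i ⟧)
    sum-homo {zero}  t = 0#-homo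
    sum-homo {suc n} t = B.trans (+-homo (t zero) (A.sum (λ i → t (suc i))))
                                 (B.+-congˡ (sum-homo (λ i → t (suc i))))

idHom : ∀ {a ℓ} (A : CommutativeRing a ℓ) → RingHom A A
idHom A = record { isRingHomomorphism = Identity.isRingHomomorphism (CommutativeRing.rawRing A) (CommutativeRing.refl A) }

compose : ∀ {a ℓa b ℓb c ℓc}
          (A : CommutativeRing a ℓa) (B : CommutativeRing b ℓb) (C : CommutativeRing c ℓc) →
          RingHom B C → RingHom A B → RingHom A C
compose A B C ψ φ = record
  { isRingHomomorphism = Composition.isRingHomomorphism (CommutativeRing.trans C)
      (RingHomomorphism.isRingHomomorphism φ) (RingHomomorphism.isRingHomomorphism ψ) }

record Ideal {a ℓ} (A : CommutativeRing a ℓ) (p : Level) : Set (a ⊔ ℓ ⊔ lsuc p) where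
  open CommutativeRing A
  field
    Member   : Pred Carrier p
    ∈-resp-≈ : ∀ {x y} → x ≈ y → x ∈ Member → y ∈ Member
    0∈       : 0# ∈ Member
    +-closed : ∀ {x y} → x ∈ Member → y ∈ Member → (x + y) ∈ Member
    *-closed : ∀ r {x} → x ∈ Member → (r * x) ∈ Member

  -‿closed : ∀ {x} → x ∈ Member → (- x) ∈ Member
  -‿closed {x} m = ∈-resp-≈ (RingNotation.-1*x≈-x A x) (*-closed (- 1#) m)

open Ideal using (Member)

module _ {a ℓ} (A : CommutativeRing a ℓ) where
  open RingNotation A

  spanIdeal : ∀ {n} → (Fin n → Carrier) → Ideal A (a ⊔ ℓ)
  spanIdeal {n} r = record
    { Member   = λ x → ∃[ c ] x ≈ combination c
    ; ∈-resp-≈ = λ x≈y (c , x≈) → c , trans (sym x≈y) x≈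
    ; 0∈       = (λ _ → 0#) , sym (trans (sum-cong-≋ (λ i → zeroˡ (r i))) (sum-replicate-zero n))
    ; +-closed = λ (c , x≈) (d , y≈) → (λ i → c i + d i) , trans (+-cong x≈ y≈)
        (sym (trans (sum-cong-≋ (λ i → distribʳ (r i) (c i) (d i)))
                    (∑-distrib-+ (λ i → c i * r i) (λ i → d i * r i))))
    ; *-closed = λ s (c , x≈) → (λ i → s * c i) , trans (*-congˡ x≈)
        (trans (*-distribˡ-sum s (λ i → c i * r i)) (sum-cong-≋ (λ i → sym (*-assoc s (c i) (r i)))))
    }
    where
    combination : (Fin n → Carrier) → Carrier
    combination c = sum (λ i → c i * r i)

  generator∈ : ∀ {n} (r : Fin n → Carrier) (i : Fin n) → r i ∈ Member (spanIdeal r)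
  generator∈ r i = δ i , sym (sum-δ r i)
    where
    δ : ∀ {n} → Fin n → Fin n → Carrier
    δ zero    zero    = 1#
    δ zero    (suc j) = 0#
    δ (suc i) zero    = 0#
    δ (suc i) (suc j) = δ i j
    sum-δ : ∀ {n} (r : Fin n → Carrier) (i : Fin n) → sum (λ j → δ i j * r j) ≈ r i
    sum-δ {suc n} r zero = trans (+-cong (*-identityˡ (r zero))
        (trans (sum-cong-≋ (λ j → zeroˡ (r (suc j)))) (sum-replicate-zero n)))
      (+-identityʳ (r zero))
    sum-δ {suc n} r (suc i) = trans (+-cong (zeroˡ (r zero)) (sum-δ (λ j → r (suc j)) i))
      (+-identityˡ (r (suc i)))

  sum-closed : ∀ {p} (I : Ideal A p) {n} (t : Fin n → Carrier) →
               (∀ i → t i ∈ Member I) → sum t ∈ Member I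
  sum-closed I {zero}  t t∈ = Ideal.0∈ I
  sum-closed I {suc n} t t∈ = Ideal.+-closed I (t∈ zero) (sum-closed I (λ i → t (suc i)) (λ i → t∈ (suc i)))

  span-least : ∀ {p} (I : Ideal A p) {n} (r : Fin n → Carrier) →
               (∀ i → r i ∈ Member I) → Member (spanIdeal r) ⊆ Member I
  span-least I r r∈ (c , x≈) = Ideal.∈-resp-≈ I (sym x≈)
    (sum-closed I (λ i → c i * r i) (λ i → Ideal.*-closed I (c i) (r∈ i)))

module _ {a ℓ p} (A : CommutativeRing a ℓ) (I : Ideal A p) where
  open RingNotation A
  open Ideal I hiding (Member)

  ≈⇒≈ᴵ : ∀ {x y} → x ≈ y → (x - y) ∈ Member I
  ≈⇒≈ᴵ x≈y = ∈-resp-≈ (sym (x≈y⇒x-y≈0 x≈y)) 0∈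

  infixl 7 _/_

  _/_ : CommutativeRing a p
  _/_ = CommutativeRingLaws.commutativeRing {A = raw} (record
    { isEquivalence = record
      { refl  = ≈⇒≈ᴵ refl
      ; sym   = λ {x} {y} m → ∈-resp-≈
          (trans (sym (-‿+-comm x (- y))) (trans (+-congˡ (-‿involutive y)) (+-comm (- x) y))) (-‿closed m)
      ; trans = λ {x} {y} {z} m n → ∈-resp-≈ (telescope x y z) (+-closed m n) }
    ; +-cong      = λ {x} {y} {u} {v} m n → ∈-resp-≈ (sym ([x+u]-[y+v] x u y v)) (+-closed m n)
    ; +-assoc     = λ x y z → ≈⇒≈ᴵ (+-assoc x y z)
    ; +-comm      = λ x y → ≈⇒≈ᴵ (+-comm x y)
    ; +-identityˡ = λ x → ≈⇒≈ᴵ (+-identityˡ x)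
    ; -‿cong      = λ {x} {y} m → ∈-resp-≈ (sym (-‿+-comm x (- y))) (-‿closed m)
    ; -‿inverseˡ  = λ x → ≈⇒≈ᴵ (-‿inverseˡ x)
    ; *-cong      = λ {x} {y} {u} {v} m n →
        ∈-resp-≈ (sym (xu-yv x u y v)) (+-closed (*-closed x n) (*-closed v m))
    ; *-assoc     = λ x y z → ≈⇒≈ᴵ (*-assoc x y z)
    ; *-comm      = λ x y → ≈⇒≈ᴵ (*-comm x y)
    ; *-identityˡ = λ x → ≈⇒≈ᴵ (*-identityˡ x)
    ; distribʳ    = λ z x y → ≈⇒≈ᴵ (distribʳ z x y)
    })
    where
    raw : RawRing a p
    raw = record { Carrier = Carrier ; _≈_ = λ x y → (x - y) ∈ Member I
                 ; _+_ = _+_ ; _*_ = _*_ ; -_ = -_ ; 0# = 0# ; 1# = 1# }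

  quotientHom : RingHom A _/_
  quotientHom = ringHom A _/_ (λ x → x) ≈⇒≈ᴵ (λ x y → ≈⇒≈ᴵ refl) (λ x y → ≈⇒≈ᴵ refl) (≈⇒≈ᴵ refl)

  imageIdeal : ∀ {q} → Ideal A q → Ideal _/_ (a ⊔ p ⊔ q)
  imageIdeal J = record
    { Member   = λ x → ∃[ y ] (x Q.≈ y) × (y ∈ Member J)
    ; ∈-resp-≈ = λ x≈x′ (y , x≈y , y∈) → y , Q.trans (Q.sym x≈x′) x≈y , y∈
    ; 0∈       = 0# , Q.refl , Ideal.0∈ J
    ; +-closed = λ (y , x≈y , y∈) (z , w≈z , z∈) → y + z , Q.+-cong x≈y w≈z , Ideal.+-closed J y∈ z∈
    ; *-closed = λ r (y , x≈y , y∈) → r * y , Q.*-cong (Q.refl {r}) x≈y , Ideal.*-closed J r y∈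
    }
    where module Q = CommutativeRing _/_

module _ {a ℓa b ℓb p q} {A : CommutativeRing a ℓa} {B : CommutativeRing b ℓb}
         (I : Ideal A p) (J : Ideal B q) (φ : RingHom A B)
         (φI⊆J : ∀ {x} → x ∈ Member I → RingHomomorphism.⟦_⟧ φ x ∈ Member J) where
  open HomLaws A B φ
  private
    module J = Ideal J
    module Q = RingHomomorphism (quotientHom B J)

  quotientMap : RingHom (A / I) (B / J)
  quotientMap = ringHom (A / I) (B / J) ⟦_⟧
    (λ {x} {y} m → J.∈-resp-≈ (sub-homo x y) (φI⊆J m))
    (λ x y → Q.⟦⟧-cong (+-homo x y)) (λ x y → Q.⟦⟧-cong (*-homo x y)) (Q.⟦⟧-cong 1#-homo)

module _ {a ℓa b ℓb} (A : CommutativeRing a ℓa) (B : CommutativeRing b ℓb) (φ : RingHom A B) where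
  private
    module A = RingNotation A
    module B = RingNotation B
  open HomLaws A B φ

  span-map : ∀ {q} (J : Ideal B q) {n} (r : Fin n → A.Carrier) → (∀ i → ⟦ r i ⟧ ∈ Member J) →
             ∀ {x} → x ∈ Member (spanIdeal A r) → ⟦ x ⟧ ∈ Member J
  span-map J r r∈ (c , x≈) = span-least B J (λ i → ⟦ r i ⟧) r∈
    ((λ i → ⟦ c i ⟧) , B.trans (⟦⟧-cong x≈)
      (B.trans (sum-homo (λ i → c i A.* r i)) (B.sum-cong-≋ (λ i → *-homo (c i) (r i)))))

module Colimit {a ℓ} (A : ℕ → CommutativeRing a ℓ) (step : ∀ n → RingHom (A n) (A (suc n))) where
  private
    module A n = CommutativeRing (A n)
    module step n = RingHomomorphism (step n)

  transition : ∀ {m n} → m ≤′ n → RingHom (A m) (A n)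
  transition {m} (≤′-reflexive ≡.refl) = idHom (A m)
  transition {m} (≤′-step {n} m≤n)      = compose (A m) (A n) (A (suc n)) (step n) (transition m≤n)

  push : ∀ {m n} → m ≤′ n → A.Carrier m → A.Carrier n
  push m≤n = RingHomomorphism.⟦_⟧ (transition m≤n)

  private
    module T {m n} (m≤n : m ≤′ n) = RingHomomorphism (transition m≤n)

  push-irr : ∀ {m n} (p q : m ≤′ n) x → A._≈_ n (push p x) (push q x)
  push-irr {m} (≤′-reflexive ≡.refl) (≤′-reflexive eq) x
    rewrite ℕₚ.≡-irrelevant eq ≡.refl = A.refl m
  push-irr (≤′-reflexive ≡.refl) (≤′-step q) x with () ← ℕₚ.1+n≰n (ℕₚ.≤′⇒≤ q)
  push-irr (≤′-step p) (≤′-reflexive ≡.refl) x with () ← ℕₚ.1+n≰n (ℕₚ.≤′⇒≤ p)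
  push-irr (≤′-step {n} p) (≤′-step q) x = step.⟦⟧-cong n (push-irr p q x)

  push-trans : ∀ {l m n} (p : l ≤′ m) (q : m ≤′ n) x →
               A._≈_ n (push (ℕₚ.≤′-trans p q) x) (push q (push p x))
  push-trans {n = n} p (≤′-reflexive ≡.refl) x = A.refl n
  push-trans p (≤′-step {n} q) x = step.⟦⟧-cong n (push-trans p q x)

  push-any : ∀ {l m n} (p : l ≤′ m) (q : m ≤′ n) (r : l ≤′ n) x →
             A._≈_ n (push q (push p x)) (push r x)
  push-any {n = n} p q r x = A.trans n (A.sym n (push-trans p q x)) (push-irr (ℕₚ.≤′-trans p q) r x)

  left : ∀ m n → m ≤′ m ℕ.+ n
  left m n = ℕₚ.≤⇒≤′ (ℕₚ.m≤m+n m n)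

  right : ∀ m n → n ≤′ m ℕ.+ n
  right m n = ℕₚ.≤⇒≤′ (ℕₚ.m≤n+m n m)

  Element : Set a
  Element = Σ ℕ A.Carrier

  infix 4 _≈ᶜ_

  _≈ᶜ_ : Rel Element ℓ
  (m , x) ≈ᶜ (n , y) = ∃[ N ] Σ (m ≤′ N) λ m≤N → Σ (n ≤′ N) λ n≤N → A._≈_ N (push m≤N x) (push n≤N y)

  from : ∀ (x : Element) {N} → proj₁ x ≤′ N → A.Carrier N
  from (_ , x) p = push p x

  lift₂ : (∀ n → Op₂ (A.Carrier n)) → Op₂ Element
  lift₂ op (m , x) (n , y) = m ℕ.+ n , op (m ℕ.+ n) (push (left m n) x) (push (right m n) y)

  raw : RawRing a ℓ
  raw = record
    { Carrier = Element ; _≈_ = _≈ᶜ_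
    ; _+_ = lift₂ A._+_ ; _*_ = lift₂ A._*_
    ; -_ = λ (n , x) → n , A.-_ n x
    ; 0# = 0 , A.0# 0 ; 1# = 0 , A.1# 0 }

  private
    module R = RawRing raw

  eventually : ∀ (x y : Element) →
    (∀ {N} (p : proj₁ x ≤′ N) (q : proj₁ y ≤′ N) → A._≈_ N (from x p) (from y q)) → x ≈ᶜ y
  eventually (m , x) (n , y) h = m ℕ.+ n , left m n , right m n , h (left m n) (right m n)

  stays : ∀ {m n k N} {x : A.Carrier m} {y : A.Carrier n}
    (p : m ≤′ k) (q : n ≤′ k) → A._≈_ k (push p x) (push q y) →
    k ≤′ N → (p′ : m ≤′ N) (q′ : n ≤′ N) → A._≈_ N (push p′ x) (push q′ y)
  stays {N = N} {x} {y} p q eq r p′ q′ = begin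
    push p′ x           ≈⟨ push-any p r p′ x ⟨
    push r (push p x)   ≈⟨ T.⟦⟧-cong r eq ⟩
    push r (push q y)   ≈⟨ push-any q r q′ y ⟩
    push q′ y           ∎
    where open Relation.Binary.Reasoning.Setoid (A.setoid N)

  ≤ˡ : ∀ m n {N} → m ℕ.+ n ≤′ N → m ≤′ N
  ≤ˡ m n = ℕₚ.≤′-trans (left m n)

  ≤ʳ : ∀ m n {N} → m ℕ.+ n ≤′ N → n ≤′ N
  ≤ʳ m n = ℕₚ.≤′-trans (right m n)

  from-+ : ∀ (x y : Element) {N} (p : proj₁ x ℕ.+ proj₁ y ≤′ N) (q : proj₁ x ≤′ N) (r : proj₁ y ≤′ N) →
    A._≈_ N (from (x R.+ y) p) (A._+_ N (from x q) (from y r))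
  from-+ (m , x) (n , y) {N} p q r = A.trans N
    (T.+-homo p (push (left m n) x) (push (right m n) y))
    (A.+-cong N (push-any (left m n) p q x) (push-any (right m n) p r y))

  from-* : ∀ (x y : Element) {N} (p : proj₁ x ℕ.+ proj₁ y ≤′ N) (q : proj₁ x ≤′ N) (r : proj₁ y ≤′ N) →
    A._≈_ N (from (x R.* y) p) (A._*_ N (from x q) (from y r))
  from-* (m , x) (n , y) {N} p q r = A.trans N
    (T.*-homo p (push (left m n) x) (push (right m n) y))
    (A.*-cong N (push-any (left m n) p q x) (push-any (right m n) p r y))

  trans-≈ᶜ : ∀ x y z → x ≈ᶜ y → y ≈ᶜ z → x ≈ᶜ z
  trans-≈ᶜ x y z (k , p , q , e) (l , r , s , f) =
    k ℕ.+ l , ℕₚ.≤′-trans p (left k l) , ℕₚ.≤′-trans s (right k l) ,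
    A.trans (k ℕ.+ l)
      (stays p q e (left k l) (ℕₚ.≤′-trans p (left k l)) (ℕₚ.≤′-trans q (left k l)))
      (stays r s f (right k l) (ℕₚ.≤′-trans q (left k l)) (ℕₚ.≤′-trans s (right k l)))

  module _ (op : ∀ n → Op₂ (A.Carrier n))
           (op-cong : ∀ n {x y u v} → A._≈_ n x y → A._≈_ n u v → A._≈_ n (op n x u) (op n y v))
           (from-op : ∀ (x y : Element) {N} (p : proj₁ x ℕ.+ proj₁ y ≤′ N)
                      (q : proj₁ x ≤′ N) (r : proj₁ y ≤′ N) →
                      A._≈_ N (from (lift₂ op x y) p) (op N (from x q) (from y r))) where

    lift₂-cong : ∀ x y u v → x ≈ᶜ y → u ≈ᶜ v → lift₂ op x u ≈ᶜ lift₂ op y v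
    lift₂-cong x y u v (k , p , q , e) (l , r , s , f) =
      N , xu , yv ,
      A.trans N (from-op x u xu x≤ u≤)
        (A.trans N (op-cong N (stays p q e (≤ˡ k l (left (k ℕ.+ l) ρ)) x≤ y≤)
                              (stays r s f (≤ʳ k l (left (k ℕ.+ l) ρ)) u≤ v≤))
                   (A.sym N (from-op y v yv y≤ v≤)))
      where
      ρ N : ℕ
      ρ = (proj₁ x ℕ.+ proj₁ u) ℕ.+ (proj₁ y ℕ.+ proj₁ v)
      N = (k ℕ.+ l) ℕ.+ ρ
      xu : proj₁ x ℕ.+ proj₁ u ≤′ N
      xu = ≤ˡ (proj₁ x ℕ.+ proj₁ u) (proj₁ y ℕ.+ proj₁ v) (right (k ℕ.+ l) ρ)
      yv : proj₁ y ℕ.+ proj₁ v ≤′ N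
      yv = ≤ʳ (proj₁ x ℕ.+ proj₁ u) (proj₁ y ℕ.+ proj₁ v) (right (k ℕ.+ l) ρ)
      x≤ : proj₁ x ≤′ N
      x≤ = ≤ˡ (proj₁ x) (proj₁ u) xu
      u≤ : proj₁ u ≤′ N
      u≤ = ≤ʳ (proj₁ x) (proj₁ u) xu
      y≤ : proj₁ y ≤′ N
      y≤ = ≤ˡ (proj₁ y) (proj₁ v) yv
      v≤ : proj₁ v ≤′ N
      v≤ = ≤ʳ (proj₁ y) (proj₁ v) yv

    lift₂-comm : (∀ n x y → A._≈_ n (op n x y) (op n y x)) → ∀ x y → lift₂ op x y ≈ᶜ lift₂ op y x
    lift₂-comm comm x@(m , _) y@(n , _) = eventually (lift₂ op x y) (lift₂ op y x) λ {N} p q →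
      A.trans N (from-op x y p (≤ˡ m n p) (≤ʳ m n p))
        (A.trans N (comm N (from x (≤ˡ m n p)) (from y (≤ʳ m n p)))
                   (A.sym N (from-op y x q (≤ʳ m n p) (≤ˡ m n p))))

    lift₂-assoc : (∀ n x y z → A._≈_ n (op n (op n x y) z) (op n x (op n y z))) →
                  ∀ x y z → lift₂ op (lift₂ op x y) z ≈ᶜ lift₂ op x (lift₂ op y z)
    lift₂-assoc assoc x@(l , _) y@(m , _) z@(n , _) =
      eventually (lift₂ op (lift₂ op x y) z) (lift₂ op x (lift₂ op y z)) λ {N} p q →
        let xy = ≤ˡ (l ℕ.+ m) n p
            yz = ≤ʳ l (m ℕ.+ n) q
            x≤ = ≤ˡ l m xy
            y≤ = ≤ʳ l m xy
            z≤ = ≤ʳ (l ℕ.+ m) n p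
        in A.trans N (from-op (lift₂ op x y) z p xy z≤)
          (A.trans N (op-cong N (from-op x y xy x≤ y≤) (A.refl N))
          (A.trans N (assoc N (from x x≤) (from y y≤) (from z z≤))
          (A.sym N (A.trans N (from-op x (lift₂ op y z) q x≤ yz)
                              (op-cong N (A.refl N) (from-op y z yz y≤ z≤))))))

  laws : CommutativeRingLaws raw
  laws = record
    { isEquivalence = record
      { refl  = λ { {n , x} → n , ≤′-reflexive ≡.refl , ≤′-reflexive ≡.refl , A.refl n }
      ; sym   = λ (k , p , q , e) → k , q , p , A.sym k e
      ; trans = λ {x} {y} {z} → trans-≈ᶜ x y z }
    ; +-cong = λ {x} {y} {u} {v} → lift₂-cong A._+_ A.+-cong from-+ x y u v
    ; +-assoc = lift₂-assoc A._+_ A.+-cong from-+ A.+-assoc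
    ; +-comm = lift₂-comm A._+_ A.+-cong from-+ A.+-comm
    ; +-identityˡ = λ x → eventually (R.0# R.+ x) x λ {N} p q →
        A.trans N (from-+ R.0# x p ℕₚ.z≤′n q)
          (A.trans N (A.+-congʳ N (T.0#-homo ℕₚ.z≤′n)) (A.+-identityˡ N (from x q)))
    ; -‿cong = λ { {m , x} {n , y} (k , p , q , e) → k , p , q ,
        A.trans k (T.-‿homo p x) (A.trans k (A.-‿cong k e) (A.sym k (T.-‿homo q y))) }
    ; -‿inverseˡ = λ x@(n , _) → eventually (R.- x R.+ x) R.0# λ {N} p q →
        let r = ≤ˡ n n p in
        A.trans N (from-+ (R.- x) x p r r)
          (A.trans N (A.+-congʳ N (T.-‿homo r (proj₂ x)))
            (A.trans N (A.-‿inverseˡ N (from x r)) (A.sym N (T.0#-homo q))))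
    ; *-cong = λ {x} {y} {u} {v} → lift₂-cong A._*_ A.*-cong from-* x y u v
    ; *-assoc = lift₂-assoc A._*_ A.*-cong from-* A.*-assoc
    ; *-comm = lift₂-comm A._*_ A.*-cong from-* A.*-comm
    ; *-identityˡ = λ x → eventually (R.1# R.* x) x λ {N} p q →
        A.trans N (from-* R.1# x p ℕₚ.z≤′n q)
          (A.trans N (A.*-congʳ N (T.1#-homo ℕₚ.z≤′n)) (A.*-identityˡ N (from x q)))
    ; distribʳ = λ z@(n , _) x@(l , _) y@(m , _) →
        eventually ((x R.+ y) R.* z) ((x R.* z) R.+ (y R.* z)) λ {N} p q →
        let xy = ≤ˡ (l ℕ.+ m) n p
            z≤ = ≤ʳ (l ℕ.+ m) n p
            x≤ = ≤ˡ l m xy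
            y≤ = ≤ʳ l m xy
            xz = ≤ˡ (l ℕ.+ n) (m ℕ.+ n) q
            yz = ≤ʳ (l ℕ.+ n) (m ℕ.+ n) q
        in A.trans N (from-* (x R.+ y) z p xy z≤)
          (A.trans N (A.*-congʳ N (from-+ x y xy x≤ y≤))
          (A.trans N (A.distribʳ N (from z z≤) (from x x≤) (from y y≤))
          (A.sym N (A.trans N (from-+ (x R.* z) (y R.* z) q xz yz)
            (A.+-cong N (from-* x z xz x≤ z≤) (from-* y z yz y≤ z≤))))))
    }

  colimit : CommutativeRing a ℓ
  colimit = CommutativeRingLaws.commutativeRing laws

  private
    module C = CommutativeRing colimit

  at-level : ∀ {n} {x y : A.Carrier n} → A._≈_ n x y → (n , x) ≈ᶜ (n , y)
  at-level {n} e = n , ≤′-reflexive ≡.refl , ≤′-reflexive ≡.refl , e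

  injectionHom : ∀ n → RingHom (A n) colimit
  injectionHom n = ringHom (A n) colimit (n ,_) at-level
    (λ x y → eventually (n , A._+_ n x y) ((n , x) R.+ (n , y)) λ {N} p q →
      A.trans N (T.+-homo p x y) (A.sym N (from-+ (n , x) (n , y) q p p)))
    (λ x y → eventually (n , A._*_ n x y) ((n , x) R.* (n , y)) λ {N} p q →
      A.trans N (T.*-homo p x y) (A.sym N (from-* (n , x) (n , y) q p p)))
    (eventually (n , A.1# n) R.1# λ {N} p q → A.trans N (T.1#-homo p) (A.sym N (T.1#-homo q)))

  module _ {p} (J : ∀ n → Ideal (A n) p)
           (step-J : ∀ n {x} → x ∈ Member (J n) → step.⟦_⟧ n x ∈ Member (J (suc n))) where
    private
      module J n = Ideal (J n)

    push-J : ∀ {m n} (m≤n : m ≤′ n) {x} → x ∈ Member (J m) → push m≤n x ∈ Member (J n)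
    push-J (≤′-reflexive ≡.refl) x∈ = x∈
    push-J (≤′-step {n} m≤n)     x∈ = step-J n (push-J m≤n x∈)

    later : ∀ (x : Element) {k N} (q : proj₁ x ≤′ k) → from x q ∈ Member (J k) →
            k ≤′ N → (r : proj₁ x ≤′ N) → from x r ∈ Member (J N)
    later (_ , x) {N = N} q x∈ s r = J.∈-resp-≈ N (push-any q s r x) (push-J s x∈)

    -- The union over n of the images of the J n: the element of the limit
    -- represented by x at stage n lies in it iff at some later stage x lies in J.
    unionIdeal : Ideal colimit p
    unionIdeal = record
      { Member   = λ (n , x) → ∃[ N ] Σ (n ≤′ N) λ n≤N → push n≤N x ∈ Member (J N)
      ; ∈-resp-≈ = λ { {x} {y} (k , q , r , e) (l , s , x∈) →
          k ℕ.+ l , ≤′t r (left k l) ,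
          J.∈-resp-≈ (k ℕ.+ l) (stays q r e (left k l) (≤′t q (left k l)) (≤′t r (left k l)))
            (later x s x∈ (right k l) (≤′t q (left k l))) }
      ; 0∈       = 0 , ≤′-reflexive ≡.refl , J.0∈ 0
      ; +-closed = λ { {x} {y} (k , q , x∈) (l , r , y∈) →
          let m = proj₁ x ; n = proj₁ y
              N = (k ℕ.+ l) ℕ.+ (m ℕ.+ n)
              kl = left (k ℕ.+ l) (m ℕ.+ n)
              mn = right (k ℕ.+ l) (m ℕ.+ n)
          in N , mn , J.∈-resp-≈ N (A.sym N (from-+ x y mn (≤ˡ m n mn) (≤ʳ m n mn)))
               (J.+-closed N (later x q x∈ (≤ˡ k l kl) (≤ˡ m n mn))
                             (later y r y∈ (≤ʳ k l kl) (≤ʳ m n mn))) }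
      ; *-closed = λ { r@(m , _) {x} (k , q , x∈) →
          let n = proj₁ x
              N = k ℕ.+ (m ℕ.+ n)
              mn = right k (m ℕ.+ n)
          in N , mn , J.∈-resp-≈ N (A.sym N (from-* r x mn (≤ˡ m n mn) (≤ʳ m n mn)))
               (J.*-closed N (from r (≤ˡ m n mn)) (later x q x∈ (left k (m ℕ.+ n)) (≤ʳ m n mn))) }
      }
      where
      ≤′t : ∀ {l m n} → l ≤′ m → m ≤′ n → l ≤′ n
      ≤′t = ℕₚ.≤′-trans

  module _ (φ : ∀ n → RingHom (A n) (A (suc n)))
           (φ-natural : ∀ n x → A._≈_ (suc (suc n)) (RingHomomorphism.⟦_⟧ (φ (suc n)) (step.⟦_⟧ n x))
                                                    (step.⟦_⟧ (suc n) (RingHomomorphism.⟦_⟧ (φ n) x))) where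
    private
      module φ n = RingHomomorphism (φ n)

    push-φ : ∀ {m n} (p : m ≤′ n) (q : suc m ≤′ suc n) x →
             A._≈_ (suc n) (push q (φ.⟦_⟧ m x)) (φ.⟦_⟧ n (push p x))
    push-φ {m} {n} p q x = A.trans (suc n) (push-irr q (ℕₚ.s≤′s p) (φ.⟦_⟧ m x)) (go p)
      where
      go : ∀ {n} (p : m ≤′ n) →
           A._≈_ (suc n) (push (ℕₚ.s≤′s p) (φ.⟦_⟧ m x)) (φ.⟦_⟧ n (push p x))
      go (≤′-reflexive ≡.refl) = A.refl (suc m)
      go (≤′-step {n} p) = A.trans (suc (suc n)) (step.⟦⟧-cong (suc n) (go p))
        (A.sym (suc (suc n)) (φ-natural n (push p x)))

    mapᶜ : Element → Element
    mapᶜ (n , x) = suc n , φ.⟦_⟧ n x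

    mapᶜ-op : (op : ∀ n → Op₂ (A.Carrier n)) →
      (∀ n {x y u v} → A._≈_ n x y → A._≈_ n u v → A._≈_ n (op n x u) (op n y v)) →
      (∀ (x y : Element) {N} (p : proj₁ x ℕ.+ proj₁ y ≤′ N) (q : proj₁ x ≤′ N) (r : proj₁ y ≤′ N) →
        A._≈_ N (from (lift₂ op x y) p) (op N (from x q) (from y r))) →
      (∀ n x y → A._≈_ (suc n) (φ.⟦_⟧ n (op n x y)) (op (suc n) (φ.⟦_⟧ n x) (φ.⟦_⟧ n y))) →
      ∀ x y → mapᶜ (lift₂ op x y) ≈ᶜ lift₂ op (mapᶜ x) (mapᶜ y)
    mapᶜ-op op op-cong from-op φ-op x@(m , _) y@(n , _) =
      suc N , ℕₚ.s≤′s mn , mn′ ,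
      A.trans (suc N) (push-φ mn (ℕₚ.s≤′s mn) (proj₂ (lift₂ op x y)))
        (A.trans (suc N) (φ.⟦⟧-cong N (from-op x y mn m≤ n≤))
        (A.trans (suc N) (φ-op N (from x m≤) (from y n≤))
        (A.sym (suc N) (A.trans (suc N) (from-op (mapᶜ x) (mapᶜ y) mn′ (ℕₚ.s≤′s m≤) (ℕₚ.s≤′s n≤))
          (op-cong (suc N) (push-φ m≤ (ℕₚ.s≤′s m≤) (proj₂ x)) (push-φ n≤ (ℕₚ.s≤′s n≤) (proj₂ y)))))))
      where
      N : ℕ
      N = m ℕ.+ suc n
      mn : m ℕ.+ n ≤′ N
      mn = ℕₚ.≤⇒≤′ (ℕₚ.+-monoʳ-≤ m (ℕₚ.n≤1+n n))
      mn′ : suc m ℕ.+ suc n ≤′ suc N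
      mn′ = ≤′-reflexive ≡.refl
      m≤ : m ≤′ N
      m≤ = ≤ˡ m n mn
      n≤ : n ≤′ N
      n≤ = ≤ʳ m n mn

    colimitMap : RingHom colimit colimit
    colimitMap = ringHom colimit colimit mapᶜ
      (λ { {m , x} {n , y} (k , p , q , e) → suc k , ℕₚ.s≤′s p , ℕₚ.s≤′s q ,
        A.trans (suc k) (push-φ p (ℕₚ.s≤′s p) x)
          (A.trans (suc k) (φ.⟦⟧-cong k e) (A.sym (suc k) (push-φ q (ℕₚ.s≤′s q) y))) })
      (mapᶜ-op A._+_ A.+-cong from-+ φ.+-homo)
      (mapᶜ-op A._*_ A.*-cong from-* φ.*-homo)
      (eventually (mapᶜ R.1#) R.1# λ {N} p q →
        A.trans N (T.⟦⟧-cong p (φ.1#-homo 0)) (A.trans N (T.1#-homo p) (A.sym N (T.1#-homo q))))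

    colimitMap-∈ : ∀ {p} (J : ∀ n → Ideal (A n) p)
      (step-J : ∀ n {x} → x ∈ Member (J n) → step.⟦_⟧ n x ∈ Member (J (suc n))) →
      (∀ n {x} → x ∈ Member (J n) → φ.⟦_⟧ n x ∈ Member (J (suc n))) →
      ∀ {x} → x ∈ Member (unionIdeal J step-J) → mapᶜ x ∈ Member (unionIdeal J step-J)
    colimitMap-∈ J step-J φ-J {n , x} (N , p , x∈) = suc N , ℕₚ.s≤′s p ,
      Ideal.∈-resp-≈ (J (suc N)) (A.sym (suc N) (push-φ p (ℕₚ.s≤′s p) x)) (φ-J N x∈)

-- The inverse limit of the quotients A / F i.
module Completion {a ℓ i r p} (A : CommutativeRing a ℓ)
                  {I : Set i} (_⊑_ : Rel I r) (F : I → Ideal A p) where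
  private
    module A = RingNotation A
    module Q i = CommutativeRing (A / F i)

  record Compatible : Set (a ⊔ i ⊔ r ⊔ p) where
    constructor compatibleFamily
    field
      component  : I → A.Carrier
      compatible : ∀ {i j} → i ⊑ j → Q._≈_ i (component i) (component j)

  open Compatible public

  lift₂ : (op : Op₂ A.Carrier) →
          (∀ i {x y u v} → Q._≈_ i x y → Q._≈_ i u v → Q._≈_ i (op x u) (op y v)) →
          Op₂ Compatible
  lift₂ op cong x y = compatibleFamily (λ i → op (component x i) (component y i))
                                       (λ {i} i⊑j → cong i (compatible x i⊑j) (compatible y i⊑j))

  diagonal : A.Carrier → Compatible
  diagonal x = compatibleFamily (λ _ → x) (λ {i} _ → Q.refl i)

  completion : CommutativeRing (a ⊔ i ⊔ r ⊔ p) (i ⊔ p)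
  completion = CommutativeRingLaws.commutativeRing {A = raw} (record
    { isEquivalence = record
      { refl  = λ i → Q.refl i
      ; sym   = λ x≈y i → Q.sym i (x≈y i)
      ; trans = λ x≈y y≈z i → Q.trans i (x≈y i) (y≈z i) }
    ; +-cong      = λ x≈y u≈v i → Q.+-cong i (x≈y i) (u≈v i)
    ; +-assoc     = λ x y z i → Q.+-assoc i (component x i) (component y i) (component z i)
    ; +-comm      = λ x y i → Q.+-comm i (component x i) (component y i)
    ; +-identityˡ = λ x i → Q.+-identityˡ i (component x i)
    ; -‿cong      = λ x≈y i → Q.-‿cong i (x≈y i)
    ; -‿inverseˡ  = λ x i → Q.-‿inverseˡ i (component x i)
    ; *-cong      = λ x≈y u≈v i → Q.*-cong i (x≈y i) (u≈v i)
    ; *-assoc     = λ x y z i → Q.*-assoc i (component x i) (component y i) (component z i)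
    ; *-comm      = λ x y i → Q.*-comm i (component x i) (component y i)
    ; *-identityˡ = λ x i → Q.*-identityˡ i (component x i)
    ; distribʳ    = λ z x y i → Q.distribʳ i (component z i) (component x i) (component y i)
    })
    where
    raw : RawRing (a ⊔ i ⊔ r ⊔ p) (i ⊔ p)
    raw = record
      { Carrier = Compatible
      ; _≈_ = λ x y → ∀ i → Q._≈_ i (component x i) (component y i)
      ; _+_ = lift₂ A._+_ (λ i → Q.+-cong i)
      ; _*_ = lift₂ A._*_ (λ i → Q.*-cong i)
      ; -_  = λ x → compatibleFamily (λ i → A.- (component x i)) (λ {i} i⊑j → Q.-‿cong i (compatible x i⊑j))
      ; 0#  = diagonal A.0#
      ; 1#  = diagonal A.1# }

  diagonalHom : RingHom A completion
  diagonalHom = ringHom A completion diagonal (λ x≈y i → RingHomomorphism.⟦⟧-cong (quotientHom A (F i)) x≈y)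
    (λ x y i → Q.refl i) (λ x y i → Q.refl i) (λ i → Q.refl i)

  completionMap : (φ : RingHom A A) →
    (∀ i {x} → x ∈ Member (F i) → RingHomomorphism.⟦_⟧ φ x ∈ Member (F i)) →
    RingHom completion completion
  completionMap φ φ-F = ringHom completion completion
    (λ x → compatibleFamily (λ i → φ.⟦_⟧ (component x i)) (λ {i} i⊑j → Φ.⟦⟧-cong i (compatible x i⊑j)))
    (λ x≈y i → Φ.⟦⟧-cong i (x≈y i))
    (λ x y i → Φ.+-homo i (component x i) (component y i))
    (λ x y i → Φ.*-homo i (component x i) (component y i))
    (λ i → Φ.1#-homo i)
    where
    module φ = RingHomomorphism φ
    module Φ i = RingHomomorphism (quotientMap (F i) (F i) φ (φ-F i))

module PowerSeries {a ℓ} (A : CommutativeRing a ℓ) where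
  open RingNotation A

  Seq : Set a
  Seq = ℕ → Carrier

  infix 4 _≋_
  _≋_ : Rel Seq ℓ
  p ≋ q = ∀ n → p n ≈ q n

  tail : Seq → Seq
  tail p n = p (suc n)

  constant : Carrier → ℕ → Carrier
  constant x zero    = x
  constant x (suc n) = 0#

  indeterminate : ℕ → Carrier
  indeterminate zero    = 0#
  indeterminate (suc n) = constant 1# n

  -- Cauchy product: p = p 0 + X · tail p, so p · q = p 0 · q + X · (tail p · q).
  convolution : Op₂ (ℕ → Carrier)
  convolution p q zero    = p zero * q zero
  convolution p q (suc n) = p zero * q (suc n) + convolution (λ k → p (suc k)) q n

  infixl 7 _·_
  _·_ : Op₂ Seq
  _·_ = convolution

  ·-cong : ∀ {p p′ q q′} → p ≋ p′ → q ≋ q′ → (p · q) ≋ (p′ · q′)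
  ·-cong p≋ q≋ zero    = *-cong (p≋ 0) (q≋ 0)
  ·-cong p≋ q≋ (suc n) = +-cong (*-cong (p≋ 0) (q≋ (suc n))) (·-cong (λ k → p≋ (suc k)) q≋ n)

  0·q : ∀ q → ((λ _ → 0#) · q) ≋ (λ _ → 0#)
  0·q q zero    = zeroˡ (q 0)
  0·q q (suc n) = trans (+-cong (zeroˡ (q (suc n))) (0·q q n)) (+-identityˡ 0#)

  1·q : ∀ q → (constant 1# · q) ≋ q
  1·q q zero    = *-identityˡ (q 0)
  1·q q (suc n) = trans (+-cong (*-identityˡ (q (suc n))) (0·q q n)) (+-identityʳ (q (suc n)))

  distrib : ∀ r p q → ((λ k → p k + q k) · r) ≋ (λ n → (p · r) n + (q · r) n)
  distrib r p q zero    = distribʳ (r 0) (p 0) (q 0)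
  distrib r p q (suc n) = trans
    (+-cong (distribʳ (r (suc n)) (p 0) (q 0)) (distrib r (tail p) (tail q) n))
    (+-medial (p 0 * r (suc n)) (q 0 * r (suc n)) ((tail p · r) n) ((tail q · r) n))

  scale : ∀ x p q → ((λ k → x * p k) · q) ≋ (λ n → x * (p · q) n)
  scale x p q zero    = *-assoc x (p 0) (q 0)
  scale x p q (suc n) = trans
    (+-cong (*-assoc x (p 0) (q (suc n))) (scale x (tail p) q n))
    (sym (distribˡ x (p 0 * q (suc n)) ((tail p · q) n)))

  last-term : ∀ p q n → (p · q) (suc n) ≈ ((p · tail q) n + p (suc n) * q 0)
  last-term p q zero    = refl
  last-term p q (suc n) = trans (+-congˡ (last-term (tail p) q n))
    (sym (+-assoc (p 0 * q (suc (suc n))) ((tail p · tail q) n) (p (suc (suc n)) * q 0)))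

  ·-comm : ∀ p q → (p · q) ≋ (q · p)
  ·-comm p q zero    = *-comm (p 0) (q 0)
  ·-comm p q (suc n) = begin
    p 0 * q (suc n) + (tail p · q) n    ≈⟨ +-cong (*-comm (p 0) (q (suc n))) (·-comm (tail p) q n) ⟩
    q (suc n) * p 0 + (q · tail p) n    ≈⟨ +-comm (q (suc n) * p 0) ((q · tail p) n) ⟩
    (q · tail p) n + q (suc n) * p 0    ≈⟨ last-term q p n ⟨
    (q · p) (suc n)                     ∎
    where open ≈-Reasoning

  ·-assoc : ∀ p q r → ((p · q) · r) ≋ (p · (q · r))
  ·-assoc p q r zero    = *-assoc (p 0) (q 0) (r 0)
  ·-assoc p q r (suc n) = begin
    (p 0 * q 0) * r (suc n) + (tail (p · q) · r) n
      ≈⟨ +-cong (*-assoc (p 0) (q 0) (r (suc n))) (distrib r (λ k → p 0 * q (suc k)) (tail p · q) n) ⟩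
    p 0 * (q 0 * r (suc n)) + (((λ k → p 0 * q (suc k)) · r) n + ((tail p · q) · r) n)
      ≈⟨ +-congˡ (+-cong (scale (p 0) (tail q) r n) (·-assoc (tail p) q r n)) ⟩
    p 0 * (q 0 * r (suc n)) + (p 0 * (tail q · r) n + (tail p · (q · r)) n)
      ≈⟨ +-assoc (p 0 * (q 0 * r (suc n))) (p 0 * (tail q · r) n) ((tail p · (q · r)) n) ⟨
    (p 0 * (q 0 * r (suc n)) + p 0 * (tail q · r) n) + (tail p · (q · r)) n
      ≈⟨ +-congʳ (distribˡ (p 0) (q 0 * r (suc n)) ((tail q · r) n)) ⟨
    p 0 * (q · r) (suc n) + (tail p · (q · r)) n ∎
    where open ≈-Reasoning

  powerSeries : CommutativeRing a ℓ
  powerSeries = CommutativeRingLaws.commutativeRing {A = raw} (record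
    { isEquivalence = record
      { refl  = λ n → refl
      ; sym   = λ p≋q n → sym (p≋q n)
      ; trans = λ p≋q q≋r n → trans (p≋q n) (q≋r n) }
    ; +-cong      = λ p≋q r≋s n → +-cong (p≋q n) (r≋s n)
    ; +-assoc     = λ p q r n → +-assoc (p n) (q n) (r n)
    ; +-comm      = λ p q n → +-comm (p n) (q n)
    ; +-identityˡ = λ p n → +-identityˡ (p n)
    ; -‿cong      = λ p≋q n → -‿cong (p≋q n)
    ; -‿inverseˡ  = λ p n → -‿inverseˡ (p n)
    ; *-cong      = ·-cong
    ; *-assoc     = ·-assoc
    ; *-comm      = ·-comm
    ; *-identityˡ = 1·q
    ; distribʳ    = distrib
    })
    where
    raw : RawRing a ℓ
    raw = record
      { Carrier = ℕ → Carrier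
      ; _≈_ = λ p q → ∀ n → p n ≈ q n
      ; _+_ = λ p q n → p n + q n
      ; _*_ = convolution
      ; -_  = λ p n → - (p n)
      ; 0#  = λ _ → 0#
      ; 1#  = constant 1# }

  constantHom : RingHom A powerSeries
  constantHom = ringHom A powerSeries constant
    (λ { x≈y zero → x≈y ; x≈y (suc n) → refl })
    (λ { x y zero → refl ; x y (suc n) → sym (+-identityˡ 0#) })
    (λ { x y zero → refl
       ; x y (suc n) → sym (trans (+-cong (zeroʳ x) (0·q (constant y) n)) (+-identityˡ 0#)) })
    (λ n → refl)

module _ {a ℓa b ℓb} (A : CommutativeRing a ℓa) (B : CommutativeRing b ℓb) (φ : RingHom A B) where
  private
    module φ = RingHomomorphism φ
    module B = CommutativeRing B
    module SA = PowerSeries A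
    module SB = PowerSeries B

  conv-homo : ∀ p q n → φ.⟦_⟧ (SA.convolution p q n)
                B.≈ SB.convolution (λ k → φ.⟦_⟧ (p k)) (λ k → φ.⟦_⟧ (q k)) n
  conv-homo p q zero    = φ.*-homo (p 0) (q 0)
  conv-homo p q (suc n) = B.trans
    (φ.+-homo (CommutativeRing._*_ A (p 0) (q (suc n))) (SA.convolution (λ k → p (suc k)) q n))
    (B.+-cong (φ.*-homo (p 0) (q (suc n))) (conv-homo (λ k → p (suc k)) q n))

  mapConstant : ∀ x n → φ.⟦_⟧ (SA.constant x n) B.≈ SB.constant (φ.⟦_⟧ x) n
  mapConstant x zero    = B.refl
  mapConstant x (suc n) = φ.0#-homo

  mapCoefficients : RingHom SA.powerSeries SB.powerSeries
  mapCoefficients = ringHom SA.powerSeries SB.powerSeries (λ p n → φ.⟦_⟧ (p n))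
    (λ p≈q n → φ.⟦⟧-cong (p≈q n))
    (λ p q n → φ.+-homo (p n) (q n))
    conv-homo
    (λ n → B.trans (mapConstant (CommutativeRing.1# A) n) (one n))
    where
    one : ∀ n → SB.constant (φ.⟦_⟧ (CommutativeRing.1# A)) n B.≈ SB.constant B.1# n
    one zero    = φ.1#-homo
    one (suc n) = B.refl

record CommutativeAlgebra {k ℓ} (K : CommutativeRing k ℓ) (a ℓa : Level) : Set (k ⊔ ℓ ⊔ lsuc (a ⊔ ℓa)) where
  field
    ring         : CommutativeRing a ℓa
    structureMap : RingHom K ring
  open RingNotation ring public hiding (ring)
  scalar : CommutativeRing.Carrier K → Carrier
  scalar = RingHomomorphism.⟦_⟧ structureMap

record AlgebraHom {k ℓ a ℓa b ℓb} {K : CommutativeRing k ℓ}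
                  (A : CommutativeAlgebra K a ℓa) (B : CommutativeAlgebra K b ℓb) :
                  Set (k ⊔ a ⊔ ℓa ⊔ b ⊔ ℓb) where
  private
    module A = CommutativeAlgebra A
    module B = CommutativeAlgebra B
  field
    ringHomomorphism : RingHom A.ring B.ring
  open HomLaws A.ring B.ring ringHomomorphism public
  field
    scalar-homo : ∀ c → ⟦ A.scalar c ⟧ B.≈ B.scalar c

module _ {k ℓ} {K : CommutativeRing k ℓ} where

  idᴬ : ∀ {a ℓa} (A : CommutativeAlgebra K a ℓa) → AlgebraHom A A
  idᴬ A = record { ringHomomorphism = idHom ring ; scalar-homo = λ c → refl }
    where open CommutativeAlgebra A

  infixr 9 _∘ᴬ_

  _∘ᴬ_ : ∀ {a ℓa b ℓb c ℓc} {A : CommutativeAlgebra K a ℓa} {B : CommutativeAlgebra K b ℓb}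
         {C : CommutativeAlgebra K c ℓc} → AlgebraHom B C → AlgebraHom A B → AlgebraHom A C
  _∘ᴬ_ {A = A} {B} {C} ψ φ = record
    { ringHomomorphism = compose A.ring B.ring C.ring ψ.ringHomomorphism φ.ringHomomorphism
    ; scalar-homo = λ c → C.trans (ψ.⟦⟧-cong (φ.scalar-homo c)) (ψ.scalar-homo c) }
    where
    module A = CommutativeAlgebra A
    module B = CommutativeAlgebra B
    module C = CommutativeAlgebra C
    module φ = AlgebraHom φ
    module ψ = AlgebraHom ψ

  homSetoid : ∀ {a ℓa b ℓb} → CommutativeAlgebra K a ℓa → CommutativeAlgebra K b ℓb →
              Setoid (k ⊔ a ⊔ ℓa ⊔ b ⊔ ℓb) (a ⊔ ℓb)
  homSetoid A B = record
    { Carrier = AlgebraHom A B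
    ; _≈_ = λ φ ψ → ∀ x → AlgebraHom.⟦_⟧ φ x B.≈ AlgebraHom.⟦_⟧ ψ x
    ; isEquivalence = record
      { refl  = λ x → B.refl
      ; sym   = λ φ≈ψ x → B.sym (φ≈ψ x)
      ; trans = λ φ≈ψ ψ≈χ x → B.trans (φ≈ψ x) (ψ≈χ x) } }
    where module B = CommutativeAlgebra B

-- K-schemes are taken as functors of points: they form a full subcategory of
-- the set-valued functors on K-algebras, so the morphisms between two of them
-- are exactly the natural transformations.

module FunctorOfPoints {k ℓ} (K : CommutativeRing k ℓ) (a : Level) where

  Algebra : Set (k ⊔ ℓ ⊔ lsuc a)
  Algebra = CommutativeAlgebra K a a

  record KFunctor : Set (lsuc (k ⊔ ℓ ⊔ a)) where
    field
      Points : Algebra → Setoid (k ⊔ a) a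
    module Points T = Setoid (Points T)
    field
      act      : ∀ {S T} → AlgebraHom S T → Points.Carrier S → Points.Carrier T
      act-cong : ∀ {S T} {φ ψ : AlgebraHom S T} {x y} → Setoid._≈_ (homSetoid S T) φ ψ →
                 Points._≈_ S x y → Points._≈_ T (act φ x) (act ψ y)
      act-id   : ∀ {T} x → Points._≈_ T (act (idᴬ T) x) x
      act-∘    : ∀ {S T U} (ψ : AlgebraHom T U) (φ : AlgebraHom S T) x →
                 Points._≈_ U (act (ψ ∘ᴬ φ) x) (act ψ (act φ x))

  open KFunctor public using (Points)

  infix 4 _⇒_

  record _⇒_ (X Y : KFunctor) : Set (lsuc a ⊔ k ⊔ ℓ) where
    private
      module X = KFunctor X
      module Y = KFunctor Y
    field
      onPoints : ∀ T → Func (X.Points T) (Y.Points T)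
    η : ∀ T → X.Points.Carrier T → Y.Points.Carrier T
    η T = Func.to (onPoints T)
    field
      natural : ∀ {S T} (φ : AlgebraHom S T) x → Y.Points._≈_ T (η T (X.act φ x)) (Y.act φ (η S x))

  open _⇒_ public using (η)

  infix 4 _≈⇒_

  _≈⇒_ : ∀ {X Y} → Rel (X ⇒ Y) (lsuc a ⊔ k ⊔ ℓ)
  _≈⇒_ {X} {Y} α β = ∀ T x → Setoid._≈_ (Points Y T) (η α T x) (η β T x)

  id⇒ : ∀ {X} → X ⇒ X
  id⇒ {X} = record
    { onPoints = λ T → record { to = λ x → x ; cong = λ x≈y → x≈y }
    ; natural  = λ {S} {T} φ x → Setoid.refl (Points X T) }

  infixr 9 _∘⇒_

  _∘⇒_ : ∀ {X Y Z} → Y ⇒ Z → X ⇒ Y → X ⇒ Z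
  _∘⇒_ {X} {Y} {Z} β α = record
    { onPoints = λ T → record
        { to   = λ x → η β T (η α T x)
        ; cong = λ x≈y → Func.cong (_⇒_.onPoints β T) (Func.cong (_⇒_.onPoints α T) x≈y) }
    ; natural = λ {S} {T} φ x → Setoid.trans (Points Z T)
        (Func.cong (_⇒_.onPoints β T) (_⇒_.natural α φ x)) (_⇒_.natural β φ (η α S x)) }

  infix 4 _≅_

  record _≅_ (X Y : KFunctor) : Set (lsuc a ⊔ k ⊔ ℓ) where
    field
      to       : X ⇒ Y
      from     : Y ⇒ X
      from∘to  : (from ∘⇒ to) ≈⇒ id⇒
      to∘from  : (to ∘⇒ from) ≈⇒ id⇒

  Spec : Algebra → KFunctor
  Spec A = record
    { Points   = λ T → homSetoid A T
    ; act      = λ φ x → φ ∘ᴬ x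
    ; act-cong = λ {S} {T} {φ} {ψ} {x} {y} φ≈ψ x≈y s → CommutativeAlgebra.trans T
        (AlgebraHom.⟦⟧-cong φ (x≈y s)) (φ≈ψ (AlgebraHom.⟦_⟧ y s))
    ; act-id   = λ {T} x s → CommutativeAlgebra.refl T
    ; act-∘    = λ {S} {T} {U} ψ φ x s → CommutativeAlgebra.refl U }

  Spec₁ : ∀ {A B} → AlgebraHom A B → Spec B ⇒ Spec A
  Spec₁ φ = record
    { onPoints = λ T → record { to = λ x → x ∘ᴬ φ ; cong = λ x≈y s → x≈y (AlgebraHom.⟦_⟧ φ s) }
    ; natural  = λ {S} {T} ψ x s → CommutativeAlgebra.refl T }

record Polynomial {a ℓ} (A : CommutativeRing a ℓ) : Set (a ⊔ ℓ) where
  open CommutativeRing A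
  field
    coeff    : ℕ → Carrier
    bound    : ℕ
    vanishes : ∀ {n} → bound ℕ.< n → coeff n ≈ 0#

open Polynomial using (coeff)

module _ {a ℓ} {A : CommutativeRing a ℓ} where
  open CommutativeRing A

  IsMonicOfDegree : Polynomial A → ℕ → Set ℓ
  IsMonicOfDegree f n = (coeff f n ≈ 1#) × (∀ {m} → n ℕ.< m → coeff f m ≈ 0#)

mapPolynomial : ∀ {a ℓa b ℓb} (A : CommutativeRing a ℓa) (B : CommutativeRing b ℓb) →
                RingHom A B → Polynomial A → Polynomial B
mapPolynomial A B φ f = record
  { coeff    = λ n → φ.⟦_⟧ (coeff f n)
  ; bound    = Polynomial.bound f
  ; vanishes = λ b<n → CommutativeRing.trans B (φ.⟦⟧-cong (Polynomial.vanishes f b<n)) φ.0#-homo }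
  where module φ = RingHomomorphism φ

monomial : ∀ {a ℓ} (A : CommutativeRing a ℓ) → ℕ → Polynomial A
monomial A n = record
  { coeff    = δ n
  ; bound    = n
  ; vanishes = above n }
  where
  open CommutativeRing A hiding (zero)
  δ : ℕ → ℕ → Carrier
  δ zero    zero    = 1#
  δ zero    (suc m) = 0#
  δ (suc n) zero    = 0#
  δ (suc n) (suc m) = δ n m
  above : ∀ n {m} → n ℕ.< m → δ n m ≈ 0#
  above zero    (ℕ.s≤s _)   = refl
  above (suc n) (ℕ.s≤s n<m) = above n n<m

module Series {k ℓ} (K : CommutativeRing k ℓ) where
  private
    module K = CommutativeRing K

  -- series n = K[[w₀,…,wₙ₋₁]], built as K[[w₁,…,wₙ₋₁]][[w₀]].
  series : ℕ → CommutativeRing k ℓ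
  series zero    = K
  series (suc n) = PowerSeries.powerSeries (series n)

  private
    module S n = RingNotation (series n)

  coefficient : ∀ {n} → S.Carrier n → Vec ℕ n → K.Carrier
  coefficient p []      = p
  coefficient p (i ∷ α) = coefficient (p i) α

  var : ∀ {n} → Fin n → S.Carrier n
  var {suc n} zero    = PowerSeries.indeterminate (series n)
  var {suc n} (suc i) = PowerSeries.constant (series n) (var i)

  scalarHom : ∀ n → RingHom K (series n)
  scalarHom zero    = idHom K
  scalarHom (suc n) = compose K (series n) (series (suc n)) (PowerSeries.constantHom (series n)) (scalarHom n)

  seriesAlgebra : ℕ → CommutativeAlgebra K k ℓ
  seriesAlgebra n = record { ring = series n ; structureMap = scalarHom n }

  -- wᵢ ↦ wᵢ₊₁
  raise : ∀ n → AlgebraHom (seriesAlgebra n) (seriesAlgebra (suc n))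
  raise n = record
    { ringHomomorphism = PowerSeries.constantHom (series n)
    ; scalar-homo      = λ c → S.refl (suc n) }

  -- wᵢ ↦ wᵢ
  includeHom : ∀ n → RingHom (series n) (series (suc n))
  includeHom zero    = PowerSeries.constantHom K
  includeHom (suc n) = mapCoefficients (series n) (series (suc n)) (includeHom n)

  private
    module I n = RingHomomorphism (includeHom n)

  constant-cong : ∀ n {x y} → S._≈_ n x y →
    S._≈_ (suc n) (PowerSeries.constant (series n) x) (PowerSeries.constant (series n) y)
  constant-cong n = RingHomomorphism.⟦⟧-cong (PowerSeries.constantHom (series n))

  include-scalar : ∀ n c → S._≈_ (suc n) (I.⟦_⟧ n (RingHomomorphism.⟦_⟧ (scalarHom n) c))
                                         (RingHomomorphism.⟦_⟧ (scalarHom (suc n)) c)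
  include-scalar zero    c = S.refl 1
  include-scalar (suc n) c = S.trans (suc (suc n))
    (mapConstant (series n) (series (suc n)) (includeHom n) (RingHomomorphism.⟦_⟧ (scalarHom n) c))
    (constant-cong (suc n) (include-scalar n c))

  include : ∀ n → AlgebraHom (seriesAlgebra n) (seriesAlgebra (suc n))
  include n = record { ringHomomorphism = includeHom n ; scalar-homo = include-scalar n }

  raise-include : ∀ n x → S._≈_ (suc (suc n)) (AlgebraHom.⟦_⟧ (raise (suc n)) (I.⟦_⟧ n x))
                                              (I.⟦_⟧ (suc n) (AlgebraHom.⟦_⟧ (raise n) x))
  raise-include n x = S.sym (suc (suc n)) (mapConstant (series n) (series (suc n)) (includeHom n) x)

  raise-var : ∀ {n} (i : Fin n) → S._≈_ (suc n) (AlgebraHom.⟦_⟧ (raise n) (var i)) (var (suc i))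
  raise-var {n} i = S.refl (suc n)

  include-var : ∀ {n} (i : Fin n) → S._≈_ (suc n) (I.⟦_⟧ n (var i)) (var (inject₁ i))
  include-var {suc n} zero zero    = I.0#-homo n
  include-var {suc n} zero (suc m) = S.trans (suc n)
    (mapConstant (series n) (series (suc n)) (includeHom n) (S.1# n) m) (constant-cong (suc n) (I.1#-homo n) m)
  include-var {suc n} (suc i) = S.trans (suc (suc n))
    (mapConstant (series n) (series (suc n)) (includeHom n) (var i)) (constant-cong (suc n) (include-var i))

  Vanishing : ∀ {n} → (Vec ℕ n → Set) → S.Carrier n → Set ℓ
  Vanishing T p = ∀ α → T α → coefficient p α K.≈ K.0#

  coefficient-cong : ∀ {n} {p q : S.Carrier n} → S._≈_ n p q → ∀ (α : Vec ℕ n) →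
    coefficient p α K.≈ coefficient q α
  coefficient-cong p≈q []      = p≈q
  coefficient-cong {p = p} {q} p≈q (i ∷ α) = coefficient-cong {p = p i} {q i} (p≈q i) α

  coefficient-0 : ∀ {n} (α : Vec ℕ n) → coefficient (S.0# n) α K.≈ K.0#
  coefficient-0 []      = K.refl
  coefficient-0 (i ∷ α) = coefficient-0 α

  coefficient-+ : ∀ {n} (p q : S.Carrier n) (α : Vec ℕ n) →
    coefficient (S._+_ n p q) α K.≈ (coefficient p α K.+ coefficient q α)
  coefficient-+ p q []      = K.refl
  coefficient-+ p q (i ∷ α) = coefficient-+ (p i) (q i) α

  vanishing-+ : ∀ {n} {T : Vec ℕ n → Set} {p q : S.Carrier n} →
    Vanishing T p → Vanishing T q → Vanishing T (S._+_ n p q)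
  vanishing-+ {p = p} {q} vp vq α t = K.trans (coefficient-+ p q α)
    (K.trans (K.+-cong (vp α t) (vq α t)) (K.+-identityˡ K.0#))

  DownClosed : ∀ {n} → (Vec ℕ n → Set) → Set
  DownClosed T = ∀ {α β} → Pointwise ℕ._≤_ α β → T β → T α

  pointwise-refl : ∀ {n} (α : Vec ℕ n) → Pointwise ℕ._≤_ α α
  pointwise-refl []      = []
  pointwise-refl (i ∷ α) = ℕₚ.≤-refl ∷ pointwise-refl α

  vanishing-* : ∀ {n} {T : Vec ℕ n → Set} → DownClosed T →
    ∀ q {p : S.Carrier n} → Vanishing T p → Vanishing T (S._*_ n q p)
  vanishing-* {zero} down q vp [] t = K.trans (K.*-congˡ (vp [] t)) (K.zeroʳ q)
  vanishing-* {suc n} {T} down q {p} vp (i ∷ α) = go q i α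
    where
    slice-down : ∀ i → DownClosed (λ α → T (i ∷ α))
    slice-down i α≤β = down (ℕₚ.≤-refl ∷ α≤β)
    go : ∀ q i → Vanishing (λ α → T (i ∷ α)) (PowerSeries.convolution (series n) q p i)
    go q zero    = vanishing-* (slice-down 0) (q 0) (λ α → vp (0 ∷ α))
    go q (suc i) = vanishing-+ {p = S._*_ n (q 0) (p (suc i))}
      (vanishing-* (slice-down (suc i)) (q 0) (λ α → vp (suc i ∷ α)))
      (λ α t → go (λ m → q (suc m)) i α (down (ℕₚ.n≤1+n i ∷ pointwise-refl α) t))

  vanishingIdeal : ∀ {n} (T : Vec ℕ n → Set) →
    (∀ {α β} → Pointwise ℕ._≤_ α β → T β → T α) → Ideal (series n) ℓ
  vanishingIdeal {n} T down = record
    { Member   = Vanishing T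
    ; ∈-resp-≈ = λ {p} {q} p≈q vp α t → K.trans (K.sym (coefficient-cong {p = p} {q} p≈q α)) (vp α t)
    ; 0∈       = λ α _ → coefficient-0 α
    ; +-closed = λ {p} {q} → vanishing-+ {p = p} {q}
    ; *-closed = λ q {p} → vanishing-* down q {p}
    }

  raise-vanishing : ∀ {n} (T : Vec ℕ n → Set) (U : Vec ℕ (suc n) → Set) → (∀ α → U (0 ∷ α) → T α) →
    ∀ p → Vanishing T p → Vanishing U (AlgebraHom.⟦_⟧ (raise n) p)
  raise-vanishing T U U⇒T p vp (zero ∷ α)  u = vp α (U⇒T α u)
  raise-vanishing T U U⇒T p vp (suc i ∷ α) u = coefficient-0 α

  include-vanishing : ∀ {n} (T : Vec ℕ n → Set) (U : Vec ℕ (suc n) → Set) → (∀ α → U (α ∷ʳ 0) → T α) →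
    ∀ p → Vanishing T p → Vanishing U (I.⟦_⟧ n p)
  include-vanishing {zero}  T U U⇒T p vp (zero ∷ [])  u = vp [] (U⇒T [] u)
  include-vanishing {zero}  T U U⇒T p vp (suc i ∷ []) u = K.refl
  include-vanishing {suc n} T U U⇒T p vp (i ∷ α)      u =
    include-vanishing (λ β → T (i ∷ β)) (λ β → U (i ∷ β)) (λ β → U⇒T (i ∷ β)) (p i) (λ β → vp (i ∷ β)) α u

module _ {k ℓ a ℓa} {K : CommutativeRing k ℓ} (A : CommutativeAlgebra K a ℓa) where
  open CommutativeAlgebra A

  -- wⁿ h(w⁻¹), for h of degree at most n
  reversed : Polynomial K → ℕ → Carrier → Carrier
  reversed h n w = ∑[ j ≤ n ] (scalar (coeff h (toℕ j)) * w ^ (n ∸ toℕ j))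

  -- yᵉ xᵈ (g(y⁻¹) − f(x⁻¹)), for f and g of degree d and e
  relation : (f g : Polynomial K) (d e : ℕ) → Carrier → Carrier → Carrier
  relation f g d e x y = x ^ d * reversed g e y - y ^ e * reversed f d x

module _ {k ℓ a ℓa b ℓb} {K : CommutativeRing k ℓ}
         (A : CommutativeAlgebra K a ℓa) (B : CommutativeAlgebra K b ℓb) (φ : AlgebraHom A B) where
  private
    module A = CommutativeAlgebra A
    module B = CommutativeAlgebra B
  open AlgebraHom φ

  reversed-homo : ∀ h n {x y} → ⟦ x ⟧ B.≈ y → ⟦ reversed A h n x ⟧ B.≈ reversed B h n y
  reversed-homo h n {x} {y} x↦y = B.trans
    (sum-homo (λ (j : Fin (suc n)) → A.scalar (coeff h (toℕ j)) A.* x A.^ (n ∸ toℕ j)))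
    (B.sum-cong-≋ λ (j : Fin (suc n)) → B.trans
      (*-homo (A.scalar (coeff h (toℕ j))) (x A.^ (n ∸ toℕ j)))
      (B.*-cong (scalar-homo (coeff h (toℕ j)))
        (B.trans (^-homo x (n ∸ toℕ j)) (B.^-congˡ (n ∸ toℕ j) x↦y))))

  relation-homo : ∀ f g d e {x y u v} → ⟦ x ⟧ B.≈ u → ⟦ y ⟧ B.≈ v →
                  ⟦ relation A f g d e x y ⟧ B.≈ relation B f g d e u v
  relation-homo f g d e {x} {y} x↦u y↦v = B.trans
    (sub-homo (x A.^ d A.* reversed A g e y) (y A.^ e A.* reversed A f d x))
    (B.+-cong (product x d x↦u (reversed-homo g e y↦v))
              (B.-‿cong (product y e y↦v (reversed-homo f d x↦u))))
    where
    product : ∀ x n {u p q} → ⟦ x ⟧ B.≈ u → ⟦ p ⟧ B.≈ q → ⟦ x A.^ n A.* p ⟧ B.≈ (u B.^ n B.* q)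
    product x n {p = p} x↦u p↦q = B.trans (*-homo (x A.^ n) p)
      (B.*-cong (B.trans (^-homo x n) (B.^-congˡ n x↦u)) p↦q)

module Weight (d e : ℕ) (1≤e : 1 ℕ.≤ e) (e<d : e ℕ.< d) where
  private
    instance
      e≢0 : NonZero e
      e≢0 = ℕ.>-nonZero 1≤e

  ratio : ℚ
  ratio = ℤ.+ d ℚ./ e

  -- Σᵢ αᵢ (d/e)ⁱ in Horner form
  weight : ∀ {n} → Vec ℕ n → ℚ
  weight []      = 0ℚ
  weight (i ∷ α) = ℤ.+ i ℚ./ 1 ℚ.+ ratio ℚ.* weight α

  /-mono : ∀ a b m n .{{_ : NonZero m}} .{{_ : NonZero n}} →
           a ℕ.* n ℕ.≤ b ℕ.* m → ℤ.+ a ℚ./ m ℚ.≤ ℤ.+ b ℚ./ n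
  /-mono a b (suc m) (suc n) le = ℚₚ.toℚᵘ-cancel-≤ (begin
    ℚ.toℚᵘ (ℤ.+ a ℚ./ suc m)    ≃⟨ ℚₚ.toℚᵘ-fromℚᵘ (ℚᵘ.mkℚᵘ (ℤ.+ a) m) ⟩
    ℚᵘ.mkℚᵘ (ℤ.+ a) m           ≤⟨ ℚᵘ.*≤* (≡.subst₂ ℤ._≤_ (ℤₚ.pos-* a (suc n)) (ℤₚ.pos-* b (suc m)) (ℤ.+≤+ le)) ⟩
    ℚᵘ.mkℚᵘ (ℤ.+ b) n           ≃⟨ ℚₚ.toℚᵘ-fromℚᵘ (ℚᵘ.mkℚᵘ (ℤ.+ b) n) ⟨
    ℚ.toℚᵘ (ℤ.+ b ℚ./ suc n)    ∎)
    where open ℚᵘₚ.≤-Reasoning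

  private
    instance
      ratio≥0 : ℚ.NonNegative ratio
      ratio≥0 = ℚₚ.normalize-nonNeg d e

  1≤ratio : 1ℚ ℚ.≤ ratio
  1≤ratio = /-mono 1 d 1 e (≡.subst₂ ℕ._≤_ (≡.sym (ℕₚ.*-identityˡ e)) (≡.sym (ℕₚ.*-identityʳ d)) (ℕₚ.<⇒≤ e<d))

  weight≥0 : ∀ {n} (α : Vec ℕ n) → 0ℚ ℚ.≤ weight α
  weight≥0 []      = ℚₚ.≤-refl
  weight≥0 (i ∷ α) = ℚₚ.+-mono-≤ {0ℚ} {ℤ.+ i ℚ./ 1} {0ℚ} {ratio ℚ.* weight α} (/-mono 0 i 1 1 ℕ.z≤n)
    (ℚₚ.≤-trans (ℚₚ.≤-reflexive (≡.sym (ℚₚ.*-zeroʳ ratio))) (ℚₚ.*-monoˡ-≤-nonNeg ratio (weight≥0 α)))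

  weight-mono : ∀ {n} {α β : Vec ℕ n} → Pointwise ℕ._≤_ α β → weight α ℚ.≤ weight β
  weight-mono [] = ℚₚ.≤-refl
  weight-mono {α = i ∷ α} {j ∷ β} (i≤j ∷ α≤β) = ℚₚ.+-mono-≤
    (/-mono i j 1 1 (ℕₚ.*-monoˡ-≤ 1 i≤j)) (ℚₚ.*-monoˡ-≤-nonNeg ratio (weight-mono α≤β))

  weight-∷ʳ : ∀ {n} (α : Vec ℕ n) → weight (α ∷ʳ 0) ≡ weight α
  weight-∷ʳ []      = ≡.trans (ℚₚ.+-identityˡ (ratio ℚ.* 0ℚ)) (ℚₚ.*-zeroʳ ratio)
  weight-∷ʳ (i ∷ α) = ≡.cong (λ w → ℤ.+ i ℚ./ 1 ℚ.+ ratio ℚ.* w) (weight-∷ʳ α)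

  weight-0∷ : ∀ {n} (α : Vec ℕ n) → weight α ℚ.≤ weight (0 ∷ α)
  weight-0∷ α = begin
    weight α                      ≡⟨ ℚₚ.*-identityˡ (weight α) ⟨
    1ℚ ℚ.* weight α               ≤⟨ ℚₚ.*-monoʳ-≤-nonNeg (weight α) {{ℚ.nonNegative (weight≥0 α)}} 1≤ratio ⟩
    ratio ℚ.* weight α            ≡⟨ ℚₚ.+-identityˡ (ratio ℚ.* weight α) ⟨
    weight (0 ∷ α)                ∎
    where open ℚₚ.≤-Reasoning

module PathSpace {k ℓ} (K : CommutativeRing k ℓ) (d e : ℕ) (1≤e : 1 ℕ.≤ e) (e<d : e ℕ.< d)
                 (f g : Polynomial K) where
  open Series K
  open Weight d e 1≤e e<d

  relationAt : ∀ n → Fin n → CommutativeRing.Carrier (series (suc n))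
  relationAt n i = relation (seriesAlgebra (suc n)) f g d e (var (inject₁ i)) (var (suc i))

  relations : ∀ n → Ideal (series (suc n)) (k ⊔ ℓ)
  relations n = spanIdeal (series (suc n)) (relationAt n)

  S : ℕ → CommutativeRing k (k ⊔ ℓ)
  S n = series (suc n) / relations n

  include-relations : ∀ n {x} → x ∈ Member (relations n) →
                      AlgebraHom.⟦_⟧ (include (suc n)) x ∈ Member (relations (suc n))
  include-relations n = span-map (series (suc n)) (series (suc (suc n))) (includeHom (suc n))
    (relations (suc n)) (relationAt n) λ i → Ideal.∈-resp-≈ (relations (suc n))
      (CommutativeRing.sym (series (suc (suc n)))
        (relation-homo (seriesAlgebra (suc n)) (seriesAlgebra (suc (suc n))) (include (suc n)) f g d e
          (include-var (inject₁ i)) (include-var (suc i))))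
      (generator∈ (series (suc (suc n))) (relationAt (suc n)) (inject₁ i))

  raise-relations : ∀ n {x} → x ∈ Member (relations n) →
                    AlgebraHom.⟦_⟧ (raise (suc n)) x ∈ Member (relations (suc n))
  raise-relations n = span-map (series (suc n)) (series (suc (suc n)))
    (AlgebraHom.ringHomomorphism (raise (suc n)))
    (relations (suc n)) (relationAt n) λ i → Ideal.∈-resp-≈ (relations (suc n))
      (CommutativeRing.sym (series (suc (suc n)))
        (relation-homo (seriesAlgebra (suc n)) (seriesAlgebra (suc (suc n))) (raise (suc n)) f g d e
          (raise-var (inject₁ i)) (raise-var (suc i))))
      (generator∈ (series (suc (suc n))) (relationAt (suc n)) (suc i))

  includeS : ∀ n → RingHom (S n) (S (suc n))
  includeS n = quotientMap (relations n) (relations (suc n)) (includeHom (suc n)) (include-relations n)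

  raiseS : ∀ n → RingHom (S n) (S (suc n))
  raiseS n = quotientMap (relations n) (relations (suc n)) (AlgebraHom.ringHomomorphism (raise (suc n)))
    (raise-relations n)

  -- The series all of whose monomials have weight > X: the coefficients in
  -- weight ≤ X are zero.
  heavy : ∀ n → ℚ → Ideal (series (suc n)) ℓ
  heavy n X = vanishingIdeal {suc n} (λ α → weight α ℚ.≤ X) (λ α≤β → ℚₚ.≤-trans (weight-mono α≤β))

  𝔪 : ∀ n → ℚ → Ideal (S n) (k ⊔ ℓ)
  𝔪 n X = imageIdeal (series (suc n)) (relations n) (heavy n X)

  include-𝔪 : ∀ X n {x} → x ∈ Member (𝔪 n X) →
              RingHomomorphism.⟦_⟧ (includeS n) x ∈ Member (𝔪 (suc n) X)
  include-𝔪 X n (y , x≈y , y∈) = RingHomomorphism.⟦_⟧ (includeHom (suc n)) y ,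
    RingHomomorphism.⟦⟧-cong (includeS n) x≈y ,
    include-vanishing {suc n} (λ α → weight α ℚ.≤ X) (λ α → weight α ℚ.≤ X)
      (λ α → ℚₚ.≤-trans (ℚₚ.≤-reflexive (≡.sym (weight-∷ʳ α)))) y y∈

  raise-𝔪 : ∀ X n {x} → x ∈ Member (𝔪 n X) →
            RingHomomorphism.⟦_⟧ (raiseS n) x ∈ Member (𝔪 (suc n) X)
  raise-𝔪 X n (y , x≈y , y∈) = AlgebraHom.⟦_⟧ (raise (suc n)) y ,
    RingHomomorphism.⟦⟧-cong (raiseS n) x≈y ,
    raise-vanishing {suc n} (λ α → weight α ℚ.≤ X) (λ α → weight α ℚ.≤ X)
      (λ α → ℚₚ.≤-trans (weight-0∷ α)) y y∈

  open Colimit S includeS using (colimit; injectionHom; unionIdeal; colimitMap; colimitMap-∈)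

  -- Rational thresholds X > 0 are cofinal among the real ones.
  filtration : ∃ (0ℚ ℚ.<_) → Ideal colimit (k ⊔ ℓ)
  filtration (X , _) = unionIdeal (λ n → 𝔪 n X) (include-𝔪 X)

  open Completion colimit (λ (X , _) (Y , _) → X ℚ.≤ Y) filtration
    using (completion; diagonalHom; completionMap)

  raise-natural : ∀ n x → CommutativeRing._≈_ (S (suc (suc n)))
    (RingHomomorphism.⟦_⟧ (raiseS (suc n)) (RingHomomorphism.⟦_⟧ (includeS n) x))
    (RingHomomorphism.⟦_⟧ (includeS (suc n)) (RingHomomorphism.⟦_⟧ (raiseS n) x))
  raise-natural n x = RingHomomorphism.⟦⟧-cong (quotientHom (series (suc (suc (suc n)))) (relations (suc (suc n))))
    (raise-include (suc n) x)

  scalarS₀ : RingHom K (S 0)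
  scalarS₀ = compose K (series 1) (S 0) (quotientHom (series 1) (relations 0)) (scalarHom 1)

  colimitShift : RingHom colimit colimit
  colimitShift = colimitMap raiseS raise-natural

  colimitScalar : RingHom K colimit
  colimitScalar = compose K (S 0) colimit (injectionHom 0) scalarS₀

  colimitShift-scalar : ∀ c → CommutativeRing._≈_ colimit
    (RingHomomorphism.⟦_⟧ colimitShift (RingHomomorphism.⟦_⟧ colimitScalar c))
    (RingHomomorphism.⟦_⟧ colimitScalar c)
  colimitShift-scalar c = 1 , ≤′-reflexive ≡.refl , ≤′-step (≤′-reflexive ≡.refl) ,
    RingHomomorphism.⟦⟧-cong (quotientHom (series 2) (relations 1))
      (CommutativeRing.trans (series 2) (AlgebraHom.scalar-homo (raise 1) c)
        (CommutativeRing.sym (series 2) (AlgebraHom.scalar-homo (include 1) c)))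

  𝒪 : CommutativeAlgebra K (k ⊔ ℓ) (k ⊔ ℓ)
  𝒪 = record
    { ring         = completion
    ; structureMap = compose K colimit completion diagonalHom colimitScalar }

  shift : AlgebraHom 𝒪 𝒪
  shift = record
    { ringHomomorphism = completionMap colimitShift
        (λ (X , _) → colimitMap-∈ raiseS raise-natural (λ n → 𝔪 n X) (include-𝔪 X) (raise-𝔪 X))
    ; scalar-homo = λ c X → RingHomomorphism.⟦⟧-cong (quotientHom colimit (filtration X)) (colimitShift-scalar c) }

  w : ℕ → CommutativeAlgebra.Carrier 𝒪
  w i = RingHomomorphism.⟦_⟧ diagonalHom (i , var (fromℕ i))

  shift-w : ∀ i → CommutativeAlgebra._≈_ 𝒪 (AlgebraHom.⟦_⟧ shift (w i)) (w (suc i))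
  shift-w i = CommutativeAlgebra.refl 𝒪 {w (suc i)}

  open FunctorOfPoints K (k ⊔ ℓ) using (KFunctor; _⇒_; Spec; Spec₁)

  formalNeighbourhood : KFunctor
  formalNeighbourhood = Spec 𝒪

  formalShift : formalNeighbourhood ⇒ formalNeighbourhood
  formalShift = Spec₁ shift

fieldRing : ∀ {k ℓ ℓ#} → HeytingField k ℓ ℓ# → CommutativeRing k ℓ
fieldRing K = HeytingCommutativeRing.commutativeRing (HeytingField.heytingCommutativeRing K)

module _ {r ℓr k ℓk ℓ#} (R : CommutativeRing r ℓr) (K : HeytingField k ℓk ℓ#)
         (ι : RingHom R (fieldRing K)) where
  private
    module R = RingNotation R
    module K = HeytingField K
    module KR = RingNotation (fieldRing K)
    module ι = RingHomomorphism ι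

  record IsFieldOfFractions : Set (r ⊔ ℓr ⊔ k ⊔ ℓk ⊔ ℓ#) where
    field
      injective : Injective R._≈_ K._≈_ ι.⟦_⟧
      fraction  : ∀ x → ∃[ a ] ∃[ b ] (ι.⟦_⟧ b K.# K.0#) × ((x K.* ι.⟦_⟧ b) K.≈ ι.⟦_⟧ a)

  IsIntegral : K.Carrier → Set (r ⊔ ℓk)
  IsIntegral x = ∃[ n ] Σ (Fin n → R.Carrier) λ c →
    (x KR.^ n K.+ KR.sum (λ i → ι.⟦_⟧ (c i) K.* x KR.^ toℕ i)) K.≈ K.0#

  IsIntegrallyClosed : Set (r ⊔ k ⊔ ℓk)
  IsIntegrallyClosed = ∀ x → IsIntegral x → ∃[ a ] ι.⟦_⟧ a K.≈ x

module _ {r ℓ} (R : CommutativeRing r ℓ) where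
  open RingNotation R

  -- Double negation: with a bare existence of generators, not even ℤ could be
  -- shown to be Noetherian constructively.
  IsNoetherian : Set (lsuc (r ⊔ ℓ))
  IsNoetherian = (I : Ideal R (r ⊔ ℓ)) →
    ¬ ¬ (∃[ n ] Σ (Fin n → Carrier) λ c → (Member I ⊆ Member (spanIdeal R c)) × (Member (spanIdeal R c) ⊆ Member I))

  IsPrimeIdeal : Ideal R (r ⊔ ℓ) → Set (r ⊔ ℓ)
  IsPrimeIdeal P = (1# ∉ Member P) × (∀ x y → (x * y) ∈ Member P → (x ∈ Member P) ⊎ (y ∈ Member P))

  IsMaximalIdeal : Ideal R (r ⊔ ℓ) → Set (lsuc (r ⊔ ℓ))
  IsMaximalIdeal M = (1# ∉ Member M) ×
    ((J : Ideal R (r ⊔ ℓ)) → Member M ⊆ Member J → 1# ∉ Member J → Member J ⊆ Member M)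

  IsUnit : Carrier → Set (r ⊔ ℓ)
  IsUnit = Invertible 1# _*_
    where open Algebra.Definitions _≈_ using (Invertible)

  natural : ℕ → Carrier
  natural n = n · 1#
    where open Algebra.Properties.Semiring.Mult semiring using () renaming (_×_ to _·_)

-- R is a domain because it embeds in K.  The case that R is a field is allowed.
record IsDedekindWithFractionField {r ℓr k ℓk ℓ#} (R : CommutativeRing r ℓr) (K : HeytingField k ℓk ℓ#)
         (ι : RingHom R (fieldRing K)) : Set (lsuc (r ⊔ ℓr) ⊔ k ⊔ ℓk ⊔ ℓ#) where
  open CommutativeRing R
  field
    isFieldOfFractions        : IsFieldOfFractions R K ι
    isNoetherian              : IsNoetherian R
    isIntegrallyClosed        : IsIntegrallyClosed R K ι
    nonzeroPrimesAreMaximal   : (P : Ideal R (r ⊔ ℓr)) → IsPrimeIdeal R P →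
                                ∃[ x ] (¬ (x ≈ 0#)) × (x ∈ Member P) → IsMaximalIdeal R P

{-# OPTIONS --safe #-}
module Submission where

-- Write F and G for the polynomials f and g reversed, so that the path space of
-- (f , g) has the relations wᵢᵈ G(wᵢ₊₁) = wᵢ₊₁ᵉ F(wᵢ).  Between two correspondences
-- (f₁ , g₁) and (f₂ , g₂) of the same degrees we look for a substitution w₀ ↦ w₀T,
-- wᵢ ↦ σⁱ(w₀T) with T in the local ring of the first and T ≡ 1 modulo the maximal
-- ideal.  It respects the relations as soon as
--     Tᵈ F₁(w₀) G₂(w₁ σT) = (σT)ᵉ F₂(w₀T) G₁(w₁).
-- Multiplication by the coordinates and the shift σ raise the weight by a definite
-- amount, so modulo higher weight only the factor Tᵈ depends on T, and
-- T ↦ T − (left − right)/d is a contraction: a solution exists and is unique.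
-- Composing the substitutions for (1 , 2) and (2 , 1) solves the equation for (1 , 1),
-- whose only solution is T = 1; hence they are mutually inverse.  Uniqueness also
-- makes the solutions modulo different weights compatible with one another.

open import Defs
open import Algebra.Apartness.Bundles using (HeytingField)
open import Algebra.Bundles using (CommutativeMonoid; CommutativeRing)
open import Algebra.Morphism.Bundles using (RingHomomorphism)
import Algebra.Properties.CommutativeSemigroup
import Algebra.Properties.CommutativeSemiring.Exp
import Algebra.Properties.Group
import Algebra.Properties.Monoid.Sum
import Algebra.Properties.Ring
import Algebra.Solver.CommutativeMonoid
open import Data.Fin.Base using (Fin; zero; suc; toℕ; fromℕ; inject₁)
import Data.Fin.Properties as Finₚ
import Data.Integer.Base as ℤ
import Data.Integer.Properties as ℤₚ
import Data.Integer.Tactic.RingSolver as ℤSolver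
open import Data.Nat.Base as ℕ using (ℕ; zero; suc; _∸_; _≤_; _<_; _≤′_; ≤′-reflexive; ≤′-step; NonZero)
import Data.Nat.Properties as ℕₚ
open import Data.Product.Base using (Σ; ∃; ∃-syntax; _×_; _,_; proj₁; proj₂)
open import Data.Rational.Base as ℚ using (ℚ; 0ℚ; 1ℚ)
import Data.Rational.Properties as ℚₚ
import Data.Rational.Unnormalised.Base as ℚᵘ
import Data.Rational.Unnormalised.Properties as ℚᵘₚ
open import Data.Sum.Base using (_⊎_; inj₁; inj₂; [_,_]′)
open import Data.Vec.Base using (Vec; []; _∷_; zipWith)
open import Level using (Level; _⊔_) renaming (suc to lsuc)
open import Relation.Binary.PropositionalEquality as ≡ using (_≡_)
open import Relation.Nullary.Decidable.Core using (Dec; yes; no)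
open import Relation.Nullary.Negation.Core using (¬_; contradiction)
open import Relation.Unary using (_∈_; _⊆_)

open Ideal using (Member)
open Polynomial using (coeff)

-- The equation for T comes from putting w₀T and w₁σT into the second relation, multiplying by
-- F₁(w₀) and replacing w₁ᵉF₁(w₀) by w₀ᵈG₁(w₁): now w₀ᵈ stands on both sides, and the equation is
-- what is left when it is dropped. Hence the substitution is verified by multiplying with w₀ᵈ, and
-- only elements congruent to 1 are ever cancelled. The obstacle is convergence: power series have
-- to be evaluated at new elements, and T itself lies only in the completion. All work is therefore
-- done modulo weight > X for a fixed X. There the elements of the maximal ideal are nilpotent,
-- evaluation is a finite sum, the contraction stops after finitely many steps, and nilpotent values
-- on the coordinates determine a homomorphism. The completion enters only at the end, by gluing.
-- The shift raises weights because e < d: it multiplies them by d/e. Weights are counted in levels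
-- of step 1/(2e), small enough for this gain.

module RingLemmas {a ℓ} (A : CommutativeRing a ℓ) where
  open RingNotation A public
  open Algebra.Properties.CommutativeSemiring.Exp commutativeSemiring public using (^-distrib-*)
  open Algebra.Properties.Ring ring public using (x[y-z]≈xy-xz; [y-z]x≈yx-zx)
  open Algebra.Properties.Group +-group public using () renaming (x∙y⁻¹≈ε⇒x≈y to x-y≈0⇒x≈y)
  open Algebra.Properties.CommutativeSemigroup *-commutativeSemigroup public
    using (x∙yz≈y∙xz) renaming (interchange to *-medial)

  x-0≈x : ∀ x → (x - 0#) ≈ x
  x-0≈x x = trans (+-congˡ -0≈0) (+-identityʳ x)

  1^n≈1 : ∀ n → (1# ^ n) ≈ 1#
  1^n≈1 zero    = refl
  1^n≈1 (suc n) = trans (*-identityˡ (1# ^ n)) (1^n≈1 n)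

  zeroIdeal : Ideal A ℓ
  zeroIdeal = record
    { Member   = _≈ 0#
    ; ∈-resp-≈ = λ x≈y x≈0 → trans (sym x≈y) x≈0
    ; 0∈       = refl
    ; +-closed = λ x≈0 y≈0 → trans (+-cong x≈0 y≈0) (+-identityˡ 0#)
    ; *-closed = λ r x≈0 → trans (*-congˡ x≈0) (zeroʳ r) }

module _ {a ℓa b ℓb} (A : CommutativeRing a ℓa) (B : CommutativeRing b ℓb) (φ : RingHom A B) where
  private
    module B = CommutativeRing B
  open HomLaws A B φ

  natural-homo : ∀ n → ⟦ natural A n ⟧ B.≈ natural B n
  natural-homo zero    = 0#-homo
  natural-homo (suc n) = B.trans (+-homo _ (natural A n)) (B.+-cong 1#-homo (natural-homo n))

module _ {a ℓ p} (A : CommutativeRing a ℓ) (I : Ideal A p) where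
  open RingNotation A
  private
    module Q = RingNotation (A / I)

  ^-mod : ∀ n {x y} → x Q.≈ y → (x ^ n) Q.≈ (y ^ n)
  ^-mod n {x} {y} x≈y = Q.trans {x ^ n} {x Q.^ n} {y ^ n} (^-homo x n)
    (Q.trans {x Q.^ n} {y Q.^ n} {y ^ n} (Q.^-congˡ n x≈y) (Q.sym {y ^ n} {y Q.^ n} (^-homo y n)))
    where open HomLaws A (A / I) (quotientHom A I)

-- Reversed polynomials at 0 and modulo an ideal

module _ {k ℓ a ℓa} {K : CommutativeRing k ℓ} (A : CommutativeAlgebra K a ℓa) where
  open CommutativeAlgebra A
  open Algebra.Properties.Monoid.Sum +-monoid using (sum-init-last)

  -- Reversal makes the leading coefficient the constant term, the last summand j = n. For monic h
  -- this is why the value at an element of the maximal ideal is congruent to 1.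
  reversed-0 : ∀ h n → reversed A h n 0# ≈ scalar (coeff h n)
  reversed-0 h n = begin
    sum term                                              ≈⟨ sum-init-last term ⟩
    sum (λ i → term (inject₁ i)) + term (fromℕ n)         ≈⟨ +-cong lower top ⟩
    0# + scalar (coeff h n)                               ≈⟨ +-identityˡ (scalar (coeff h n)) ⟩
    scalar (coeff h n)                                    ∎
    where
    open ≈-Reasoning
    term : Fin (suc n) → Carrier
    term j = scalar (coeff h (toℕ j)) * 0# ^ (n ∸ toℕ j)
    0^ : ∀ m {n} → m ℕ.< n → 0# ^ (n ∸ m) ≈ 0#
    0^ zero    {suc n} _           = zeroˡ (0# ^ n)
    0^ (suc m) {suc n} (ℕ.s≤s m<n) = 0^ m m<n
    lower : sum (λ i → term (inject₁ i)) ≈ 0#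
    lower = trans (sum-cong-≋ (λ (i : Fin n) → trans (*-congˡ (0^ (toℕ (inject₁ i)) (Finₚ.inject₁ℕ< i)))
                                           (zeroʳ (scalar (coeff h (toℕ (inject₁ i)))))))
                  (sum-replicate-zero n)
    top : term (fromℕ n) ≈ scalar (coeff h n)
    top = ≡.subst (λ m → scalar (coeff h m) * 0# ^ (n ∸ m) ≈ scalar (coeff h n)) (≡.sym (Finₚ.toℕ-fromℕ n))
      (≡.subst (λ m → scalar (coeff h n) * 0# ^ m ≈ scalar (coeff h n)) (≡.sym (ℕₚ.n∸n≡0 n))
        (*-identityʳ (scalar (coeff h n))))

  quotientAlgebra : ∀ {p} → Ideal ring p → CommutativeAlgebra K a p
  quotientAlgebra I = record
    { ring         = ring / I
    ; structureMap = compose K ring (ring / I) (quotientHom ring I) structureMap }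

  quotientAlgebraHom : ∀ {p} (I : Ideal ring p) → AlgebraHom A (quotientAlgebra I)
  quotientAlgebraHom I = record
    { ringHomomorphism = quotientHom ring I
    ; scalar-homo      = λ c → CommutativeRing.refl (ring / I) }

  -- The projection to the quotient is an algebra homomorphism, and these commute with `reversed`.
  reversed-mod : ∀ {p} (I : Ideal ring p) h n {x y} → CommutativeRing._≈_ (ring / I) x y →
                 CommutativeRing._≈_ (ring / I) (reversed A h n x) (reversed A h n y)
  reversed-mod I h n {x} {y} x≈y = Q.trans {reversed A h n x} {reversed Aᴵ h n y} {reversed A h n y}
    (reversed-homo A Aᴵ π h n {x} {y} x≈y)
    (Q.sym {reversed A h n y} {reversed Aᴵ h n y} (reversed-homo A Aᴵ π h n {y} {y} (Q.refl {y})))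
    where
    Aᴵ : CommutativeAlgebra K _ _
    Aᴵ = quotientAlgebra I
    π : AlgebraHom A Aᴵ
    π = quotientAlgebraHom I
    module Q = CommutativeRing (ring / I)

  reversed-cong : ∀ h n {x y} → x ≈ y → reversed A h n x ≈ reversed A h n y
  reversed-cong = reversed-homo A A (idᴬ A)

-- Contractions

-- Abstracts the local ring modulo a weight: `I 0` stands for the maximal ideal and `I n` for the
-- elements of level n. The index counts levels of weight, not powers of `I 0`; at `depth` the
-- truncation leaves only zero.
record ContractingAlgebra {k ℓ} (K : CommutativeRing k ℓ) (s ℓs p : Level) :
                          Set (k ⊔ ℓ ⊔ lsuc (s ⊔ ℓs ⊔ p)) where
  field
    algebra : CommutativeAlgebra K s ℓs
    σ       : AlgebraHom algebra algebra
    I       : ℕ → Ideal (CommutativeAlgebra.ring algebra) p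

  open CommutativeAlgebra algebra public using (Carrier; ring)
  open RingLemmas ring public hiding (Carrier; ring)
  module σ = AlgebraHom σ

  field
    I-descends : ∀ n {x} → x ∈ Member (I (suc n)) → x ∈ Member (I n)
    I₀*I       : ∀ n {x y} → x ∈ Member (I 0) → y ∈ Member (I n) → (x * y) ∈ Member (I (suc n))
    σ-I        : ∀ n {x} → x ∈ Member (I n) → σ.⟦ x ⟧ ∈ Member (I (suc n))
    depth      : ℕ
    I-depth≈0  : ∀ {x} → x ∈ Member (I depth) → x ≈ 0#
    w          : Carrier
    w∈I₀       : w ∈ Member (I 0)

  w₁ : Carrier
  w₁ = σ.⟦ w ⟧

  private
    module I n = Ideal (I n)
    module Mod n = RingLemmas (ring / I n)

  ≈⇒≈ₙ : ∀ n {x y} → x ≈ y → Mod._≈_ n x y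
  ≈⇒≈ₙ n = ≈⇒≈ᴵ ring (I n)

  I⊆I₀ : ∀ n {x} → x ∈ Member (I n) → x ∈ Member (I 0)
  I⊆I₀ zero    x∈ = x∈
  I⊆I₀ (suc n) x∈ = I⊆I₀ n (I-descends n x∈)

  depth-induction : ∀ {x} → x ∈ Member (I 0) → (∀ n → x ∈ Member (I n) → x ∈ Member (I (suc n))) → x ≈ 0#
  depth-induction {x} x∈ step = I-depth≈0 (all depth)
    where
    all : ∀ n → x ∈ Member (I n)
    all zero    = x∈
    all (suc n) = step n (all n)

  -- Nakayama's argument: for v = u - 1 and z = x - y one has z = -vz with v in `I 0`, so z sinks
  -- one level at a time until it vanishes. No inverse of u is constructed.
  unit-cancel : ∀ {u x y} → Mod._≈_ 0 u 1# → u * x ≈ u * y → x ≈ y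
  unit-cancel {u} {x} {y} u≈1 ux≈uy = x-y≈0⇒x≈y x y
    (depth-induction (I.∈-resp-≈ 0 -v*z≈z (I.-‿closed 0 (I.∈-resp-≈ 0 (*-comm z v) (I.*-closed 0 z u≈1))))
      (λ n z∈ → I.∈-resp-≈ (suc n) -v*z≈z (I.-‿closed (suc n) (I₀*I n u≈1 z∈))))
    where
    z v : Carrier
    z = x - y
    v = u - 1#
    -v*z≈z : (- (v * z)) ≈ z
    -v*z≈z = begin
      - (v * z)              ≈⟨ -‿cong ([y-z]x≈yx-zx z u 1#) ⟩
      - (u * z - 1# * z)     ≈⟨ -‿cong (+-cong uz≈0 (-‿cong (*-identityˡ z))) ⟩
      - (0# - z)             ≈⟨ -‿cong (+-identityˡ (- z)) ⟩
      - - z                  ≈⟨ -‿involutive z ⟩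
      z                      ∎
      where
      open ≈-Reasoning
      uz≈0 : u * z ≈ 0#
      uz≈0 = trans (x[y-z]≈xy-xz u x y) (x≈y⇒x-y≈0 ux≈uy)

  nilpotent : ∀ {x} → x ∈ Member (I 0) → x ^ suc depth ≈ 0#
  nilpotent {x} x∈ = I-depth≈0 (power∈ depth)
    where
    power∈ : ∀ n → (x ^ suc n) ∈ Member (I n)
    power∈ zero    = I.∈-resp-≈ 0 (sym (*-identityʳ x)) x∈
    power∈ (suc n) = I₀*I n x∈ (power∈ n)

  reversed≈1 : ∀ {h n} → IsMonicOfDegree h n → ∀ {x} → x ∈ Member (I 0) → Mod._≈_ 0 (reversed algebra h n x) 1#
  reversed≈1 {h} {n} (lead , _) {x} x∈ = Mod.trans 0
    (reversed-mod algebra (I 0) h n (I.∈-resp-≈ 0 (sym (x-0≈x x)) x∈))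
    (≈⇒≈ₙ 0 (trans (reversed-0 algebra h n) (trans (structure.⟦⟧-cong lead) structure.1#-homo)))
    where module structure = HomLaws K ring (CommutativeAlgebra.structureMap algebra)

  IsPrincipal : Carrier → Set p
  IsPrincipal T = Mod._≈_ 0 T 1#

  principal-* : ∀ {S T} → IsPrincipal S → IsPrincipal T → IsPrincipal (S * T)
  principal-* s t = Mod.trans 0 (Mod.*-cong 0 s t) (≈⇒≈ₙ 0 (*-identityˡ 1#))

  power≈1 : ∀ n {T} → IsPrincipal T → IsPrincipal (T ^ n)
  power≈1 n t = Mod.trans 0 (^-mod ring (I 0) n t) (≈⇒≈ₙ 0 (1^n≈1 n))

  σ-principal : ∀ {T} → IsPrincipal T → IsPrincipal σ.⟦ T ⟧
  σ-principal {T} t = I.∈-resp-≈ 0 (trans (σ.sub-homo T 1#) (+-congˡ (-‿cong σ.1#-homo)))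
    (I⊆I₀ 1 (σ-I 0 t))

  w*∈ : ∀ T → (w * T) ∈ Member (I 0)
  w*∈ T = I.∈-resp-≈ 0 (*-comm T w) (I.*-closed 0 T w∈I₀)

  w₁∈ : w₁ ∈ Member (I 0)
  w₁∈ = I⊆I₀ 1 (σ-I 0 w∈I₀)

  w₁*∈ : ∀ T → (w₁ * T) ∈ Member (I 0)
  w₁*∈ T = I.∈-resp-≈ 0 (*-comm T w₁) (I.*-closed 0 T w₁∈)

  -- The quotient q is the sum of the n products xⁱyʲ with i + j = n - 1, each congruent to 1.
  -- Modulo `I 0` it is thus the derivative of the n-th power at 1.
  power-difference : ∀ n {x y} → IsPrincipal x → IsPrincipal y →
    ∃[ q ] ((x ^ n) - (y ^ n) ≈ (x - y) * q) × Mod._≈_ 0 q (natural ring n)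
  power-difference zero    {x} {y} px py = 0# , trans (-‿inverseʳ 1#) (sym (zeroʳ (x - y))) , Mod.refl 0
  power-difference (suc n) {x} {y} px py with power-difference n px py
  ... | q , eq , q≈n = x * q + y ^ n ,
    (begin
      x * x ^ n - y * y ^ n                       ≈⟨ xu-yv x (x ^ n) y (y ^ n) ⟩
      x * (x ^ n - y ^ n) + y ^ n * (x - y)       ≈⟨ +-cong (trans (*-congˡ eq) (x∙yz≈y∙xz x (x - y) q)) (*-comm (y ^ n) (x - y)) ⟩
      (x - y) * (x * q) + (x - y) * y ^ n         ≈⟨ distribˡ (x - y) (x * q) (y ^ n) ⟨
      (x - y) * (x * q + y ^ n)                   ∎) ,
    Mod.trans 0 (≈⇒≈ₙ 0 (+-comm (x * q) (y ^ n)))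
      (Mod.+-cong 0 {y ^ n} {1#} {x * q} {natural ring n}
        (power≈1 n py)
        (Mod.trans 0 (Mod.*-cong 0 px q≈n) (≈⇒≈ₙ 0 (*-identityˡ (natural ring n)))))
    where open ≈-Reasoning

  module FixedPoint (N : Carrier → Carrier) (N1 : IsPrincipal (N 1#))
    (contracts : ∀ n {S T} → IsPrincipal S → IsPrincipal T → Mod._≈_ n S T → Mod._≈_ (suc n) (N S) (N T)) where

    private
      iterate : ℕ → Carrier
      iterate zero    = 1#
      iterate (suc n) = N (iterate n)

      principal : ∀ n → IsPrincipal (iterate n)
      principal zero    = Mod.refl 0
      principal (suc n) = Mod.trans 0
        (I-descends 0 (contracts 0 (principal n) (Mod.refl 0) (principal n))) N1

      -- Every further application of `N` moves the difference of consecutive iterates one level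
      -- deeper; at `depth` the difference is zero and the iteration has reached its fixed point.
      stable : ∀ n → Mod._≈_ n (iterate (suc n)) (iterate n)
      stable zero    = N1
      stable (suc n) = contracts n (principal (suc n)) (principal n) (stable n)

    fixed : Carrier
    fixed = iterate depth

    fixed-principal : IsPrincipal fixed
    fixed-principal = principal depth

    fixed-≈ : N fixed ≈ fixed
    fixed-≈ = x-y≈0⇒x≈y _ _ (I-depth≈0 (stable depth))

    fixed-unique : ∀ {S T} → IsPrincipal S → IsPrincipal T → N S ≈ S → N T ≈ T → S ≈ T
    fixed-unique {S} {T} s t NS NT = x-y≈0⇒x≈y S T (depth-induction
      (Mod.trans 0 s (Mod.sym 0 t))
      (λ n S≈T → I.∈-resp-≈ (suc n) (+-cong NS (-‿cong NT)) (contracts n s t S≈T)))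

  module Conjugacy (d e : ℕ) (f₁ g₁ f₂ g₂ : Polynomial K) where
    F₁ F₂ G₁ G₂ : Carrier → Carrier
    F₁ = reversed algebra f₁ d
    F₂ = reversed algebra f₂ d
    G₁ = reversed algebra g₁ e
    G₂ = reversed algebra g₂ e

    a b : Carrier → Carrier
    a T = F₁ w * G₂ (w₁ * σ.⟦ T ⟧)
    b T = σ.⟦ T ⟧ ^ e * (F₂ (w * T) * G₁ w₁)

    IsConjugacy : Carrier → Set (ℓs ⊔ p)
    IsConjugacy T = IsPrincipal T × (T ^ d * a T ≈ b T)

    module _ (f₁-monic : IsMonicOfDegree f₁ d) (g₁-monic : IsMonicOfDegree g₁ e)
             (f₂-monic : IsMonicOfDegree f₂ d) (g₂-monic : IsMonicOfDegree g₂ e)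
             (c : Carrier) (cd≈1 : c * natural ring d ≈ 1#) where

      a-principal : ∀ T → IsPrincipal (a T)
      a-principal T = principal-* (reversed≈1 {f₁} f₁-monic w∈I₀) (reversed≈1 {g₂} g₂-monic (w₁*∈ σ.⟦ T ⟧))

      b-principal : ∀ {T} → IsPrincipal T → IsPrincipal (b T)
      b-principal {T} t = principal-* (power≈1 e (σ-principal t))
        (principal-* (reversed≈1 {f₂} f₂-monic (w*∈ T)) (reversed≈1 {g₁} g₁-monic w₁∈))

      -- Newton's iteration with the derivative replaced by its value d modulo I 0
      N : Carrier → Carrier
      N T = T - c * (T ^ d * a T - b T)

      σ-contracts : ∀ n {S T} → Mod._≈_ n S T → Mod._≈_ (suc n) σ.⟦ S ⟧ σ.⟦ T ⟧
      σ-contracts n {S} {T} S≈T = I.∈-resp-≈ (suc n) (σ.sub-homo S T) (σ-I n S≈T)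

      a-contracts : ∀ n {S T} → Mod._≈_ n S T → Mod._≈_ (suc n) (a S) (a T)
      a-contracts n S≈T = Mod.*-congˡ (suc n) {F₁ w} (reversed-mod algebra (I (suc n)) g₂ e
        (Mod.*-congˡ (suc n) {w₁} (σ-contracts n S≈T)))

      -- The two occurrences of T gain a level for different reasons: one stands under σ, the other
      -- is multiplied by w.
      b-contracts : ∀ n {S T} → Mod._≈_ n S T → Mod._≈_ (suc n) (b S) (b T)
      b-contracts n {S} {T} S≈T = Mod.*-cong (suc n) (^-mod ring (I (suc n)) e (σ-contracts n S≈T))
        (Mod.*-congʳ (suc n) {G₁ w₁} (reversed-mod algebra (I (suc n)) f₂ d
          (I.∈-resp-≈ (suc n) (x[y-z]≈xy-xz w S T) (I₀*I n w∈I₀ S≈T))))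

      N-1 : IsPrincipal (N 1#)
      N-1 = Mod.trans 0
        (Mod.+-congˡ 0 {1#} (Mod.-‿cong 0 {c * (1# ^ d * a 1# - b 1#)} {0#} (Mod.trans 0
          (Mod.*-congˡ 0 {c} (Mod.trans 0 (Mod.+-cong 0 (principal-* (≈⇒≈ₙ 0 (1^n≈1 d)) (a-principal 1#))
                                            (Mod.-‿cong 0 (b-principal (Mod.refl 0))))
                                          (≈⇒≈ₙ 0 (-‿inverseʳ 1#))))
          (≈⇒≈ₙ 0 (zeroʳ c)))))
        (≈⇒≈ₙ 0 (x-0≈x 1#))

      -- With a and b frozen, the iteration depends on T only through T itself and the power P, so
      -- the factor S - T can be pulled out. The multiplier 1 - cqa is the error made in taking c
      -- for the inverse of the derivative.
      N-difference : ∀ S T P Q a b q → P - Q ≈ (S - T) * q →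
        (S - c * (P * a - b)) - (T - c * (Q * a - b)) ≈ (1# - c * (q * a)) * (S - T)
      N-difference S T P Q a b q P-Q = begin
        (S - c * X) - (T - c * Y)              ≈⟨ [x+u]-[y+v] S (- (c * X)) T (- (c * Y)) ⟩
        (S - T) + (- (c * X) - - (c * Y))      ≈⟨ +-congˡ (-‿+-comm (c * X) (- (c * Y))) ⟩
        (S - T) - (c * X - c * Y)              ≈⟨ +-congˡ (-‿cong (x[y-z]≈xy-xz c X Y)) ⟨
        (S - T) - c * (X - Y)                  ≈⟨ +-congˡ (-‿cong (*-congˡ X-Y)) ⟩
        (S - T) - c * (((S - T) * q) * a)      ≈⟨ +-cong (sym (*-identityˡ (S - T))) (-‿cong rearrange) ⟩
        1# * (S - T) - (c * (q * a)) * (S - T) ≈⟨ [y-z]x≈yx-zx (S - T) 1# (c * (q * a)) ⟨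
        (1# - c * (q * a)) * (S - T)           ∎
        where
        open ≈-Reasoning
        X Y : Carrier
        X = P * a - b
        Y = Q * a - b
        X-Y : X - Y ≈ ((S - T) * q) * a
        X-Y = begin
          (P * a - b) - (Q * a - b)            ≈⟨ [x+u]-[y+v] (P * a) (- b) (Q * a) (- b) ⟩
          (P * a - Q * a) + (- b - - b)        ≈⟨ +-cong (sym ([y-z]x≈yx-zx a P Q)) (-‿inverseʳ (- b)) ⟩
          (P - Q) * a + 0#                     ≈⟨ +-identityʳ ((P - Q) * a) ⟩
          (P - Q) * a                          ≈⟨ *-congʳ P-Q ⟩
          ((S - T) * q) * a                    ∎
        rearrange : c * (((S - T) * q) * a) ≈ (c * (q * a)) * (S - T)
        rearrange = trans (*-congˡ (trans (*-assoc (S - T) q a) (*-comm (S - T) (q * a))))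
                          (sym (*-assoc c (q * a) (S - T)))

      N-contracts : ∀ n {S T} → IsPrincipal S → IsPrincipal T → Mod._≈_ n S T → Mod._≈_ (suc n) (N S) (N T)
      N-contracts n {S} {T} s t S≈T with power-difference d s t
      -- Replacing `a S`, `b S` by `a T`, `b T` costs only terms of level n + 1. The remaining
      -- difference is (1 - cqa)(S - T), and cqa is congruent to cd = 1.
      ... | q , P-Q , q≈d = Mod.trans (suc n) {N S} {S - c * (S ^ d * a T - b T)} {N T}
        (Mod.+-congˡ (suc n) {S} (Mod.-‿cong (suc n) (Mod.*-congˡ (suc n) {c}
          (Mod.+-cong (suc n) (Mod.*-congˡ (suc n) {S ^ d} (a-contracts n S≈T))
                              (Mod.-‿cong (suc n) (b-contracts n S≈T))))))
        (I.∈-resp-≈ (suc n) (sym (N-difference S T (S ^ d) (T ^ d) (a T) (b T) q P-Q))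
          (I₀*I n caq≈1 S≈T))
        where
        caq≈1 : Mod._≈_ 0 1# (c * (q * a T))
        caq≈1 = Mod.sym 0 (Mod.trans 0
          (Mod.*-congˡ 0 {c} (Mod.trans 0 (Mod.*-cong 0 q≈d (a-principal T)) (≈⇒≈ₙ 0 (*-identityʳ (natural ring d)))))
          (≈⇒≈ₙ 0 cd≈1))

      private
        module N = FixedPoint N N-1 N-contracts

      conjugacy⇒fixed : ∀ {T} → IsConjugacy T → N T ≈ T
      conjugacy⇒fixed {T} (_ , eq) = trans
        (+-congˡ (-‿cong (trans (*-congˡ (x≈y⇒x-y≈0 eq)) (zeroʳ c)))) (x-0≈x T)

      -- A fixed point only gives cE = 0 for the defect E of the equation; multiplication by d, the
      -- inverse of c, frees E.
      fixed⇒conjugacy : ∀ {T} → N T ≈ T → T ^ d * a T ≈ b T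
      fixed⇒conjugacy {T} NT≈T = x-y≈0⇒x≈y (T ^ d * a T) (b T) (begin
        E                         ≈⟨ *-identityˡ E ⟨
        1# * E                    ≈⟨ *-congʳ (trans (*-comm _ c) cd≈1) ⟨
        natural ring d * c * E    ≈⟨ *-assoc _ c E ⟩
        natural ring d * (c * E)  ≈⟨ *-congˡ cE≈0 ⟩
        natural ring d * 0#       ≈⟨ zeroʳ _ ⟩
        0#                        ∎)
        where
        open ≈-Reasoning
        E : Carrier
        E = T ^ d * a T - b T
        cE≈0 : c * E ≈ 0#
        cE≈0 = begin
          c * E                    ≈⟨ -‿involutive (c * E) ⟨
          - - (c * E)              ≈⟨ -‿cong (+-identityˡ (- (c * E))) ⟨
          - (0# - c * E)           ≈⟨ -‿cong (+-congʳ (-‿inverseˡ T)) ⟨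
          - ((- T + T) - c * E)    ≈⟨ -‿cong (+-assoc (- T) T (- (c * E))) ⟩
          - (- T + (T - c * E))    ≈⟨ -‿cong (+-congˡ NT≈T) ⟩
          - (- T + T)              ≈⟨ -‿cong (-‿inverseˡ T) ⟩
          - 0#                     ≈⟨ -0≈0 ⟩
          0#                       ∎

      conjugacy : ∃ IsConjugacy
      conjugacy = N.fixed , N.fixed-principal , fixed⇒conjugacy N.fixed-≈

      conjugacy-unique : ∀ {S T} → IsConjugacy S → IsConjugacy T → S ≈ T
      conjugacy-unique s t = N.fixed-unique (proj₁ s) (proj₁ t) (conjugacy⇒fixed s) (conjugacy⇒fixed t)

module _ {k ℓ} {K : CommutativeRing k ℓ} (d e : ℕ) {s ℓs p} (A : ContractingAlgebra K s ℓs p) where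
  open ContractingAlgebra A
  open Algebra.Solver.CommutativeMonoid *-commutativeMonoid using (solve; _⊕_; _⊜_)

  relation-conjugate : (f₁ g₁ f₂ g₂ : Polynomial K) → IsMonicOfDegree f₁ d →
    relation algebra f₁ g₁ d e w w₁ ≈ 0# →
    ∀ {T} → Conjugacy.IsConjugacy d e f₁ g₁ f₂ g₂ T →
    relation algebra f₂ g₂ d e (w * T) (w₁ * σ.⟦ T ⟧) ≈ 0#
  relation-conjugate f₁ g₁ f₂ g₂ f₁-monic rel {T} (_ , eq) =
    -- The factor F₁(w) makes the first relation applicable, and it is congruent to 1 because f₁ is
    -- monic.
    x≈y⇒x-y≈0 (unit-cancel (reversed≈1 {f₁} f₁-monic w∈I₀) (begin
      F₁ w * ((w * T) ^ d * G₂′)             ≈⟨ *-congˡ (*-congʳ (^-distrib-* w T d)) ⟩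
      F₁ w * ((w ^ d * T ^ d) * G₂′)         ≈⟨ solve 4 (λ f x t g → f ⊕ ((x ⊕ t) ⊕ g) ⊜ x ⊕ (t ⊕ (f ⊕ g))) refl (F₁ w) (w ^ d) (T ^ d) G₂′ ⟩
      w ^ d * (T ^ d * (F₁ w * G₂′))         ≈⟨ *-congˡ eq ⟩
      w ^ d * (S ^ e * (F₂′ * G₁ w₁))        ≈⟨ solve 4 (λ x s f g → x ⊕ (s ⊕ (f ⊕ g)) ⊜ (x ⊕ g) ⊕ (s ⊕ f)) refl (w ^ d) (S ^ e) F₂′ (G₁ w₁) ⟩
      (w ^ d * G₁ w₁) * (S ^ e * F₂′)        ≈⟨ *-congʳ (x-y≈0⇒x≈y _ _ rel) ⟩
      (w₁ ^ e * F₁ w) * (S ^ e * F₂′)        ≈⟨ solve 4 (λ x f s g → (x ⊕ f) ⊕ (s ⊕ g) ⊜ f ⊕ ((x ⊕ s) ⊕ g)) refl (w₁ ^ e) (F₁ w) (S ^ e) F₂′ ⟩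
      F₁ w * ((w₁ ^ e * S ^ e) * F₂′)        ≈⟨ *-congˡ (*-congʳ (^-distrib-* w₁ S e)) ⟨
      F₁ w * ((w₁ * S) ^ e * F₂′)            ∎))
    where
    open ≈-Reasoning
    open Conjugacy d e f₁ g₁ f₂ g₂
    S G₂′ F₂′ : Carrier
    S = σ.⟦ T ⟧
    G₂′ = G₂ (w₁ * S)
    F₂′ = F₂ (w * T)

  conjugacy-1 : (f g : Polynomial K) → Conjugacy.IsConjugacy d e f g f g 1#
  conjugacy-1 f g = principal-1 , (begin
    1# ^ d * (F₁ w * G₂ (w₁ * σ.⟦ 1# ⟧))      ≈⟨ *-cong (1^n≈1 d) (*-congˡ (reversed-cong algebra g e (trans (*-congˡ σ.1#-homo) (*-identityʳ w₁)))) ⟩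
    1# * (F₁ w * G₂ w₁)                       ≈⟨ *-cong 1^e (*-congʳ (reversed-cong algebra f d (*-identityʳ w))) ⟨
    σ.⟦ 1# ⟧ ^ e * (F₂ (w * 1#) * G₁ w₁)      ∎)
    where
    open ≈-Reasoning
    open Conjugacy d e f g f g
    principal-1 : IsPrincipal 1#
    principal-1 = CommutativeRing.refl (ring / I 0)
    1^e : σ.⟦ 1# ⟧ ^ e ≈ 1#
    1^e = trans (^-congˡ e σ.1#-homo) (1^n≈1 e)

module _ {k ℓ} {K : CommutativeRing k ℓ} (d e : ℕ)
         {a ℓa p b ℓb q} (A : ContractingAlgebra K a ℓa p) (B : ContractingAlgebra K b ℓb q)
         (φ : AlgebraHom (ContractingAlgebra.algebra B) (ContractingAlgebra.algebra A)) where
  private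
    module B = ContractingAlgebra B
    module φ = AlgebraHom φ
  open ContractingAlgebra A
  open Algebra.Solver.CommutativeMonoid *-commutativeMonoid using (solve; _⊕_; _⊜_)

  -- A cocycle rule: the equation for T times the image under φ of the equation for V has the factor
  -- F₂G₂, taken at the substituted coordinates, on both sides, and this is congruent to 1. It
  -- serves two purposes: φ can come from another path space, or be the projection from a finer
  -- truncation of the same one.
  conjugacy-∘ : (∀ x → φ.⟦ B.σ.⟦ x ⟧ ⟧ ≈ σ.⟦ φ.⟦ x ⟧ ⟧) →
    (∀ {x} → x ∈ Member (B.I 0) → φ.⟦ x ⟧ ∈ Member (I 0)) →
    (f₁ g₁ f₂ g₂ f₃ g₃ : Polynomial K) →
    IsMonicOfDegree f₂ d → IsMonicOfDegree g₂ e →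
    ∀ {T V} → φ.⟦ B.w ⟧ ≈ w * T →
    Conjugacy.IsConjugacy d e f₁ g₁ f₂ g₂ T → B.Conjugacy.IsConjugacy d e f₂ g₂ f₃ g₃ V →
    Conjugacy.IsConjugacy d e f₁ g₁ f₃ g₃ (T * φ.⟦ V ⟧)
  conjugacy-∘ φσ φI f₁ g₁ f₂ g₂ f₃ g₃ f₂-monic g₂-monic {T} {V} φw (T≈1 , T-eq) (V≈1 , V-eq) =
    principal-* T≈1 φV≈1 ,
    unit-cancel (principal-* (reversed≈1 {g₂} g₂-monic (w₁*∈ σ.⟦ T ⟧)) (reversed≈1 {f₂} f₂-monic (w*∈ T))) (begin
      (G₂′ * F₂′) * ((T * V′) ^ d * (F₁ * G₃′))                 ≈⟨ *-congˡ (*-congʳ (^-distrib-* T V′ d)) ⟩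
      (G₂′ * F₂′) * ((T ^ d * V′ ^ d) * (F₁ * G₃′))
        ≈⟨ solve 6 (λ g f t v f₁ g₃ → (g ⊕ f) ⊕ ((t ⊕ v) ⊕ (f₁ ⊕ g₃)) ⊜ (t ⊕ (f₁ ⊕ g)) ⊕ (v ⊕ (f ⊕ g₃))) refl G₂′ F₂′ (T ^ d) (V′ ^ d) F₁ G₃′ ⟩
      (T ^ d * (F₁ * G₂′)) * (V′ ^ d * (F₂′ * G₃′))             ≈⟨ *-cong T-eq φV-eq ⟩
      (σT ^ e * (F₂′ * G₁)) * (σV ^ e * (F₃′ * G₂′))
        ≈⟨ solve 6 (λ s f g v f₃ g₂ → (s ⊕ (f ⊕ g)) ⊕ (v ⊕ (f₃ ⊕ g₂)) ⊜ (g₂ ⊕ f) ⊕ ((s ⊕ v) ⊕ (f₃ ⊕ g))) refl (σT ^ e) F₂′ G₁ (σV ^ e) F₃′ G₂′ ⟩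
      (G₂′ * F₂′) * ((σT ^ e * σV ^ e) * (F₃′ * G₁))            ≈⟨ *-congˡ (*-congʳ (trans (^-congˡ e (σ.*-homo T V′)) (^-distrib-* σT σV e))) ⟨
      (G₂′ * F₂′) * (σ.⟦ T * V′ ⟧ ^ e * (F₃′ * G₁))             ∎)
    where
    open ≈-Reasoning
    V′ σT σV F₁ G₁ F₂′ G₂′ F₃′ G₃′ : Carrier
    V′  = φ.⟦ V ⟧
    σT  = σ.⟦ T ⟧
    σV  = σ.⟦ V′ ⟧
    F₁  = reversed algebra f₁ d w
    G₁  = reversed algebra g₁ e w₁
    F₂′ = reversed algebra f₂ d (w * T)
    G₂′ = reversed algebra g₂ e (w₁ * σT)
    F₃′ = reversed algebra f₃ d (w * (T * V′))
    G₃′ = reversed algebra g₃ e (w₁ * σ.⟦ T * V′ ⟧)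
    φV≈1 : IsPrincipal V′
    φV≈1 = Ideal.∈-resp-≈ (I 0) (trans (φ.sub-homo V B.1#) (+-congˡ (-‿cong φ.1#-homo))) (φI V≈1)
    φw₁ : φ.⟦ B.w₁ ⟧ ≈ w₁ * σT
    φw₁ = trans (φσ B.w) (trans (σ.⟦⟧-cong φw) (σ.*-homo w T))
    φF₂ : φ.⟦ reversed B.algebra f₂ d B.w ⟧ ≈ F₂′
    φF₂ = reversed-homo B.algebra algebra φ f₂ d φw
    φG₂ : φ.⟦ reversed B.algebra g₂ e B.w₁ ⟧ ≈ G₂′
    φG₂ = reversed-homo B.algebra algebra φ g₂ e φw₁
    φF₃ : φ.⟦ reversed B.algebra f₃ d (B.w B.* V) ⟧ ≈ F₃′
    φF₃ = reversed-homo B.algebra algebra φ f₃ d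
      (trans (φ.*-homo B.w V) (trans (*-congʳ φw) (*-assoc w T V′)))
    φG₃ : φ.⟦ reversed B.algebra g₃ e (B.w₁ B.* B.σ.⟦ V ⟧) ⟧ ≈ G₃′
    φG₃ = reversed-homo B.algebra algebra φ g₃ e (trans (φ.*-homo B.w₁ B.σ.⟦ V ⟧)
      (trans (*-cong φw₁ (φσ V)) (trans (*-assoc w₁ σT σV) (*-congˡ (sym (σ.*-homo T V′))))))
    φV-eq : V′ ^ d * (F₂′ * G₃′) ≈ σV ^ e * (F₃′ * G₂′)
    φV-eq = begin
      V′ ^ d * (F₂′ * G₃′)       ≈⟨ *-cong (φ.^-homo V d) (trans (φ.*-homo _ _) (*-cong φF₂ φG₃)) ⟨
      φ.⟦ V B.^ d ⟧ * φ.⟦ _ ⟧    ≈⟨ φ.*-homo _ _ ⟨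
      φ.⟦ _ ⟧                    ≈⟨ φ.⟦⟧-cong V-eq ⟩
      φ.⟦ _ ⟧                    ≈⟨ φ.*-homo _ _ ⟩
      φ.⟦ B.σ.⟦ V ⟧ B.^ e ⟧ * φ.⟦ _ ⟧   ≈⟨ *-cong (trans (φ.^-homo B.σ.⟦ V ⟧ e) (^-congˡ e (φσ V))) (trans (φ.*-homo _ _) (*-cong φF₃ φG₂)) ⟩
      σV ^ e * (F₃′ * G₂′)       ∎

-- Power series at nilpotent elements

module Evaluation {a ℓa b ℓb} (A : CommutativeRing a ℓa) (B : CommutativeRing b ℓb) (φ : RingHom A B)
                  (x : CommutativeRing.Carrier B) where
  private
    module A = CommutativeRing A
    module φ = HomLaws A B φ
  open RingLemmas B
  open PowerSeries A using (Seq; _≋_; _·_; constant; indeterminate)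
  open CommutativeRing (PowerSeries.powerSeries A) using () renaming (_+_ to _⊹_)

  -- Horner's form of the sum of φ(pᵢ)xⁱ over i < n. It becomes multiplicative when xⁿ = 0.
  truncated : ℕ → Seq → Carrier
  truncated zero    p = 0#
  truncated (suc n) p = φ.⟦ p 0 ⟧ + x * truncated n (λ i → p (suc i))

  truncated-cong : ∀ n {p q} → p ≋ q → truncated n p ≈ truncated n q
  truncated-cong zero    p≋q = refl
  truncated-cong (suc n) p≋q = +-cong (φ.⟦⟧-cong (p≋q 0)) (*-congˡ (truncated-cong n (λ i → p≋q (suc i))))

  truncated-+ : ∀ n p q → truncated n (p ⊹ q) ≈ truncated n p + truncated n q
  truncated-+ zero    p q = sym (+-identityˡ 0#)
  truncated-+ (suc n) p q = trans
    (+-cong (φ.+-homo (p 0) (q 0)) (trans (*-congˡ (truncated-+ n _ _)) (distribˡ x _ _)))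
    (+-medial _ _ _ _)

  truncated-scale : ∀ n c p → truncated n (λ i → c A.* p i) ≈ φ.⟦ c ⟧ * truncated n p
  truncated-scale zero    c p = sym (zeroʳ φ.⟦ c ⟧)
  truncated-scale (suc n) c p = trans
    (+-cong (φ.*-homo c (p 0)) (trans (*-congˡ (truncated-scale n c _)) (x∙yz≈y∙xz x φ.⟦ c ⟧ _)))
    (sym (distribˡ φ.⟦ c ⟧ _ _))

  truncated-0 : ∀ n {p} → (∀ i → p i A.≈ A.0#) → truncated n p ≈ 0#
  truncated-0 zero    p≈0 = refl
  truncated-0 (suc n) p≈0 = trans
    (+-cong (trans (φ.⟦⟧-cong (p≈0 0)) φ.0#-homo)
            (trans (*-congˡ (truncated-0 n (λ i → p≈0 (suc i)))) (zeroʳ x)))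
    (+-identityˡ 0#)

  private
    z*0 : ∀ {z y} → z ≈ 0# → z * y ≈ 0#
    z*0 {y = y} z≈0 = trans (*-congʳ z≈0) (zeroˡ y)

    kill : ∀ z n → z * (x ^ suc n) ≈ 0# → (z * x) * (x ^ n) ≈ 0#
    kill z n zx^n≈0 = trans (*-assoc z x (x ^ n)) zx^n≈0

    z1≈0⇒z≈0 : ∀ {z} → z * 1# ≈ 0# → z ≈ 0#
    z1≈0⇒z≈0 {z} eq = trans (sym (*-identityʳ z)) eq

  truncated-suc : ∀ n z → z * x ^ n ≈ 0# → ∀ p → z * truncated (suc n) p ≈ z * truncated n p
  truncated-suc zero    z zx≈0 p = trans (z*0 (z1≈0⇒z≈0 zx≈0)) (sym (z*0 (z1≈0⇒z≈0 zx≈0)))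
  truncated-suc (suc n) z zx≈0 p = begin
    z * (φ.⟦ p 0 ⟧ + x * truncated (suc n) p′)       ≈⟨ distribˡ z _ _ ⟩
    z * φ.⟦ p 0 ⟧ + z * (x * truncated (suc n) p′)   ≈⟨ +-congˡ (*-assoc z x _) ⟨
    z * φ.⟦ p 0 ⟧ + z * x * truncated (suc n) p′     ≈⟨ +-congˡ (truncated-suc n (z * x) (kill z n zx≈0) p′) ⟩
    z * φ.⟦ p 0 ⟧ + z * x * truncated n p′           ≈⟨ +-congˡ (*-assoc z x _) ⟩
    z * φ.⟦ p 0 ⟧ + z * (x * truncated n p′)         ≈⟨ distribˡ z _ _ ⟨
    z * (φ.⟦ p 0 ⟧ + x * truncated n p′)             ∎
    where
    open ≈-Reasoning
    p′ : Seq
    p′ i = p (suc i)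

  truncated-constant : ∀ n z → z * x ^ n ≈ 0# → ∀ c → z * truncated n (constant c) ≈ z * φ.⟦ c ⟧
  truncated-constant zero    z zx≈0 c = trans (z*0 (z1≈0⇒z≈0 zx≈0)) (sym (z*0 (z1≈0⇒z≈0 zx≈0)))
  truncated-constant (suc n) z zx≈0 c = *-congˡ (trans
    (+-congˡ (trans (*-congˡ (truncated-0 n (λ i → A.refl))) (zeroʳ x))) (+-identityʳ φ.⟦ c ⟧))

  truncated-indeterminate : ∀ n z → z * x ^ n ≈ 0# → z * truncated n indeterminate ≈ z * x
  truncated-indeterminate zero    z zx≈0 = trans (z*0 (z1≈0⇒z≈0 zx≈0)) (sym (z*0 (z1≈0⇒z≈0 zx≈0)))
  truncated-indeterminate (suc n) z zx≈0 = begin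
    z * (φ.⟦ A.0# ⟧ + x * truncated n (constant A.1#))  ≈⟨ *-congˡ (trans (+-congʳ φ.0#-homo) (+-identityˡ _)) ⟩
    z * (x * truncated n (constant A.1#))               ≈⟨ *-assoc z x _ ⟨
    (z * x) * truncated n (constant A.1#)               ≈⟨ truncated-constant n (z * x) (kill z n zx≈0) A.1# ⟩
    (z * x) * φ.⟦ A.1# ⟧                                ≈⟨ trans (*-congˡ φ.1#-homo) (*-identityʳ (z * x)) ⟩
    z * x                                               ∎
    where open ≈-Reasoning

  -- The multiplier z makes the induction on n go through: zxⁿ⁺¹ ≈ 0 gives (zx)xⁿ ≈ 0.
  truncated-· : ∀ n z → z * x ^ n ≈ 0# → ∀ p q → z * truncated n (p · q) ≈ z * (truncated n p * truncated n q)
  truncated-· zero    z zx≈0 p q = trans (z*0 (z1≈0⇒z≈0 zx≈0)) (sym (z*0 (z1≈0⇒z≈0 zx≈0)))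
  truncated-· (suc n) z zx≈0 p q = begin
    z * (φ.⟦ p 0 A.* q 0 ⟧ + x * truncated n (p₀q ⊹ (p′ · q)))
      ≈⟨ *-congˡ (+-cong (φ.*-homo (p 0) (q 0)) (*-congˡ (trans (truncated-+ n p₀q (p′ · q)) (+-congʳ (truncated-scale n (p 0) q′))))) ⟩
    z * (P₀ * Q₀ + x * (P₀ * truncated n q′ + truncated n (p′ · q)))
      ≈⟨ *-congˡ (trans (+-congˡ (trans (distribˡ x _ _) (+-congʳ (x∙yz≈y∙xz x P₀ _))))
                 (trans (sym (+-assoc _ _ _)) (+-congʳ (sym (distribˡ P₀ Q₀ _))))) ⟩
    z * (P₀ * Q + x * truncated n (p′ · q))
      ≈⟨ distribˡ z _ _ ⟩
    z * (P₀ * Q) + z * (x * truncated n (p′ · q))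
      ≈⟨ +-congˡ tail-product ⟩
    z * (P₀ * Q) + z * ((x * truncated n p′) * Q)
      ≈⟨ distribˡ z _ _ ⟨
    z * (P₀ * Q + (x * truncated n p′) * Q)
      ≈⟨ *-congˡ (distribʳ Q P₀ (x * truncated n p′)) ⟨
    z * ((P₀ + x * truncated n p′) * Q) ∎
    where
    open ≈-Reasoning
    p′ q′ p₀q : Seq
    p′ i = p (suc i)
    q′ i = q (suc i)
    p₀q i = p 0 A.* q′ i
    P₀ Q₀ Q zx : Carrier
    P₀ = φ.⟦ p 0 ⟧
    Q₀ = φ.⟦ q 0 ⟧
    Q = truncated (suc n) q
    zx = z * x
    zx·x^n≈0 : zx * x ^ n ≈ 0#
    zx·x^n≈0 = kill z n zx≈0
    tail-product : z * (x * truncated n (p′ · q)) ≈ z * ((x * truncated n p′) * Q)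
    tail-product = begin
      z * (x * truncated n (p′ · q))               ≈⟨ *-assoc z x _ ⟨
      zx * truncated n (p′ · q)                    ≈⟨ truncated-· n zx zx·x^n≈0 p′ q ⟩
      zx * (truncated n p′ * truncated n q)        ≈⟨ x∙yz≈y∙xz zx _ _ ⟩
      truncated n p′ * (zx * truncated n q)        ≈⟨ *-congˡ (truncated-suc n zx zx·x^n≈0 q) ⟨
      truncated n p′ * (zx * Q)                    ≈⟨ x∙yz≈y∙xz _ zx Q ⟩
      zx * (truncated n p′ * Q)                    ≈⟨ *-assoc z x _ ⟩
      z * (x * (truncated n p′ * Q))               ≈⟨ *-congˡ (*-assoc x _ Q) ⟨
      z * ((x * truncated n p′) * Q)               ∎

  module _ (n : ℕ) (x^n≈0 : x ^ n ≈ 0#) where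
    private
      1x^n≈0 : 1# * x ^ n ≈ 0#
      1x^n≈0 = trans (*-identityˡ (x ^ n)) x^n≈0

      drop-1 : ∀ {y z} → 1# * y ≈ 1# * z → y ≈ z
      drop-1 {y} {z} eq = trans (sym (*-identityˡ y)) (trans eq (*-identityˡ z))

    evaluate : RingHom (PowerSeries.powerSeries A) B
    evaluate = ringHom (PowerSeries.powerSeries A) B (truncated n) (truncated-cong n) (truncated-+ n)
      (λ p q → drop-1 (truncated-· n 1# 1x^n≈0 p q))
      (trans (drop-1 (truncated-constant n 1# 1x^n≈0 A.1#)) φ.1#-homo)

    evaluate-constant : ∀ c → truncated n (constant c) ≈ φ.⟦ c ⟧
    evaluate-constant c = drop-1 (truncated-constant n 1# 1x^n≈0 c)

    evaluate-indeterminate : truncated n indeterminate ≈ x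
    evaluate-indeterminate = drop-1 (truncated-indeterminate n 1# 1x^n≈0)

module _ {a ℓa} (A : CommutativeRing a ℓa) where
  private
    module A = CommutativeRing A
  open PowerSeries A
  open CommutativeRing powerSeries using () renaming (_≈_ to _≈ₛ_; _+_ to _⊹_; _*_ to _⊛_)

  constant+indeterminate*tail : ∀ p → p ≈ₛ (constant (p 0) ⊹ (indeterminate ⊛ tail p))
  constant+indeterminate*tail p zero    = A.sym (A.trans (A.+-congˡ (A.zeroˡ (p 1))) (A.+-identityʳ (p 0)))
  constant+indeterminate*tail p (suc n) = A.sym (A.trans (A.+-identityˡ _)
    (A.trans (A.+-cong (A.zeroˡ _) (1·q (tail p) n)) (A.+-identityˡ (p (suc n)))))

  module _ {b ℓb} (B : CommutativeRing b ℓb) (φ ψ : RingHom powerSeries B) where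
    private
      module φ = HomLaws powerSeries B φ
      module ψ = HomLaws powerSeries B ψ
    open RingLemmas B

    -- Since p = p₀ + X · tail p, the values of φ and ψ at p agree up to a multiple of φ(X)ⁿ.
    powerSeries-ext : (∀ c → φ.⟦ constant c ⟧ ≈ ψ.⟦ constant c ⟧) →
      φ.⟦ indeterminate ⟧ ≈ ψ.⟦ indeterminate ⟧ → ∀ n → φ.⟦ indeterminate ⟧ ^ n ≈ 0# →
      ∀ p → φ.⟦ p ⟧ ≈ ψ.⟦ p ⟧
    powerSeries-ext φ≈ψ x≈y n x^n≈0 p = trans (sym (*-identityˡ φ.⟦ p ⟧))
      (trans (multiples n 1# (trans (*-identityˡ (x ^ n)) x^n≈0) p) (*-identityˡ ψ.⟦ p ⟧))
      where
      open ≈-Reasoning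
      x : Carrier
      x = φ.⟦ indeterminate ⟧
      split : ∀ (χ : RingHom powerSeries B) (let module χ = HomLaws powerSeries B χ) p →
              χ.⟦ p ⟧ ≈ χ.⟦ constant (p 0) ⟧ + χ.⟦ indeterminate ⟧ * χ.⟦ tail p ⟧
      split χ p = trans (⟦⟧-cong (constant+indeterminate*tail p))
        (trans (+-homo (constant (p 0)) (indeterminate ⊛ tail p)) (+-congˡ (*-homo indeterminate (tail p))))
        where open HomLaws powerSeries B χ
      multiples : ∀ n z → z * x ^ n ≈ 0# → ∀ p → z * φ.⟦ p ⟧ ≈ z * ψ.⟦ p ⟧
      multiples zero    z z1≈0 p = trans (*-congʳ z≈0) (trans (zeroˡ _) (sym (trans (*-congʳ z≈0) (zeroˡ _))))
        where
        z≈0 : z ≈ 0#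
        z≈0 = trans (sym (*-identityʳ z)) z1≈0
      multiples (suc n) z zx≈0 p = begin
        z * φ.⟦ p ⟧                                                ≈⟨ *-congˡ (split φ p) ⟩
        z * (φ.⟦ constant (p 0) ⟧ + x * φ.⟦ tail p ⟧)              ≈⟨ trans (distribˡ z _ _) (+-congˡ (sym (*-assoc z x _))) ⟩
        z * φ.⟦ constant (p 0) ⟧ + (z * x) * φ.⟦ tail p ⟧
          ≈⟨ +-cong (*-congˡ (φ≈ψ (p 0))) (multiples n (z * x) (trans (*-assoc z x (x ^ n)) zx≈0) (tail p)) ⟩
        z * ψ.⟦ constant (p 0) ⟧ + (z * x) * ψ.⟦ tail p ⟧          ≈⟨ +-congˡ (trans (*-congʳ (*-congˡ x≈y)) (*-assoc z _ _)) ⟩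
        z * ψ.⟦ constant (p 0) ⟧ + z * (ψ.⟦ indeterminate ⟧ * ψ.⟦ tail p ⟧)   ≈⟨ distribˡ z _ _ ⟨
        z * (ψ.⟦ constant (p 0) ⟧ + ψ.⟦ indeterminate ⟧ * ψ.⟦ tail p ⟧)       ≈⟨ *-congˡ (split ψ p) ⟨
        z * ψ.⟦ p ⟧                                                ∎

-- Monomials and power series in several variables

module _ {k ℓ a ℓa} {K : CommutativeRing k ℓ} (A : CommutativeAlgebra K a ℓa) where
  open CommutativeAlgebra A using (ring)
  open RingLemmas ring hiding (ring)

  monomialAt : ∀ {n} → (Fin n → Carrier) → Vec ℕ n → Carrier
  monomialAt x []      = 1#
  monomialAt x (i ∷ α) = x zero ^ i * monomialAt (λ j → x (suc j)) α

  monomialAt-cong : ∀ {n} {x y : Fin n → Carrier} → (∀ i → x i ≈ y i) → ∀ α → monomialAt x α ≈ monomialAt y α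
  monomialAt-cong x≈y []      = refl
  monomialAt-cong x≈y (i ∷ α) = *-cong (^-congˡ i (x≈y zero)) (monomialAt-cong (λ j → x≈y (suc j)) α)

  monomialAt-* : ∀ {n} (x y : Fin n → Carrier) α →
    monomialAt (λ i → x i * y i) α ≈ monomialAt x α * monomialAt y α
  monomialAt-* x y []      = sym (*-identityˡ 1#)
  monomialAt-* x y (i ∷ α) = trans
    (*-cong (^-distrib-* (x zero) (y zero) i) (monomialAt-* (λ j → x (suc j)) (λ j → y (suc j)) α))
    (*-medial _ _ _ _)

module _ {k ℓ a ℓa b ℓb} {K : CommutativeRing k ℓ} (A : CommutativeAlgebra K a ℓa) (B : CommutativeAlgebra K b ℓb)
         (φ : AlgebraHom A B) where
  private
    module A = CommutativeAlgebra A
    module B = CommutativeAlgebra B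
  open AlgebraHom φ

  monomialAt-homo : ∀ {n} (x : Fin n → A.Carrier) α →
    ⟦ monomialAt A x α ⟧ B.≈ monomialAt B (λ i → ⟦ x i ⟧) α
  monomialAt-homo x []      = 1#-homo
  monomialAt-homo x (i ∷ α) = B.trans (*-homo (x zero A.^ i) (monomialAt A (λ j → x (suc j)) α))
    (B.*-cong (^-homo (x zero) i) (monomialAt-homo (λ j → x (suc j)) α))

module SeriesHoms {k ℓ} (K : CommutativeRing k ℓ) {b ℓb} (B : CommutativeAlgebra K b ℓb) where
  open Series K
  open CommutativeAlgebra B using (ring; scalar; structureMap)
  open RingLemmas ring hiding (ring)

  -- Induction on the variables, w₀ being outermost: each step is the case of one variable over the
  -- series in the others. Nilpotent values take the place of continuity.
  series-ext : ∀ n (φ ψ : RingHom (series n) ring) (let module φ = HomLaws (series n) ring φ)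
    (let module ψ = HomLaws (series n) ring ψ) →
    (∀ c → φ.⟦ RingHomomorphism.⟦_⟧ (scalarHom n) c ⟧ ≈ ψ.⟦ RingHomomorphism.⟦_⟧ (scalarHom n) c ⟧) →
    (∀ (i : Fin n) → φ.⟦ var i ⟧ ≈ ψ.⟦ var i ⟧) → (∀ (i : Fin n) → ∃[ m ] φ.⟦ var i ⟧ ^ m ≈ 0#) →
    ∀ p → φ.⟦ p ⟧ ≈ ψ.⟦ p ⟧
  series-ext zero    φ ψ scalars vars nil = scalars
  series-ext (suc n) φ ψ scalars vars nil = powerSeries-ext (series n) ring φ ψ
    (series-ext n (compose (series n) (series (suc n)) ring φ (PowerSeries.constantHom (series n)))
                  (compose (series n) (series (suc n)) ring ψ (PowerSeries.constantHom (series n)))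
                  scalars (λ i → vars (suc i)) (λ i → nil (suc i)))
    (vars zero) (proj₁ (nil zero)) (proj₂ (nil zero))

  module _ (m : ℕ) where

    evaluateSeries : ∀ n (x : Fin n → Carrier) → (∀ i → x i ^ m ≈ 0#) → RingHom (series n) ring
    evaluateSeries zero    x nil = structureMap
    evaluateSeries (suc n) x nil = Evaluation.evaluate (series n) ring
      (evaluateSeries n (λ i → x (suc i)) (λ i → nil (suc i))) (x zero) m (nil zero)

    evaluateSeries-scalar : ∀ n x nil c →
      RingHomomorphism.⟦_⟧ (evaluateSeries n x nil) (RingHomomorphism.⟦_⟧ (scalarHom n) c) ≈ scalar c
    evaluateSeries-scalar zero    x nil c = refl
    evaluateSeries-scalar (suc n) x nil c = trans
      (Evaluation.evaluate-constant (series n) ring (evaluateSeries n (λ i → x (suc i)) (λ i → nil (suc i)))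
        (x zero) m (nil zero) _)
      (evaluateSeries-scalar n (λ i → x (suc i)) (λ i → nil (suc i)) c)

    evaluateSeries-var : ∀ n x nil i → RingHomomorphism.⟦_⟧ (evaluateSeries n x nil) (var i) ≈ x i
    evaluateSeries-var (suc n) x nil zero    = Evaluation.evaluate-indeterminate (series n) ring
      (evaluateSeries n (λ i → x (suc i)) (λ i → nil (suc i))) (x zero) m (nil zero)
    evaluateSeries-var (suc n) x nil (suc i) = trans
      (Evaluation.evaluate-constant (series n) ring (evaluateSeries n (λ i → x (suc i)) (λ i → nil (suc i)))
        (x zero) m (nil zero) _)
      (evaluateSeries-var n (λ i → x (suc i)) (λ i → nil (suc i)) i)

    -- The value of p is a finite sum, so it lies in J as soon as each term does. The multiplier y
    -- collects the powers of the coordinates already split off, and T becomes the condition on the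
    -- exponents still to come. When none are left, deciding T tells whether the coefficient is zero
    -- or the monomial lies in J.
    evaluateSeries-vanishing : ∀ {q} (J : Ideal ring q) {n} x nil {T : Vec ℕ n → Set} →
      (∀ α → Dec (T α)) → ∀ y → (∀ α → ¬ T α → (y * monomialAt B x α) ∈ Member J) →
      ∀ p → Vanishing T p → (y * RingHomomorphism.⟦_⟧ (evaluateSeries n x nil) p) ∈ Member J
    evaluateSeries-vanishing J {zero} x nil T? y hyp p vp with T? []
    ... | yes t = Ideal.∈-resp-≈ J
      (sym (trans (*-congˡ (trans (structure.⟦⟧-cong (vp [] t)) structure.0#-homo)) (zeroʳ y))) (Ideal.0∈ J)
      where module structure = HomLaws K ring structureMap
    ... | no ¬t = Ideal.∈-resp-≈ J (*-comm _ y) (Ideal.*-closed J _ (Ideal.∈-resp-≈ J (*-identityʳ y) (hyp [] ¬t)))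
    evaluateSeries-vanishing J {suc n} x nil {T} T? y hyp p vp = go m y T T? hyp p vp
      where
      tail-nil : ∀ i → x (suc i) ^ m ≈ 0#
      tail-nil i = nil (suc i)
      open Evaluation (series n) ring (evaluateSeries n (λ i → x (suc i)) tail-nil) (x zero)
      go : ∀ l y (T : Vec ℕ (suc n) → Set) → (∀ α → Dec (T α)) → (∀ α → ¬ T α → (y * monomialAt B x α) ∈ Member J) →
        ∀ p → Vanishing {suc n} T p → (y * truncated l p) ∈ Member J
      go zero    y T T? hyp p vp = Ideal.∈-resp-≈ J (sym (zeroʳ y)) (Ideal.0∈ J)
      go (suc l) y T T? hyp p vp = Ideal.∈-resp-≈ J
        (trans (+-congˡ (*-assoc y (x zero) _)) (sym (distribˡ y _ _)))
        (Ideal.+-closed J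
          (evaluateSeries-vanishing J (λ i → x (suc i)) tail-nil (λ α → T? (0 ∷ α)) y
            (λ α ¬t → Ideal.∈-resp-≈ J (*-congˡ (*-identityˡ _)) (hyp (0 ∷ α) ¬t))
            (p 0) (λ α → vp (0 ∷ α)))
          -- A factor of the first coordinate moves from the series into the multiplier, so the
          -- condition is read one exponent higher.
          (go l (y * x zero) (λ { (i ∷ α) → T (suc i ∷ α) }) (λ { (i ∷ α) → T? (suc i ∷ α) })
            (λ { (i ∷ α) ¬t → Ideal.∈-resp-≈ J
                   (trans (*-congˡ (*-assoc (x zero) _ _)) (sym (*-assoc y (x zero) _))) (hyp (suc i ∷ α) ¬t) })
            (λ i → p (suc i)) (λ { (i ∷ α) → vp (suc i ∷ α) })))

-- Weights

toℚᵘ-/ : ∀ a n → ℚ.toℚᵘ (ℤ.+ a ℚ./ suc n) ℚᵘ.≃ ℚᵘ.mkℚᵘ (ℤ.+ a) n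
toℚᵘ-/ a n = ℚₚ.toℚᵘ-fromℚᵘ (ℚᵘ.mkℚᵘ (ℤ.+ a) n)

/-+ : ∀ a b n .{{_ : NonZero n}} → (ℤ.+ a ℚ./ n) ℚ.+ (ℤ.+ b ℚ./ n) ≡ ℤ.+ (a ℕ.+ b) ℚ./ n
/-+ a b (suc n) = ℚₚ.toℚᵘ-injective (begin
  ℚ.toℚᵘ ((ℤ.+ a ℚ./ suc n) ℚ.+ (ℤ.+ b ℚ./ suc n))              ≈⟨ ℚₚ.toℚᵘ-homo-+ (ℤ.+ a ℚ./ suc n) (ℤ.+ b ℚ./ suc n) ⟩
  ℚ.toℚᵘ (ℤ.+ a ℚ./ suc n) ℚᵘ.+ ℚ.toℚᵘ (ℤ.+ b ℚ./ suc n)        ≈⟨ ℚᵘₚ.+-cong (toℚᵘ-/ a n) (toℚᵘ-/ b n) ⟩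
  ℚᵘ.mkℚᵘ (ℤ.+ a) n ℚᵘ.+ ℚᵘ.mkℚᵘ (ℤ.+ b) n                      ≈⟨ ℚᵘ.*≡* (cross (ℤ.+ a) (ℤ.+ b) (ℤ.+ suc n)) ⟩
  ℚᵘ.mkℚᵘ (ℤ.+ (a ℕ.+ b)) n                                     ≈⟨ toℚᵘ-/ (a ℕ.+ b) n ⟨
  ℚ.toℚᵘ (ℤ.+ (a ℕ.+ b) ℚ./ suc n)                              ∎)
  where
  open ℚᵘₚ.≃-Reasoning
  cross : ∀ x y z → (x ℤ.* z ℤ.+ y ℤ.* z) ℤ.* z ≡ (x ℤ.+ y) ℤ.* (z ℤ.* z)
  cross = ℤSolver.solve-∀

/-* : ∀ a b m n .{{_ : NonZero m}} .{{_ : NonZero n}} .{{_ : NonZero (m ℕ.* n)}} →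
      (ℤ.+ a ℚ./ m) ℚ.* (ℤ.+ b ℚ./ n) ≡ ℤ.+ (a ℕ.* b) ℚ./ (m ℕ.* n)
/-* a b (suc m) (suc n) = ℚₚ.toℚᵘ-injective (begin
  ℚ.toℚᵘ ((ℤ.+ a ℚ./ suc m) ℚ.* (ℤ.+ b ℚ./ suc n))              ≈⟨ ℚₚ.toℚᵘ-homo-* (ℤ.+ a ℚ./ suc m) (ℤ.+ b ℚ./ suc n) ⟩
  ℚ.toℚᵘ (ℤ.+ a ℚ./ suc m) ℚᵘ.* ℚ.toℚᵘ (ℤ.+ b ℚ./ suc n)        ≈⟨ ℚᵘₚ.*-cong (toℚᵘ-/ a m) (toℚᵘ-/ b n) ⟩
  ℚᵘ.mkℚᵘ (ℤ.+ a) m ℚᵘ.* ℚᵘ.mkℚᵘ (ℤ.+ b) n                      ≈⟨ ℚᵘ.*≡* (≡.cong (ℤ._* (ℤ.+ (suc m ℕ.* suc n))) (≡.sym (ℤₚ.pos-* a b))) ⟩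
  ℚᵘ.mkℚᵘ (ℤ.+ (a ℕ.* b)) (n ℕ.+ m ℕ.* suc n)                   ≈⟨ toℚᵘ-/ (a ℕ.* b) (n ℕ.+ m ℕ.* suc n) ⟨
  ℚ.toℚᵘ (ℤ.+ (a ℕ.* b) ℚ./ (suc m ℕ.* suc n))                  ∎)
  where open ℚᵘₚ.≃-Reasoning

Threshold : Set
Threshold = ∃ (0ℚ ℚ.<_)

module WeightLevels (d e : ℕ) (1≤e : 1 ℕ.≤ e) (e<d : e ℕ.< d) where
  open Weight d e 1≤e e<d

  private
    instance
      e≢0 : NonZero e
      e≢0 = ℕ.>-nonZero 1≤e
      d≢0 : NonZero d
      d≢0 = ℕ.>-nonZero (ℕₚ.<-trans 1≤e e<d)
      den≢0 : NonZero (2 ℕ.* e)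
      den≢0 = ℕₚ.m*n≢0 2 e
      den²≢0 : NonZero (e ℕ.* (2 ℕ.* e))
      den²≢0 = ℕₚ.m*n≢0 e (2 ℕ.* e)
      ratio>0 : ℚ.Positive ratio
      ratio>0 = ℚₚ.normalize-pos d e

  -- Starting at ½, multiplying by ratio ≥ 1 + 1/e or adding ½ climbs at least one level.
  level : ℕ → ℚ
  level k = ℤ.+ (e ℕ.+ k) ℚ./ (2 ℕ.* e)

  level>0 : ∀ k → 0ℚ ℚ.< level k
  level>0 k = ℚₚ.positive⁻¹ (level k) {{ℚₚ.normalize-pos (e ℕ.+ k) (2 ℕ.* e) {{den≢0}} {{ℕ.>-nonZero (ℕₚ.≤-trans 1≤e (ℕₚ.m≤m+n e k))}}}}

  levelThreshold : ℕ → Threshold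
  levelThreshold k = level k , level>0 k

  level-suc : ∀ k → level k ℚ.≤ level (suc k)
  level-suc k = /-mono (e ℕ.+ k) (e ℕ.+ suc k) (2 ℕ.* e) (2 ℕ.* e)
    (ℕₚ.*-monoˡ-≤ (2 ℕ.* e) (ℕₚ.+-monoʳ-≤ e (ℕₚ.n≤1+n k)))

  level-+ : ∀ k → level (suc k) ℚ.≤ level 0 ℚ.+ level k
  level-+ k = ≡.subst (level (suc k) ℚ.≤_) (≡.sym (/-+ (e ℕ.+ 0) (e ℕ.+ k) (2 ℕ.* e)))
    (/-mono (e ℕ.+ suc k) ((e ℕ.+ 0) ℕ.+ (e ℕ.+ k)) (2 ℕ.* e) (2 ℕ.* e) (ℕₚ.*-monoˡ-≤ (2 ℕ.* e)
      (begin
        e ℕ.+ suc k                ≡⟨ ℕₚ.+-suc e k ⟩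
        1 ℕ.+ (e ℕ.+ k)            ≤⟨ ℕₚ.+-monoˡ-≤ (e ℕ.+ k) 1≤e ⟩
        e ℕ.+ (e ℕ.+ k)            ≡⟨ ≡.cong (ℕ._+ (e ℕ.+ k)) (ℕₚ.+-identityʳ e) ⟨
        e ℕ.+ 0 ℕ.+ (e ℕ.+ k)      ∎)))
    where open ℕₚ.≤-Reasoning

  -- From d ≥ e + 1 the gain is at least `level k` divided by e; since `level k` ≥ ½ this is a full
  -- step 1/(2e).
  level-ratio : ∀ k → level (suc k) ℚ.≤ ratio ℚ.* level k
  level-ratio k = ≡.subst (level (suc k) ℚ.≤_) (≡.sym (/-* d (e ℕ.+ k) e (2 ℕ.* e)))
    (/-mono (e ℕ.+ suc k) (d ℕ.* (e ℕ.+ k)) (2 ℕ.* e) (e ℕ.* (2 ℕ.* e)) (begin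
      (e ℕ.+ suc k) ℕ.* (e ℕ.* (2 ℕ.* e))      ≡⟨ ℕₚ.*-assoc (e ℕ.+ suc k) e (2 ℕ.* e) ⟨
      (e ℕ.+ suc k) ℕ.* e ℕ.* (2 ℕ.* e)        ≤⟨ ℕₚ.*-monoˡ-≤ (2 ℕ.* e) (begin
        (e ℕ.+ suc k) ℕ.* e                    ≡⟨ ≡.cong (ℕ._* e) (ℕₚ.+-suc e k) ⟩
        e ℕ.+ (e ℕ.+ k) ℕ.* e                  ≤⟨ ℕₚ.+-monoˡ-≤ ((e ℕ.+ k) ℕ.* e) (ℕₚ.m≤m+n e k) ⟩
        (e ℕ.+ k) ℕ.+ (e ℕ.+ k) ℕ.* e          ≡⟨ ≡.cong ((e ℕ.+ k) ℕ.+_) (ℕₚ.*-comm (e ℕ.+ k) e) ⟩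
        suc e ℕ.* (e ℕ.+ k)                    ≤⟨ ℕₚ.*-monoˡ-≤ (e ℕ.+ k) e<d ⟩
        d ℕ.* (e ℕ.+ k)                        ∎) ⟩
      d ℕ.* (e ℕ.+ k) ℕ.* (2 ℕ.* e)            ∎))
    where open ℕₚ.≤-Reasoning

  level-unbounded : ∀ X → 0ℚ ℚ.< X → ∃[ n ] X ℚ.≤ level n
  -- This level is ½ + n, which exceeds n and so also X = n/(m + 1).
  level-unbounded X@(ℚ.mkℚ (ℤ.+ n) m _) _ = n ℕ.* (2 ℕ.* e) ,
    ≡.subst (ℚ._≤ level (n ℕ.* (2 ℕ.* e))) (ℚₚ.↥p/↧p≡p X)
      (/-mono n (e ℕ.+ n ℕ.* (2 ℕ.* e)) (suc m) (2 ℕ.* e)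
        (ℕₚ.≤-trans (ℕₚ.m≤n+m (n ℕ.* (2 ℕ.* e)) e) (ℕₚ.m≤m*n _ (suc m))))
  level-unbounded (ℚ.mkℚ ℤ.-[1+ n ] m _) (ℚ.*<* ())

  level-0<1 : level 0 ℚ.< 1ℚ
  level-0<1 = ℚₚ.≤-<-trans
    (/-mono (e ℕ.+ 0) 1 (2 ℕ.* e) 2 (ℕₚ.≤-reflexive (≡.trans (≡.cong (ℕ._* 2) (ℕₚ.+-identityʳ e))
      (≡.trans (ℕₚ.*-comm e 2) (≡.sym (ℕₚ.*-identityˡ (2 ℕ.* e)))))))
    (ℚ.*<* (ℤ.+<+ (ℕ.s≤s (ℕ.s≤s ℕ.z≤n))))

  weight-+ : ∀ {n} (α β : Vec ℕ n) → weight (zipWith ℕ._+_ α β) ≡ weight α ℚ.+ weight β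
  weight-+ []      []      = ≡.refl
  weight-+ (i ∷ α) (j ∷ β) = begin
    ℤ.+ (i ℕ.+ j) ℚ./ 1 ℚ.+ ratio ℚ.* weight (zipWith ℕ._+_ α β)
      ≡⟨ ≡.cong₂ ℚ._+_ (≡.sym (/-+ i j 1)) (≡.trans (≡.cong (ratio ℚ.*_) (weight-+ α β)) (ℚₚ.*-distribˡ-+ ratio (weight α) (weight β))) ⟩
    (I ℚ.+ J) ℚ.+ (ratio ℚ.* weight α ℚ.+ ratio ℚ.* weight β)
      ≡⟨ interchange I J (ratio ℚ.* weight α) (ratio ℚ.* weight β) ⟩
    (I ℚ.+ ratio ℚ.* weight α) ℚ.+ (J ℚ.+ ratio ℚ.* weight β) ∎
    where
    open ≡.≡-Reasoning
    open Algebra.Properties.CommutativeSemigroup (CommutativeMonoid.commutativeSemigroup ℚₚ.+-0-commutativeMonoid)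
      using (interchange)
    I J : ℚ
    I = ℤ.+ i ℚ./ 1
    J = ℤ.+ j ℚ./ 1

  -- Weights add, so two weights above X and Y cannot sum to at most X + Y. The alternative is the
  -- shape in which `vanishing-product` needs this.
  weight-+-≤ : ∀ {n} X Y {Z} → Z ℚ.≤ X ℚ.+ Y → (α β : Vec ℕ n) → weight (zipWith ℕ._+_ α β) ℚ.≤ Z →
               (weight α ℚ.≤ X) ⊎ (weight β ℚ.≤ Y)
  weight-+-≤ X Y Z≤X+Y α β αβ≤Z with weight α ℚₚ.≤? X | weight β ℚₚ.≤? Y
  ... | yes α≤X | _       = inj₁ α≤X
  ... | no  _   | yes β≤Y = inj₂ β≤Y
  ... | no  α≰X | no  β≰Y = contradiction
    (ℚₚ.<-≤-trans (ℚₚ.+-mono-< (ℚₚ.≰⇒> α≰X) (ℚₚ.≰⇒> β≰Y))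
      (ℚₚ.≤-trans (ℚₚ.≤-reflexive (≡.sym (weight-+ α β))) (ℚₚ.≤-trans αβ≤Z Z≤X+Y)))
    (ℚₚ.<-irrefl ≡.refl)

  -- Prepending a zero exponent is the effect of σ on monomials. It multiplies the weight by
  -- `ratio`, which is cancelled against `level-ratio`.
  weight-0∷-≤ : ∀ {n} k (α : Vec ℕ n) → weight (0 ∷ α) ℚ.≤ level (suc k) → weight α ℚ.≤ level k
  weight-0∷-≤ k α 0α≤ = ℚₚ.*-cancelˡ-≤-pos ratio
    (ℚₚ.≤-trans (ℚₚ.≤-reflexive (≡.sym (ℚₚ.+-identityˡ (ratio ℚ.* weight α)))) (ℚₚ.≤-trans 0α≤ (level-ratio k)))

-- Maps out of quotients and colimits

module _ {a ℓa b ℓb p} (A : CommutativeRing a ℓa) (B : CommutativeRing b ℓb) (I : Ideal A p) (φ : RingHom A B) where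
  private
    module A = CommutativeRing A
  open RingLemmas B
  open HomLaws A B φ

  quotientLift : (∀ {x} → x ∈ Member I → ⟦ x ⟧ ≈ 0#) → RingHom (A / I) B
  quotientLift φI≈0 = ringHom (A / I) B ⟦_⟧
    (λ {x} {y} x-y∈ → x-y≈0⇒x≈y ⟦ x ⟧ ⟦ y ⟧ (trans (sym (sub-homo x y)) (φI≈0 x-y∈)))
    +-homo *-homo 1#-homo

module ColimitLemmas {a ℓ} (A : ℕ → CommutativeRing a ℓ) (step : ∀ n → RingHom (A n) (A (suc n))) where
  open Colimit A step
  private
    module A n = CommutativeRing (A n)
    module step n = RingHomomorphism (step n)
    module C = CommutativeRing colimit

  module _ {b ℓb} (B : CommutativeRing b ℓb) (φ : ∀ n → RingHom (A n) B) where
    open RingLemmas B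
    private
      module φ n = RingHomomorphism (φ n)

    module _ (φ-step : ∀ n x → φ.⟦_⟧ (suc n) (step.⟦_⟧ n x) ≈ φ.⟦_⟧ n x) where

      φ-push : ∀ {m n} (p : m ≤′ n) x → φ.⟦_⟧ n (push p x) ≈ φ.⟦_⟧ m x
      φ-push (≤′-reflexive ≡.refl) x = refl
      φ-push (≤′-step {n} p)       x = trans (φ-step n (push p x)) (φ-push p x)

      colimitLift : RingHom colimit B
      colimitLift = ringHom colimit B (λ (n , x) → φ.⟦_⟧ n x)
        (λ { {m , x} {n , y} (N , p , q , eq) →
             trans (sym (φ-push p x)) (trans (φ.⟦⟧-cong N eq) (φ-push q y)) })
        (λ (m , x) (n , y) → trans (φ.+-homo (m ℕ.+ n) _ _) (+-cong (φ-push (left m n) x) (φ-push (right m n) y)))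
        (λ (m , x) (n , y) → trans (φ.*-homo (m ℕ.+ n) _ _) (*-cong (φ-push (left m n) x) (φ-push (right m n) y)))
        (φ.1#-homo 0)

      colimitLift-∈ : ∀ {p q} (J : ∀ n → Ideal (A n) p)
        (step-J : ∀ n {x} → x ∈ Member (J n) → step.⟦_⟧ n x ∈ Member (J (suc n))) (L : Ideal B q) →
        (∀ n {x} → x ∈ Member (J n) → φ.⟦_⟧ n x ∈ Member L) →
        ∀ {x} → x ∈ Member (unionIdeal J step-J) → RingHomomorphism.⟦_⟧ colimitLift x ∈ Member L
      colimitLift-∈ J step-J L φJ {n , x} (N , p , x∈) = Ideal.∈-resp-≈ L (φ-push p x) (φJ N x∈)

  module _ {p q r} (I : ∀ n → Ideal (A n) p) (step-I : ∀ n {x} → x ∈ Member (I n) → step.⟦_⟧ n x ∈ Member (I (suc n)))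
           (J : ∀ n → Ideal (A n) q) (step-J : ∀ n {x} → x ∈ Member (J n) → step.⟦_⟧ n x ∈ Member (J (suc n)))
           (L : ∀ n → Ideal (A n) r) (step-L : ∀ n {x} → x ∈ Member (L n) → step.⟦_⟧ n x ∈ Member (L (suc n))) where

    unionIdeal-* : (∀ n {x y} → x ∈ Member (I n) → y ∈ Member (J n) → A._*_ n x y ∈ Member (L n)) →
      ∀ {x y} → x ∈ Member (unionIdeal I step-I) → y ∈ Member (unionIdeal J step-J) →
      (x C.* y) ∈ Member (unionIdeal L step-L)
    unionIdeal-* IJ⊆L {x@(m , _)} {y@(n , _)} (k , q , x∈) (l , r , y∈) = N , mn ,
      Ideal.∈-resp-≈ (L N) (A.sym N (from-* x y mn (≤ˡ m n mn) (≤ʳ m n mn)))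
        (IJ⊆L N (later I step-I x q x∈ (≤ˡ k l kl) (≤ˡ m n mn)) (later J step-J y r y∈ (≤ʳ k l kl) (≤ʳ m n mn)))
      where
      N : ℕ
      N = (k ℕ.+ l) ℕ.+ (m ℕ.+ n)
      kl : k ℕ.+ l ≤′ N
      kl = left (k ℕ.+ l) (m ℕ.+ n)
      mn : m ℕ.+ n ≤′ N
      mn = right (k ℕ.+ l) (m ℕ.+ n)

  module _ {p q} (I : ∀ n → Ideal (A n) p) (step-I : ∀ n {x} → x ∈ Member (I n) → step.⟦_⟧ n x ∈ Member (I (suc n)))
           (J : ∀ n → Ideal (A n) q) (step-J : ∀ n {x} → x ∈ Member (J n) → step.⟦_⟧ n x ∈ Member (J (suc n))) where

    unionIdeal-mono : (∀ n {x} → x ∈ Member (I n) → x ∈ Member (J n)) →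
      ∀ {x} → x ∈ Member (unionIdeal I step-I) → x ∈ Member (unionIdeal J step-J)
    unionIdeal-mono I⊆J (N , p , x∈) = N , p , I⊆J N x∈

    colimitMap-⊆ : (φ : ∀ n → RingHom (A n) (A (suc n)))
      (φ-natural : ∀ n x → A._≈_ (suc (suc n)) (RingHomomorphism.⟦_⟧ (φ (suc n)) (step.⟦_⟧ n x))
                                               (step.⟦_⟧ (suc n) (RingHomomorphism.⟦_⟧ (φ n) x))) →
      (∀ n {x} → x ∈ Member (I n) → RingHomomorphism.⟦_⟧ (φ n) x ∈ Member (J (suc n))) →
      ∀ {x} → x ∈ Member (unionIdeal I step-I) → mapᶜ φ φ-natural x ∈ Member (unionIdeal J step-J)
    colimitMap-⊆ φ φ-natural φI⊆J {n , x} (N , p , x∈) = suc N , ℕₚ.s≤′s p ,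
      Ideal.∈-resp-≈ (J (suc N)) (A.sym (suc N) (push-φ φ φ-natural p (ℕₚ.s≤′s p) x)) (φI⊆J N x∈)

-- Vanishing coefficients of products and monomials

module VanishingLemmas {k ℓ} (K : CommutativeRing k ℓ) where
  open Series K
  private
    module K = CommutativeRing K
    module S n = RingLemmas (series n)

  -- A coefficient of the product sums over the decompositions α + β of its exponent, and each
  -- summand has a vanishing factor. The Cauchy product in `go` peels coefficients off p alone, so T
  -- and V shift while q and U stay.
  vanishing-product : ∀ {n} {T U V : Vec ℕ n → Set} →
    (∀ α β → V (zipWith ℕ._+_ α β) → T α ⊎ U β) → {p q : S.Carrier n} →
    Vanishing T p → Vanishing U q → Vanishing V (S._*_ n p q)
  vanishing-product {zero} split vp vq [] v =
    [ (λ t → K.trans (K.*-congʳ (vp [] t)) (K.zeroˡ _)) , (λ u → K.trans (K.*-congˡ (vq [] u)) (K.zeroʳ _)) ]′ (split [] [] v)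
  vanishing-product {suc n} {T} {U} {V} split {p} {q} vp vq (i ∷ α) = go p i T V split vp α
    where
    go : ∀ p i (T V : Vec ℕ (suc n) → Set) → (∀ α β → V (zipWith ℕ._+_ α β) → T α ⊎ U β) →
      Vanishing T p → Vanishing (λ α → V (i ∷ α)) (PowerSeries.convolution (series n) p q i)
    go p zero    T V split vp = vanishing-product (λ α β → split (0 ∷ α) (0 ∷ β)) (λ α → vp (0 ∷ α)) (λ α → vq (0 ∷ α))
    go p (suc i) T V split vp = vanishing-+ {p = S._*_ n (p 0) (q (suc i))}
      (vanishing-product (λ α β → split (0 ∷ α) (suc i ∷ β)) (λ α → vp (0 ∷ α)) (λ α → vq (suc i ∷ α)))
      (go (λ j → p (suc j)) i (λ { (j ∷ α) → T (suc j ∷ α) }) (λ { (j ∷ α) → V (suc j ∷ α) })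
        (λ { (j ∷ α) (l ∷ β) → split (suc j ∷ α) (l ∷ β) }) (λ { (j ∷ α) → vp (suc j ∷ α) }))

  monomialSeries : ∀ {n} → Vec ℕ n → S.Carrier n
  monomialSeries {zero}  []      = K.1#
  monomialSeries {suc n} (i ∷ α) = S._*_ (suc n) (S._^_ (suc n) (var {suc n} zero) i)
    (PowerSeries.constant (series n) (monomialSeries α))

  -- All coefficients away from α are zero, and α lies outside T. Multiplication by w₀ moves the
  -- coefficients up one place, so `go` shifts T accordingly.
  monomialSeries-vanishing : ∀ {n} {T : Vec ℕ n → Set} (α : Vec ℕ n) → ¬ T α → Vanishing T (monomialSeries α)
  monomialSeries-vanishing {zero}  []      ¬t [] t = contradiction t ¬t
  monomialSeries-vanishing {suc n} {T} (i ∷ α) ¬t (j ∷ β) = go i (λ j β → T (j ∷ β)) (monomialSeries-vanishing α ¬t) j β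
    where
    open PowerSeries (series n) using (constant; 1·q)
    module Sₙ = S n
    module Sₙ₊₁ = S (suc n)
    w₀ : Sₙ₊₁.Carrier
    w₀ = var {suc n} zero
    go : ∀ i (T : ℕ → Vec ℕ n → Set) {q} → Vanishing (T i) q → ∀ j →
         Vanishing (T j) (Sₙ₊₁._*_ (Sₙ₊₁._^_ w₀ i) (constant q) j)
    go zero T {q} vq zero    β t = K.trans (coefficient-cong {p = _} {q} (1·q (constant q) 0) β) (vq β t)
    go zero T {q} vq (suc j) β t = K.trans (coefficient-cong {p = _} {Sₙ.0#} (1·q (constant q) (suc j)) β) (coefficient-0 β)
    go (suc i) T {q} vq zero β t = K.trans
      (coefficient-cong {p = _} {Sₙ.0#} (Sₙ.trans (Sₙ.*-congʳ (Sₙ.zeroˡ _)) (Sₙ.zeroˡ _)) β) (coefficient-0 β)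
    go (suc i) T {q} vq (suc j) β t = K.trans
      (coefficient-cong {p = Sₙ₊₁._*_ (Sₙ₊₁._^_ w₀ (suc i)) (constant q) (suc j)} {rest j} shifted β)
      (go i (λ j → T (suc j)) vq j β t)
      where
      rest : Sₙ₊₁.Carrier
      rest = Sₙ₊₁._*_ (Sₙ₊₁._^_ w₀ i) (constant q)
      shifted : Sₙ₊₁._*_ (Sₙ₊₁._^_ w₀ (suc i)) (constant q) (suc j) Sₙ.≈ rest j
      shifted = Sₙ.trans (Sₙ₊₁.*-assoc w₀ (Sₙ₊₁._^_ w₀ i) (constant q) (suc j))
        (Sₙ.trans (Sₙ.+-congʳ (Sₙ.zeroˡ (rest (suc j)))) (Sₙ.trans (Sₙ.+-identityˡ _) (1·q rest j)))

  module _ {b ℓb} (B : CommutativeAlgebra K b ℓb) where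
    open CommutativeAlgebra B using (ring)
    open RingLemmas ring hiding (ring)

    monomialSeries-homo : ∀ {n} (φ : RingHom (series n) ring) (α : Vec ℕ n) →
      RingHomomorphism.⟦_⟧ φ (monomialSeries α) ≈ monomialAt B (λ (i : Fin n) → RingHomomorphism.⟦_⟧ φ (var i)) α
    monomialSeries-homo {zero}  φ []      = RingHomomorphism.1#-homo φ
    monomialSeries-homo {suc n} φ (i ∷ α) = trans (*-homo _ _)
      (*-cong (^-homo (var {suc n} zero) i) (monomialSeries-homo (compose (series n) (series (suc n)) ring φ (PowerSeries.constantHom (series n))) α))
      where open HomLaws (series (suc n)) ring φ

-- Images of ideals in a quotient

module _ {a ℓ i} (A : CommutativeRing a ℓ) (I : Ideal A i) where
  open RingLemmas A
  private
    module I = Ideal I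
    module Q = CommutativeRing (A / I)

  image∈ : ∀ {p} (J : Ideal A p) {x} → x ∈ Member J → x ∈ Member (imageIdeal A I J)
  image∈ J {x} x∈ = x , Q.refl {x} , x∈

  image-mono : ∀ {p q} (J : Ideal A p) (L : Ideal A q) → Member J ⊆ Member L →
               Member (imageIdeal A I J) ⊆ Member (imageIdeal A I L)
  image-mono J L J⊆L (y , x≈y , y∈) = y , x≈y , J⊆L y∈

  image-* : ∀ {p q r} (J : Ideal A p) (L : Ideal A q) (M : Ideal A r) →
            (∀ {x y} → x ∈ Member J → y ∈ Member L → (x * y) ∈ Member M) →
            ∀ {x y} → x ∈ Member (imageIdeal A I J) → y ∈ Member (imageIdeal A I L) →
            (x * y) ∈ Member (imageIdeal A I M)
  image-* J L M JL⊆M {x} {y} (x′ , x≈x′ , x′∈) (y′ , y≈y′ , y′∈) =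
    x′ * y′ , Q.*-cong {x} {x′} {y} {y′} x≈x′ y≈y′ , JL⊆M x′∈ y′∈

  image-trivial : ∀ {p} (J : Ideal A p) → Member J ⊆ Member I →
                  ∀ {x} → x ∈ Member (imageIdeal A I J) → x Q.≈ 0#
  image-trivial J J⊆I {x} (y , x≈y , y∈) = Q.trans {x} {y} {0#} x≈y (I.∈-resp-≈ (sym (x-0≈x y)) (J⊆I y∈))

module _ {a ℓa b ℓb i j p q} {A : CommutativeRing a ℓa} {B : CommutativeRing b ℓb}
         (I : Ideal A i) (J : Ideal B j) (φ : RingHom A B)
         (φI⊆J : ∀ {x} → x ∈ Member I → RingHomomorphism.⟦_⟧ φ x ∈ Member J)
         (L : Ideal A p) (M : Ideal B q) where

  image-map : (∀ {x} → x ∈ Member L → RingHomomorphism.⟦_⟧ φ x ∈ Member M) →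
    ∀ {x} → x ∈ Member (imageIdeal A I L) → RingHomomorphism.⟦_⟧ φ x ∈ Member (imageIdeal B J M)
  image-map φL⊆M (y , x≈y , y∈) =
    RingHomomorphism.⟦_⟧ φ y , RingHomomorphism.⟦⟧-cong (quotientMap I J φ φI⊆J) x≈y , φL⊆M y∈

module _ {k ℓ a ℓa} {K : CommutativeRing k ℓ} {A : CommutativeAlgebra K a ℓa} (σ : AlgebraHom A A) where
  open CommutativeAlgebra A using (Carrier)
  private
    module σ = AlgebraHom σ

  shifts : Carrier → ℕ → Carrier
  shifts x zero    = x
  shifts x (suc i) = σ.⟦ shifts x i ⟧

-- The local ring at infinity before completion

record FilteredAlgebra {k ℓ} (K : CommutativeRing k ℓ) : Set (lsuc (k ⊔ ℓ)) where
  field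
    algebra : CommutativeAlgebra K k (k ⊔ ℓ)
    σ       : AlgebraHom algebra algebra
    w       : CommutativeAlgebra.Carrier algebra
    F       : Threshold → Ideal (CommutativeAlgebra.ring algebra) (k ⊔ ℓ)

  open CommutativeAlgebra algebra public using (ring; Carrier; _≈_; _*_; 0#)
  module σ = AlgebraHom σ

  coordinate : ℕ → Carrier
  coordinate = shifts σ w

module PathAlgebras {k ℓ} (K : CommutativeRing k ℓ) (d e : ℕ) (1≤e : 1 ℕ.≤ e) (e<d : e ℕ.< d) where
  open Weight d e 1≤e e<d
  open WeightLevels d e 1≤e e<d

  -- By ranging over all ideals J, `hom-F` says that the image of `F X` lies in the ideal generated
  -- by the monomials in y of weight > X, with no mention of infinite sums.
  record Lift (A : FilteredAlgebra K) (B : CommutativeAlgebra K k (k ⊔ ℓ)) (y : ℕ → CommutativeAlgebra.Carrier B) :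
              Set (lsuc (k ⊔ ℓ)) where
    open FilteredAlgebra A
    private
      module B = CommutativeAlgebra B
    field
      hom : AlgebraHom algebra B
    module hom = AlgebraHom hom
    field
      hom-coordinate : ∀ i → hom.⟦ coordinate i ⟧ B.≈ y i
      hom-F          : ∀ (X : Threshold) (J : Ideal B.ring (k ⊔ ℓ)) →
        (∀ {n} (α : Vec ℕ n) → ¬ (weight α ℚ.≤ proj₁ X) → monomialAt B (λ i → y (toℕ i)) α ∈ Member J) →
        ∀ {x} → x ∈ Member (F X) → hom.⟦ x ⟧ ∈ Member J

  -- An interface that keeps the comparison away from power series, quotients and colimits. `lift`
  -- and `ext` act as a universal property for sequences of nilpotent elements that satisfy the
  -- relations.
  record PathAlgebra (f g : Polynomial K) : Set (lsuc (k ⊔ ℓ)) where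
    field
      filteredAlgebra : FilteredAlgebra K
    open FilteredAlgebra filteredAlgebra public
    field
      F-antitone  : ∀ (X Y : Threshold) → proj₁ X ℚ.≤ proj₁ Y → ∀ {x} → x ∈ Member (F Y) → x ∈ Member (F X)
      F-*         : ∀ (X Y Z : Threshold) → proj₁ Z ℚ.≤ proj₁ X ℚ.+ proj₁ Y →
                    ∀ {x y} → x ∈ Member (F X) → y ∈ Member (F Y) → (x * y) ∈ Member (F Z)
      σ-F         : ∀ (X Y : Threshold) → (∀ {n} (α : Vec ℕ n) → weight (0 ∷ α) ℚ.≤ proj₁ Y → weight α ℚ.≤ proj₁ X) →
                    ∀ {x} → x ∈ Member (F X) → σ.⟦ x ⟧ ∈ Member (F Y)
      w∈F         : w ∈ Member (F (levelThreshold 0))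
      w-relation  : relation algebra f g d e w σ.⟦ w ⟧ ≈ 0#
      monomial∈F  : ∀ (X : Threshold) {n} (α : Vec ℕ n) → ¬ (weight α ℚ.≤ proj₁ X) →
                    monomialAt algebra (λ i → coordinate (toℕ i)) α ∈ Member (F X)

    field
      -- ext asks for no continuity, since modulo xᵐ a power series is a polynomial in x.
      lift : (B : CommutativeAlgebra K k (k ⊔ ℓ)) (let module B = CommutativeAlgebra B) (y : ℕ → B.Carrier) (m : ℕ) →
             (∀ i → y i B.^ m B.≈ B.0#) → (∀ i → relation B f g d e (y i) (y (suc i)) B.≈ B.0#) → Lift filteredAlgebra B y
      ext  : (B : CommutativeAlgebra K k (k ⊔ ℓ)) (let module B = CommutativeAlgebra B) (φ ψ : AlgebraHom algebra B) →
             (∀ i → AlgebraHom.⟦_⟧ φ (coordinate i) B.≈ AlgebraHom.⟦_⟧ ψ (coordinate i)) →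
             (∀ i → ∃[ m ] AlgebraHom.⟦_⟧ φ (coordinate i) B.^ m B.≈ B.0#) →
             ∀ x → AlgebraHom.⟦_⟧ φ x B.≈ AlgebraHom.⟦_⟧ ψ x

    Truncated : Threshold → CommutativeAlgebra K k (k ⊔ ℓ)
    Truncated X = quotientAlgebra algebra (F X)

    σ-F-self : ∀ X {x} → x ∈ Member (F X) → σ.⟦ x ⟧ ∈ Member (F X)
    σ-F-self X = σ-F X X (λ α → ℚₚ.≤-trans (weight-0∷ α))

    truncatedShift : ∀ X → AlgebraHom (Truncated X) (Truncated X)
    truncatedShift X = record
      { ringHomomorphism = quotientMap (F X) (F X) σ.ringHomomorphism (σ-F-self X)
      ; scalar-homo      = λ c → RingHomomorphism.⟦⟧-cong (quotientHom ring (F X)) (σ.scalar-homo c) }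

    truncatedF : ∀ X → Threshold → Ideal (CommutativeAlgebra.ring (Truncated X)) (k ⊔ ℓ)
    truncatedF X Y = imageIdeal ring (F X) (F Y)

    truncation : Threshold → ContractingAlgebra K k (k ⊔ ℓ) (k ⊔ ℓ)
    truncation X = record
      { algebra    = Truncated X
      ; σ          = truncatedShift X
      ; I          = λ n → truncatedF X (levelThreshold n)
      ; I-descends = λ n → image-mono ring (F X) (F (levelThreshold (suc n))) (F (levelThreshold n))
          (F-antitone (levelThreshold n) (levelThreshold (suc n)) (level-suc n))
      ; I₀*I       = λ n → image-* ring (F X) (F (levelThreshold 0)) (F (levelThreshold n)) (F (levelThreshold (suc n)))
          (F-* (levelThreshold 0) (levelThreshold n) (levelThreshold (suc n)) (level-+ n))
      ; σ-I        = λ n → image-map (F X) (F X) σ.ringHomomorphism (σ-F-self X)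
          (F (levelThreshold n)) (F (levelThreshold (suc n)))
          (σ-F (levelThreshold n) (levelThreshold (suc n)) (weight-0∷-≤ n))
      ; depth      = proj₁ deep
      ; I-depth≈0  = image-trivial ring (F X) (F (levelThreshold (proj₁ deep)))
          (F-antitone X (levelThreshold (proj₁ deep)) (proj₂ deep))
      ; w          = w
      ; w∈I₀       = image∈ ring (F X) (F (levelThreshold 0)) w∈F
      }
      where
      -- From this level on the filtration is contained in `F X`, hence zero in the truncation.
      deep : ∃[ n ] proj₁ X ℚ.≤ level n
      deep = level-unbounded (proj₁ X) (proj₂ X)

-- Comparison of two path spaces modulo a fixed weight

module Comparison {k ℓ} (K : CommutativeRing k ℓ) (d e : ℕ) (1≤e : 1 ℕ.≤ e) (e<d : e ℕ.< d)
                  (c : CommutativeRing.Carrier K)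
                  (cd≈1 : CommutativeRing._≈_ K (CommutativeRing._*_ K c (natural K d)) (CommutativeRing.1# K)) where
  open Weight d e 1≤e e<d
  open WeightLevels d e 1≤e e<d
  open PathAlgebras K d e 1≤e e<d

  module _ (A : CommutativeAlgebra K k (k ⊔ ℓ)) where
    open CommutativeAlgebra A
    open HomLaws K ring structureMap

    scalar-inverse : scalar c * natural ring d ≈ 1#
    scalar-inverse = trans (*-congˡ (sym (natural-homo K ring structureMap d)))
      (trans (sym (*-homo c (natural K d))) (trans (⟦⟧-cong cd≈1) 1#-homo))

  module _ {f g : Polynomial K} (P : PathAlgebra f g) where
    open PathAlgebra P

    truncated-ext : ∀ X (B : CommutativeAlgebra K k (k ⊔ ℓ)) (let module B = CommutativeAlgebra B)
      (φ ψ : AlgebraHom (Truncated X) B) →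
      (∀ i → AlgebraHom.⟦_⟧ φ (coordinate i) B.≈ AlgebraHom.⟦_⟧ ψ (coordinate i)) →
      (∀ i → ∃[ m ] AlgebraHom.⟦_⟧ φ (coordinate i) B.^ m B.≈ B.0#) →
      ∀ x → AlgebraHom.⟦_⟧ φ x B.≈ AlgebraHom.⟦_⟧ ψ x
    truncated-ext X B φ ψ = ext B (φ ∘ᴬ quotientAlgebraHom algebra (F X)) (ψ ∘ᴬ quotientAlgebraHom algebra (F X))

    truncated-relation : ∀ X → CommutativeAlgebra._≈_ (Truncated X)
      (relation (Truncated X) f g d e w σ.⟦ w ⟧) (CommutativeAlgebra.0# (Truncated X))
    truncated-relation X = TX.trans {relation (Truncated X) f g d e w σ.⟦ w ⟧} {relation algebra f g d e w σ.⟦ w ⟧} {0#}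
      (TX.sym {relation algebra f g d e w σ.⟦ w ⟧} {relation (Truncated X) f g d e w σ.⟦ w ⟧}
        (relation-homo algebra (Truncated X) (quotientAlgebraHom algebra (F X)) f g d e {w} {σ.⟦ w ⟧} {w} {σ.⟦ w ⟧} (TX.refl {w}) (TX.refl {σ.⟦ w ⟧})))
      (≈⇒≈ᴵ ring (F X) w-relation)
      where module TX = CommutativeAlgebra (Truncated X)

  module _ {f₁ g₁ f₂ g₂ : Polynomial K} (P : PathAlgebra f₁ g₁) (Q : PathAlgebra f₂ g₂)
           (f₁-monic : IsMonicOfDegree f₁ d) (g₁-monic : IsMonicOfDegree g₁ e)
           (f₂-monic : IsMonicOfDegree f₂ d) (g₂-monic : IsMonicOfDegree g₂ e)
           (X : Threshold) where
    private
      module P = PathAlgebra P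
      module Q = PathAlgebra Q
    open ContractingAlgebra (P.truncation X)
    open Conjugacy d e f₁ g₁ f₂ g₂

    conjugator : ∃ IsConjugacy
    conjugator = conjugacy f₁-monic g₁-monic f₂-monic g₂-monic
      (CommutativeAlgebra.scalar algebra c) (scalar-inverse algebra)

    conjugator-unique : ∀ {T} → IsConjugacy T → proj₁ conjugator ≈ T
    conjugator-unique {T} = conjugacy-unique f₁-monic g₁-monic f₂-monic g₂-monic
      (CommutativeAlgebra.scalar algebra c) (scalar-inverse algebra) {proj₁ conjugator} {T} (proj₂ conjugator)

    T : Carrier
    T = proj₁ conjugator

    y : ℕ → Carrier
    y = shifts σ (w * T)

    private
      u : ℕ → Carrier
      u = shifts σ T

      y∈I₀ : ∀ i → y i ∈ Member (I 0)
      y∈I₀ zero    = w*∈ T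
      y∈I₀ (suc i) = I⊆I₀ 1 (σ-I 0 (y∈I₀ i))

      -- The equation for T settles the relation between the first two coordinates; the others are
      -- its images under σ.
      y-relation : ∀ i → relation algebra f₂ g₂ d e (y i) (y (suc i)) ≈ 0#
      y-relation zero    = trans
        (relation-homo algebra algebra (idᴬ algebra) f₂ g₂ d e {w * T} {σ.⟦ w * T ⟧} {w * T} {w₁ * σ.⟦ T ⟧} refl (σ.*-homo w T))
        (relation-conjugate d e (P.truncation X) f₁ g₁ f₂ g₂ f₁-monic (truncated-relation P X) {T} (proj₂ conjugator))
      y-relation (suc i) = trans
        (sym (relation-homo algebra algebra σ f₂ g₂ d e {y i} {y (suc i)} refl refl))
        (trans (σ.⟦⟧-cong (y-relation i)) σ.0#-homo)

      y≈ : ∀ i → y i ≈ P.coordinate i * u i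
      y≈ zero    = refl
      y≈ (suc i) = trans (σ.⟦⟧-cong (y≈ i)) (σ.*-homo (P.coordinate i) (u i))

      y-lift : Lift Q.filteredAlgebra algebra y
      y-lift = Q.lift algebra y (suc depth) (λ i → nilpotent (y∈I₀ i)) y-relation

      module y-lift = Lift y-lift

      -- Each `y i` is a multiple of the i-th coordinate, so a monomial in the `y i` is a multiple
      -- of the same monomial in the coordinates. The substitution therefore never lowers weights.
      y-monomial∈ : ∀ (Y : Threshold) {n} (α : Vec ℕ n) → ¬ (weight α ℚ.≤ proj₁ Y) →
        monomialAt algebra (λ i → y (toℕ i)) α ∈ Member (P.truncatedF X Y)
      y-monomial∈ Y {n} α α≰Y = F.∈-resp-≈
        (sym (trans (monomialAt-cong algebra (λ i → y≈ (toℕ i)) α)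
               (trans (monomialAt-* algebra (λ i → P.coordinate (toℕ i)) (λ i → u (toℕ i)) α)
                 (*-comm (monomialAt algebra (λ i → P.coordinate (toℕ i)) α) (monomialAt algebra (λ i → u (toℕ i)) α)))))
        (F.*-closed (monomialAt algebra (λ i → u (toℕ i)) α)
          (F.∈-resp-≈ (monomialAt-homo P.algebra algebra (quotientAlgebraHom P.algebra (P.F X)) (λ (i : Fin n) → P.coordinate (toℕ i)) α)
            (image∈ P.ring (P.F X) (P.F Y) (P.monomial∈F Y α α≰Y))))
        where module F = Ideal (P.truncatedF X Y)

      y-lift-F : ∀ Y {x} → x ∈ Member (Q.F Y) → y-lift.hom.⟦ x ⟧ ∈ Member (P.truncatedF X Y)
      y-lift-F Y = y-lift.hom-F Y (P.truncatedF X Y) (λ {n} α → y-monomial∈ Y {n} α)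

    -- Functions pull back, so the homomorphism starts at Q. Weights are not lowered, hence `F X` of
    -- Q goes to zero and the same threshold serves on both sides.
    compare : AlgebraHom (Q.Truncated X) (P.Truncated X)
    compare = record
      { ringHomomorphism = quotientLift Q.ring ring (Q.F X) y-lift.hom.ringHomomorphism
          (λ x∈ → image-trivial P.ring (P.F X) (P.F X) (λ z∈ → z∈) (y-lift-F X x∈))
      ; scalar-homo      = y-lift.hom.scalar-homo }

    private
      module compare = AlgebraHom compare

    compare-coordinate : ∀ i → compare.⟦ Q.coordinate i ⟧ ≈ y i
    compare-coordinate = y-lift.hom-coordinate

    compare-F : ∀ Y {x} → x ∈ Member (Q.truncatedF X Y) → compare.⟦ x ⟧ ∈ Member (P.truncatedF X Y)
    compare-F Y {x} (z , x≈z , z∈) = Ideal.∈-resp-≈ (P.truncatedF X Y)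
      (sym (compare.⟦⟧-cong {x} {z} x≈z)) (y-lift-F Y z∈)

    compare-nilpotent : ∀ i → compare.⟦ Q.coordinate i ⟧ ^ suc depth ≈ 0#
    compare-nilpotent i = trans (^-congˡ (suc depth) (compare-coordinate i)) (nilpotent (y∈I₀ i))

    -- Both composites send the i-th coordinate to `y (suc i)`, which is nilpotent, so
    -- `truncated-ext` applies.
    compare-σ : ∀ x → compare.⟦ Q.σ.⟦ x ⟧ ⟧ ≈ σ.⟦ compare.⟦ x ⟧ ⟧
    compare-σ = truncated-ext Q X algebra (compare ∘ᴬ Q.truncatedShift X) (σ ∘ᴬ compare)
      (λ i → trans (compare-coordinate (suc i)) (σ.⟦⟧-cong (sym (compare-coordinate i))))
      (λ i → suc depth , compare-nilpotent (suc i))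

  module _ {f₁ g₁ f₂ g₂ : Polynomial K} (P : PathAlgebra f₁ g₁) (Q : PathAlgebra f₂ g₂)
           (f₁-monic : IsMonicOfDegree f₁ d) (g₁-monic : IsMonicOfDegree g₁ e)
           (f₂-monic : IsMonicOfDegree f₂ d) (g₂-monic : IsMonicOfDegree g₂ e) where
    private
      module P = PathAlgebra P
      module Q = PathAlgebra Q

    module _ (X : Threshold) where
      open ContractingAlgebra (P.truncation X)
      private
        φ : AlgebraHom (Q.Truncated X) (P.Truncated X)
        φ = compare P Q f₁-monic g₁-monic f₂-monic g₂-monic X
        ψ : AlgebraHom (P.Truncated X) (Q.Truncated X)
        ψ = compare Q P f₂-monic g₂-monic f₁-monic g₁-monic X
        module Qₓ = CommutativeAlgebra (Q.Truncated X)
        module φ = AlgebraHom φ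
        module ψ = AlgebraHom ψ
        S V : Carrier
        S = proj₁ (conjugator P Q f₁-monic g₁-monic f₂-monic g₂-monic X)
        V = φ.⟦ proj₁ (conjugator Q P f₂-monic g₂-monic f₁-monic g₁-monic X) ⟧
        φσ : ∀ x → φ.⟦ Q.σ.⟦ x ⟧ ⟧ ≈ σ.⟦ φ.⟦ x ⟧ ⟧
        φσ = compare-σ P Q f₁-monic g₁-monic f₂-monic g₂-monic X
        φw : φ.⟦ Q.w ⟧ ≈ w * S
        φw = compare-coordinate P Q f₁-monic g₁-monic f₂-monic g₂-monic X 0

        SV≈1 : S * V ≈ 1#
        SV≈1 = trans
          (sym (conjugator-unique P P f₁-monic g₁-monic f₁-monic g₁-monic X {S * V}
            (conjugacy-∘ d e (P.truncation X) (Q.truncation X) φ φσ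
              (λ {x} → compare-F P Q f₁-monic g₁-monic f₂-monic g₂-monic X (levelThreshold 0) {x})
              f₁ g₁ f₂ g₂ f₁ g₁ f₂-monic g₂-monic φw
              (proj₂ (conjugator P Q f₁-monic g₁-monic f₂-monic g₂-monic X))
              (proj₂ (conjugator Q P f₂-monic g₂-monic f₁-monic g₁-monic X)))))
          (conjugator-unique P P f₁-monic g₁-monic f₁-monic g₁-monic X {1#} (conjugacy-1 d e (P.truncation X) f₁ g₁))

        -- For w the composite multiplies by S V = 1; commutation with the shifts carries this to
        -- the later coordinates.
        φψ-coordinate : ∀ i → φ.⟦ ψ.⟦ P.coordinate i ⟧ ⟧ ≈ P.coordinate i
        φψ-coordinate zero    = begin
          φ.⟦ ψ.⟦ w ⟧ ⟧          ≈⟨ φ.⟦⟧-cong (compare-coordinate Q P f₂-monic g₂-monic f₁-monic g₁-monic X 0) ⟩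
          φ.⟦ Q.w Qₓ.* _ ⟧       ≈⟨ φ.*-homo Q.w _ ⟩
          φ.⟦ Q.w ⟧ * V          ≈⟨ *-congʳ φw ⟩
          (w * S) * V            ≈⟨ *-assoc w S V ⟩
          w * (S * V)            ≈⟨ *-congˡ SV≈1 ⟩
          w * 1#                 ≈⟨ *-identityʳ w ⟩
          w                      ∎
          where open ≈-Reasoning
        φψ-coordinate (suc i) = trans
          (φ.⟦⟧-cong (compare-σ Q P f₂-monic g₂-monic f₁-monic g₁-monic X (P.coordinate i)))
          (trans (φσ ψ.⟦ P.coordinate i ⟧) (σ.⟦⟧-cong (φψ-coordinate i)))

        coordinate∈I₀ : ∀ i → P.coordinate i ∈ Member (I 0)
        coordinate∈I₀ zero    = w∈I₀
        coordinate∈I₀ (suc i) = I⊆I₀ 1 (σ-I 0 (coordinate∈I₀ i))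

      compare-inverse : ∀ x → φ.⟦ ψ.⟦ x ⟧ ⟧ ≈ x
      compare-inverse = truncated-ext P X algebra (φ ∘ᴬ ψ) (idᴬ algebra) φψ-coordinate
        (λ i → suc depth , trans (^-congˡ (suc depth) (φψ-coordinate i)) (nilpotent (coordinate∈I₀ i)))

    module _ (X Y : Threshold) (X≤Y : proj₁ X ℚ.≤ proj₁ Y) where
      open ContractingAlgebra (P.truncation X)
      private
        φX = compare P Q f₁-monic g₁-monic f₂-monic g₂-monic X
        φY = compare P Q f₁-monic g₁-monic f₂-monic g₂-monic Y
        module φX = AlgebraHom φX
        module φY = AlgebraHom φY

        FY⊆FX : ∀ {x} → x ∈ Member (P.F Y) → x ∈ Member (P.F X)
        FY⊆FX = P.F-antitone X Y X≤Y

        π : AlgebraHom (P.Truncated Y) (P.Truncated X)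
        π = record
          { ringHomomorphism = quotientMap (P.F Y) (P.F X) (idHom P.ring) FY⊆FX
          ; scalar-homo      = λ c → refl }

        yX yY : ℕ → Carrier
        yX = y P Q f₁-monic g₁-monic f₂-monic g₂-monic X
        yY = y P Q f₁-monic g₁-monic f₂-monic g₂-monic Y

        T-descends : proj₁ (conjugator P Q f₁-monic g₁-monic f₂-monic g₂-monic X) ≈
                     proj₁ (conjugator P Q f₁-monic g₁-monic f₂-monic g₂-monic Y)
        T-descends = trans
          (conjugator-unique P Q f₁-monic g₁-monic f₂-monic g₂-monic X
            -- The projection is read as a substitution with T = 1 from P to itself, so the
            -- composition rule shows that the solution modulo Y also solves the equation modulo X.
            (conjugacy-∘ d e (P.truncation X) (P.truncation Y) π (λ x → refl)
              (λ {x} → image-map (P.F Y) (P.F X) (idHom P.ring) FY⊆FX (P.F (levelThreshold 0)) (P.F (levelThreshold 0)) (λ z∈ → z∈) {x})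
              f₁ g₁ f₁ g₁ f₂ g₂ f₁-monic g₁-monic (sym (*-identityʳ w))
              (conjugacy-1 d e (P.truncation X) f₁ g₁)
              (proj₂ (conjugator P Q f₁-monic g₁-monic f₂-monic g₂-monic Y))))
          (*-identityˡ _)

        y-descends : ∀ i → yX i ≈ yY i
        y-descends zero    = *-congˡ T-descends
        y-descends (suc i) = σ.⟦⟧-cong (y-descends i)

      compare-descends : ∀ x → φX.⟦ x ⟧ ≈ φY.⟦ x ⟧
      compare-descends = Q.ext algebra (φX ∘ᴬ quotientAlgebraHom Q.algebra (Q.F X)) (π ∘ᴬ φY ∘ᴬ quotientAlgebraHom Q.algebra (Q.F Y))
        (λ i → trans (compare-coordinate P Q f₁-monic g₁-monic f₂-monic g₂-monic X i)
          (trans (y-descends i) (sym (AlgebraHom.⟦⟧-cong π (compare-coordinate P Q f₁-monic g₁-monic f₂-monic g₂-monic Y i)))))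
        (λ i → suc depth , compare-nilpotent P Q f₁-monic g₁-monic f₂-monic g₂-monic X i)

-- Completion

module _ {k ℓ} {K : CommutativeRing k ℓ} {A B : CommutativeAlgebra K (k ⊔ ℓ) (k ⊔ ℓ)} where
  open FunctorOfPoints K (k ⊔ ℓ)

  Spec-≅ : (φ : AlgebraHom B A) (ψ : AlgebraHom A B) →
    (∀ x → CommutativeAlgebra._≈_ A (AlgebraHom.⟦_⟧ φ (AlgebraHom.⟦_⟧ ψ x)) x) →
    (∀ x → CommutativeAlgebra._≈_ B (AlgebraHom.⟦_⟧ ψ (AlgebraHom.⟦_⟧ φ x)) x) →
    Spec A ≅ Spec B
  Spec-≅ φ ψ φψ ψφ = record
    { to      = Spec₁ φ
    ; from    = Spec₁ ψ
    ; from∘to = λ T x s → AlgebraHom.⟦⟧-cong x (φψ s)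
    ; to∘from = λ T x s → AlgebraHom.⟦⟧-cong x (ψφ s) }

  Spec₁-commutes : (φ : AlgebraHom B A) (α : AlgebraHom A A) (β : AlgebraHom B B) →
    (∀ x → CommutativeAlgebra._≈_ A (AlgebraHom.⟦_⟧ α (AlgebraHom.⟦_⟧ φ x)) (AlgebraHom.⟦_⟧ φ (AlgebraHom.⟦_⟧ β x))) →
    (Spec₁ φ ∘⇒ Spec₁ α) ≈⇒ (Spec₁ β ∘⇒ Spec₁ φ)
  Spec₁-commutes φ α β αφ T x s = AlgebraHom.⟦⟧-cong x (αφ s)

module Completions {k ℓ} (K : CommutativeRing k ℓ) (d e : ℕ) (1≤e : 1 ℕ.≤ e) (e<d : e ℕ.< d) where
  open PathAlgebras K d e 1≤e e<d

  -- An axiomatic inverse limit: elements are known only through their components, so the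
  -- isomorphism is assembled one threshold at a time.
  record IsCompletion {f g : Polynomial K} (P : PathAlgebra f g)
                      (O : CommutativeAlgebra K (k ⊔ ℓ) (k ⊔ ℓ)) (τ : AlgebraHom O O) : Set (k ⊔ ℓ) where
    private
      module P = PathAlgebra P
      module PA = CommutativeAlgebra P.algebra
      module O = CommutativeAlgebra O
      module τ = AlgebraHom τ

    infix 4 _≈[_]_
    _≈[_]_ : P.Carrier → Threshold → P.Carrier → Set (k ⊔ ℓ)
    x ≈[ X ] y = (x PA.- y) ∈ Member (P.F X)

    Compatible : (Threshold → P.Carrier) → Set (k ⊔ ℓ)
    Compatible z = ∀ (X Y : Threshold) → proj₁ X ℚ.≤ proj₁ Y → z X ≈[ X ] z Y

    field
      component            : O.Carrier → Threshold → P.Carrier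
      component-compatible : ∀ x → Compatible (component x)
      component-cong       : ∀ {x y} → x O.≈ y → ∀ X → component x X ≈[ X ] component y X
      component-injective  : ∀ {x y} → (∀ X → component x X ≈[ X ] component y X) → x O.≈ y
      component-+          : ∀ x y X → component (x O.+ y) X ≈[ X ] (component x X PA.+ component y X)
      component-*          : ∀ x y X → component (x O.* y) X ≈[ X ] (component x X PA.* component y X)
      component-1          : ∀ X → component O.1# X ≈[ X ] PA.1#
      component-scalar     : ∀ c X → component (O.scalar c) X ≈[ X ] PA.scalar c
      component-shift      : ∀ x X → component τ.⟦ x ⟧ X ≈[ X ] P.σ.⟦ component x X ⟧
      glue                 : (z : Threshold → P.Carrier) → Compatible z → O.Carrier
      component-glue       : ∀ z (z-compatible : Compatible z) X → component (glue z z-compatible) X ≈[ X ] z X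

  record TruncatedHoms {f₁ g₁ f₂ g₂ : Polynomial K} (P : PathAlgebra f₁ g₁) (Q : PathAlgebra f₂ g₂) : Set (k ⊔ ℓ) where
    private
      module P = PathAlgebra P
      module Q = PathAlgebra Q
    field
      hom : ∀ X → AlgebraHom (Q.Truncated X) (P.Truncated X)
    module hom X = AlgebraHom (hom X)
    field
      descends : ∀ (X Y : Threshold) → proj₁ X ℚ.≤ proj₁ Y → ∀ x →
                 CommutativeAlgebra._≈_ (P.Truncated X) (hom.⟦_⟧ X x) (hom.⟦_⟧ Y x)
      commutes : ∀ X x → CommutativeAlgebra._≈_ (P.Truncated X) (hom.⟦_⟧ X Q.σ.⟦ x ⟧) P.σ.⟦ hom.⟦_⟧ X x ⟧

  module _ {f₁ g₁ f₂ g₂ : Polynomial K} (P : PathAlgebra f₁ g₁) (Q : PathAlgebra f₂ g₂)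
           {OP OQ : CommutativeAlgebra K (k ⊔ ℓ) (k ⊔ ℓ)} {σ : AlgebraHom OP OP} {τ : AlgebraHom OQ OQ}
           (CP : IsCompletion P OP σ) (CQ : IsCompletion Q OQ τ) (Φ : TruncatedHoms P Q) where
    private
      module P = PathAlgebra P
      module Q = PathAlgebra Q
      module OP = CommutativeAlgebra OP
      module OQ = CommutativeAlgebra OQ
      module CP = IsCompletion CP
      module CQ = IsCompletion CQ
      module σ = AlgebraHom σ
      module τ = AlgebraHom τ
      module PX X = CommutativeAlgebra (P.Truncated X)
      module Φ = TruncatedHoms Φ
      module φ X = AlgebraHom (Φ.hom X)

      images : OQ.Carrier → Threshold → P.Carrier
      images x X = φ.⟦_⟧ X (CQ.component x X)

      -- The thresholds differ in two places, in the component and in the homomorphism, and they are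
      -- exchanged one after the other.
      images-compatible : ∀ x → CP.Compatible (images x)
      images-compatible x X Y X≤Y = PX.trans X (φ.⟦⟧-cong X (CQ.component-compatible x X Y X≤Y))
        (Φ.descends X Y X≤Y (CQ.component x Y))

      completed : OQ.Carrier → OP.Carrier
      completed x = CP.glue (images x) (images-compatible x)

    completed-component : ∀ x X → PX._≈_ X (CP.component (completed x) X) (φ.⟦_⟧ X (CQ.component x X))
    completed-component x = CP.component-glue (images x) (images-compatible x)

    private
      injective : ∀ {x y} (z : Threshold → P.Carrier) → (∀ X → PX._≈_ X (CP.component x X) (z X)) →
                  (∀ X → PX._≈_ X (CP.component y X) (z X)) → x OP.≈ y
      injective z x≈z y≈z = CP.component-injective (λ X → PX.trans X (x≈z X) (PX.sym X (y≈z X)))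

    completedHom : AlgebraHom OQ OP
    completedHom = record
      { ringHomomorphism = ringHom OQ.ring OP.ring completed
          (λ {x} {y} x≈y → injective (λ X → φ.⟦_⟧ X (CQ.component y X))
            (λ X → PX.trans X (completed-component x X) (φ.⟦⟧-cong X (CQ.component-cong x≈y X)))
            (completed-component y))
          (λ x y → injective (λ X → PX._+_ X (φ.⟦_⟧ X (CQ.component x X)) (φ.⟦_⟧ X (CQ.component y X)))
            (λ X → PX.trans X (completed-component (x OQ.+ y) X) (PX.trans X (φ.⟦⟧-cong X (CQ.component-+ x y X)) (φ.+-homo X _ _)))
            (λ X → PX.trans X (CP.component-+ (completed x) (completed y) X)
                     (PX.+-cong X (completed-component x X) (completed-component y X))))
          (λ x y → injective (λ X → PX._*_ X (φ.⟦_⟧ X (CQ.component x X)) (φ.⟦_⟧ X (CQ.component y X)))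
            (λ X → PX.trans X (completed-component (x OQ.* y) X) (PX.trans X (φ.⟦⟧-cong X (CQ.component-* x y X)) (φ.*-homo X _ _)))
            (λ X → PX.trans X (CP.component-* (completed x) (completed y) X)
                     (PX.*-cong X (completed-component x X) (completed-component y X))))
          (injective PX.1#
            (λ X → PX.trans X (completed-component OQ.1# X) (PX.trans X (φ.⟦⟧-cong X (CQ.component-1 X)) (φ.1#-homo X)))
            CP.component-1)
      ; scalar-homo = λ c → injective (λ X → PX.scalar X c)
          (λ X → PX.trans X (completed-component (OQ.scalar c) X)
            (PX.trans X (φ.⟦⟧-cong X (CQ.component-scalar c X)) (φ.scalar-homo X c)))
          (CP.component-scalar c) }

    completedHom-shift : ∀ x → σ.⟦ completed x ⟧ OP.≈ completed τ.⟦ x ⟧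
    completedHom-shift x = injective (λ X → AlgebraHom.⟦_⟧ (P.truncatedShift X) (φ.⟦_⟧ X (CQ.component x X)))
      (λ X → PX.trans X (CP.component-shift (completed x) X) (AlgebraHom.⟦⟧-cong (P.truncatedShift X) (completed-component x X)))
      (λ X → PX.trans X (completed-component τ.⟦ x ⟧ X) (PX.trans X (φ.⟦⟧-cong X (CQ.component-shift x X))
        (Φ.commutes X (CQ.component x X))))

  module _ {f₁ g₁ f₂ g₂ : Polynomial K} {P : PathAlgebra f₁ g₁} {Q : PathAlgebra f₂ g₂}
           {OP OQ : CommutativeAlgebra K (k ⊔ ℓ) (k ⊔ ℓ)} {σ : AlgebraHom OP OP} {τ : AlgebraHom OQ OQ}
           (CP : IsCompletion P OP σ) (CQ : IsCompletion Q OQ τ) (Φ : TruncatedHoms P Q) (Ψ : TruncatedHoms Q P)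
           (ΦΨ : ∀ X x → CommutativeAlgebra._≈_ (PathAlgebra.Truncated P X) (TruncatedHoms.hom.⟦_⟧ Φ X (TruncatedHoms.hom.⟦_⟧ Ψ X x)) x) where
    private
      module P = PathAlgebra P
      module PX X = CommutativeAlgebra (P.Truncated X)
      module CP = IsCompletion CP
      module φ X = AlgebraHom (TruncatedHoms.hom Φ X)
      φ̂ = completedHom P Q CP CQ Φ
      ψ̂ = completedHom Q P CQ CP Ψ

    completedHom-inverse : ∀ x → CommutativeAlgebra._≈_ OP (AlgebraHom.⟦_⟧ φ̂ (AlgebraHom.⟦_⟧ ψ̂ x)) x
    completedHom-inverse x = CP.component-injective λ X →
      PX.trans X (completed-component P Q CP CQ Φ (AlgebraHom.⟦_⟧ ψ̂ x) X)
        (PX.trans X (φ.⟦⟧-cong X (completed-component Q P CQ CP Ψ x X)) (ΦΨ X (CP.component x X)))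

  module _ {f₁ g₁ f₂ g₂ : Polynomial K} {P : PathAlgebra f₁ g₁} {Q : PathAlgebra f₂ g₂}
           {OP OQ : CommutativeAlgebra K (k ⊔ ℓ) (k ⊔ ℓ)} {σ : AlgebraHom OP OP} {τ : AlgebraHom OQ OQ}
           (CP : IsCompletion P OP σ) (CQ : IsCompletion Q OQ τ) (Φ : TruncatedHoms P Q) (Ψ : TruncatedHoms Q P)
           (ΦΨ : ∀ X x → CommutativeAlgebra._≈_ (PathAlgebra.Truncated P X) (TruncatedHoms.hom.⟦_⟧ Φ X (TruncatedHoms.hom.⟦_⟧ Ψ X x)) x)
           (ΨΦ : ∀ X x → CommutativeAlgebra._≈_ (PathAlgebra.Truncated Q X) (TruncatedHoms.hom.⟦_⟧ Ψ X (TruncatedHoms.hom.⟦_⟧ Φ X x)) x) where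
    open FunctorOfPoints K (k ⊔ ℓ)

    Spec-completion-≅ : Σ (Spec OP ≅ Spec OQ) λ Ξ → (_≅_.to Ξ ∘⇒ Spec₁ σ) ≈⇒ (Spec₁ τ ∘⇒ _≅_.to Ξ)
    Spec-completion-≅ =
      Spec-≅ φ̂ (completedHom Q P CQ CP Ψ) (completedHom-inverse CP CQ Φ Ψ ΦΨ) (completedHom-inverse CQ CP Ψ Φ ΨΦ) ,
      Spec₁-commutes φ̂ σ τ (completedHom-shift P Q CP CQ Φ)
      where
      φ̂ : AlgebraHom OQ OP
      φ̂ = completedHom P Q CP CQ Φ

-- The colimit of the rings S n as a path algebra

module FormalNeighbourhood {k ℓ} (K : CommutativeRing k ℓ) (d e : ℕ) (1≤e : 1 ℕ.≤ e) (e<d : e ℕ.< d)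
                           (f g : Polynomial K) where
  open Series K
  open Weight d e 1≤e e<d
  open WeightLevels d e 1≤e e<d
  open PathSpace K d e 1≤e e<d f g
  open Colimit S includeS using (colimit; injectionHom; unionIdeal; at-level)
  open ColimitLemmas S includeS
  open VanishingLemmas K
  private
    module series n = CommutativeRing (series n)
    module C = CommutativeRing colimit
    module colimitShift = RingHomomorphism colimitShift

  heavy-antitone : ∀ n {X Y} → X ℚ.≤ Y → Member (heavy n Y) ⊆ Member (heavy n X)
  heavy-antitone n X≤Y p∈ α α≤X = p∈ α (ℚₚ.≤-trans α≤X X≤Y)

  𝔪-antitone : ∀ {X Y} → X ℚ.≤ Y → ∀ n {x} → x ∈ Member (𝔪 n Y) → x ∈ Member (𝔪 n X)
  𝔪-antitone {X} {Y} X≤Y n {x} = image-mono (series (suc n)) (relations n) (heavy n Y) (heavy n X)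
    (λ {p} → heavy-antitone n X≤Y {p}) {x}

  filtration-antitone : ∀ (X Y : Threshold) → proj₁ X ℚ.≤ proj₁ Y →
    ∀ {x} → x ∈ Member (filtration Y) → x ∈ Member (filtration X)
  filtration-antitone (X , _) (Y , _) X≤Y {x} = unionIdeal-mono (λ n → 𝔪 n Y) (include-𝔪 Y) (λ n → 𝔪 n X) (include-𝔪 X)
    (λ n {y} → 𝔪-antitone X≤Y n {y}) {x}

  𝔪-* : ∀ {X Y Z} → Z ℚ.≤ X ℚ.+ Y → ∀ n {x y} → x ∈ Member (𝔪 n X) → y ∈ Member (𝔪 n Y) →
    CommutativeRing._*_ (S n) x y ∈ Member (𝔪 n Z)
  𝔪-* {X} {Y} {Z} Z≤X+Y n {x} {y} =
    image-* (series (suc n)) (relations n) (heavy n X) (heavy n Y) (heavy n Z)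
      (λ {p} {q} → vanishing-product {suc n} {λ α → weight α ℚ.≤ X} {λ α → weight α ℚ.≤ Y} {λ α → weight α ℚ.≤ Z}
        (weight-+-≤ X Y Z≤X+Y) {p} {q}) {x} {y}

  filtration-* : ∀ (X Y Z : Threshold) → proj₁ Z ℚ.≤ proj₁ X ℚ.+ proj₁ Y →
    ∀ {x y} → x ∈ Member (filtration X) → y ∈ Member (filtration Y) → (x C.* y) ∈ Member (filtration Z)
  filtration-* (X , _) (Y , _) (Z , _) Z≤X+Y {x} {y} =
    unionIdeal-* (λ n → 𝔪 n X) (include-𝔪 X) (λ n → 𝔪 n Y) (include-𝔪 Y) (λ n → 𝔪 n Z) (include-𝔪 Z)
      (λ n {u} {v} → 𝔪-* Z≤X+Y n {u} {v}) {x} {y}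

  raise-𝔪-⊆ : ∀ {X Y} → (∀ {n} (α : Vec ℕ n) → weight (0 ∷ α) ℚ.≤ Y → weight α ℚ.≤ X) →
    ∀ n {x} → x ∈ Member (𝔪 n X) → RingHomomorphism.⟦_⟧ (raiseS n) x ∈ Member (𝔪 (suc n) Y)
  raise-𝔪-⊆ {X} {Y} 0α≤Y⇒α≤X n {x} =
    image-map (relations n) (relations (suc n)) (AlgebraHom.ringHomomorphism (raise (suc n))) (λ {z} → raise-relations n {z})
      (heavy n X) (heavy (suc n) Y)
      (λ {p} → raise-vanishing {suc n} (λ α → weight α ℚ.≤ X) (λ α → weight α ℚ.≤ Y) 0α≤Y⇒α≤X p) {x}

  shift-filtration : ∀ (X Y : Threshold) → (∀ {n} (α : Vec ℕ n) → weight (0 ∷ α) ℚ.≤ proj₁ Y → weight α ℚ.≤ proj₁ X) →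
    ∀ {x} → x ∈ Member (filtration X) → colimitShift.⟦ x ⟧ ∈ Member (filtration Y)
  shift-filtration (X , _) (Y , _) 0α≤Y⇒α≤X {x} =
    colimitMap-⊆ (λ n → 𝔪 n X) (include-𝔪 X) (λ n → 𝔪 n Y) (include-𝔪 Y) raiseS raise-natural
      (λ n {u} → raise-𝔪-⊆ 0α≤Y⇒α≤X n {u}) {x}

  heavy⇒filtration : ∀ (X : Threshold) n {p} → p ∈ Member (heavy n (proj₁ X)) → (n , p) ∈ Member (filtration X)
  heavy⇒filtration (X , _) n {p} p∈ = n , ≤′-reflexive ≡.refl , image∈ (series (suc n)) (relations n) (heavy n X) {p} p∈

  colimitAlgebra : CommutativeAlgebra K k (k ⊔ ℓ)
  colimitAlgebra = record { ring = colimit ; structureMap = colimitScalar }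

  wᶜ : ℕ → C.Carrier
  wᶜ i = i , var (fromℕ i)

  w₀∈ : wᶜ 0 ∈ Member (filtration (levelThreshold 0))
  w₀∈ = heavy⇒filtration (levelThreshold 0) 0 λ
    { (zero ∷ [])        _  → CommutativeRing.refl K
    -- This coefficient of w₀ is 1, but its exponent has weight 1, above `level 0` = ½, so vanishing
    -- is not asked of it.
    ; (suc zero ∷ [])    1≤ → contradiction (ℚₚ.≤-<-trans (ℚₚ.≤-trans (ℚₚ.≤-reflexive (≡.sym weight-[1])) 1≤) level-0<1)
                                            (ℚₚ.<-irrefl ≡.refl)
    ; (suc (suc i) ∷ []) _  → CommutativeRing.refl K }
    where
    weight-[1] : weight (1 ∷ []) ≡ 1ℚ
    weight-[1] = ≡.trans (≡.cong (1ℚ ℚ.+_) (ℚₚ.*-zeroʳ ratio)) (ℚₚ.+-identityʳ 1ℚ)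

  include≈ᶜ : ∀ n p → (suc n , RingHomomorphism.⟦_⟧ (includeHom (suc n)) p) C.≈ (n , p)
  include≈ᶜ n p = suc n , ≤′-reflexive ≡.refl , ≤′-step (≤′-reflexive ≡.refl) , CommutativeRing.refl (S (suc n)) {RingHomomorphism.⟦_⟧ (includeHom (suc n)) p}

  series≈⇒≈ᶜ : ∀ n {p q} → CommutativeRing._≈_ (series (suc n)) p q → (n , p) C.≈ (n , q)
  series≈⇒≈ᶜ n p≈q = at-level (RingHomomorphism.⟦⟧-cong (quotientHom (series (suc n)) (relations n)) p≈q)

  scalar≈ᶜ : ∀ n c → (n , RingHomomorphism.⟦_⟧ (scalarHom (suc n)) c) C.≈ RingHomomorphism.⟦_⟧ colimitScalar c
  scalar≈ᶜ zero    c = C.refl {RingHomomorphism.⟦_⟧ colimitScalar c}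
  scalar≈ᶜ (suc n) c = C.trans {suc n , RingHomomorphism.⟦_⟧ (scalarHom (suc (suc n))) c}
    {n , RingHomomorphism.⟦_⟧ (scalarHom (suc n)) c} {RingHomomorphism.⟦_⟧ colimitScalar c}
    (C.trans {suc n , RingHomomorphism.⟦_⟧ (scalarHom (suc (suc n))) c} {suc n , RingHomomorphism.⟦_⟧ (includeHom (suc n)) s} {n , s}
       (series≈⇒≈ᶜ (suc n) (CommutativeRing.sym (series (suc (suc n))) (include-scalar (suc n) c))) (include≈ᶜ n s))
    (scalar≈ᶜ n c)
    where
    s : series.Carrier (suc n)
    s = RingHomomorphism.⟦_⟧ (scalarHom (suc n)) c

  -- In the colimit a variable depends on its index alone. For w₀ this follows by descending the
  -- inclusions; a later variable is the shift of its predecessor, so the shift carries the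
  -- induction.
  var≈ᶜ : ∀ n (i : Fin (suc n)) → (n , var i) C.≈ wᶜ (toℕ i)
  var≈ᶜ zero    zero    = C.refl {wᶜ 0}
  var≈ᶜ (suc n) zero    = C.trans {suc n , var {suc (suc n)} zero} {n , var {suc n} zero} {wᶜ 0}
    (C.trans {suc n , var {suc (suc n)} zero} {suc n , RingHomomorphism.⟦_⟧ (includeHom (suc n)) (var {suc n} zero)} {n , var {suc n} zero}
      (series≈⇒≈ᶜ (suc n) (CommutativeRing.sym (series (suc (suc n))) (include-var {suc n} zero))) (include≈ᶜ n (var {suc n} zero)))
    (var≈ᶜ n zero)
  var≈ᶜ (suc n) (suc i) = colimitShift.⟦⟧-cong {n , var i} {wᶜ (toℕ i)} (var≈ᶜ n i)

  colimitAlgebraShift : AlgebraHom colimitAlgebra colimitAlgebra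
  colimitAlgebraShift = record { ringHomomorphism = colimitShift ; scalar-homo = colimitShift-scalar }

  filteredAlgebra : FilteredAlgebra K
  filteredAlgebra = record { algebra = colimitAlgebra ; σ = colimitAlgebraShift ; w = wᶜ 0 ; F = filtration }

  coordinate : ℕ → C.Carrier
  coordinate = shifts colimitAlgebraShift (wᶜ 0)

  -- The shift acts on representatives and takes the last variable of one stage to the last variable
  -- of the next, so the equality holds on the nose.
  coordinate≡wᶜ : ∀ i → coordinate i ≡ wᶜ i
  coordinate≡wᶜ zero    = ≡.refl
  coordinate≡wᶜ (suc i) = ≡.cong colimitShift.⟦_⟧ (coordinate≡wᶜ i)

  ιHom : ∀ n → RingHom (series (suc n)) colimit
  ιHom n = compose (series (suc n)) (S n) colimit (injectionHom n) (quotientHom (series (suc n)) (relations n))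

  ι : ∀ n → AlgebraHom (seriesAlgebra (suc n)) colimitAlgebra
  ι n = record { ringHomomorphism = ιHom n ; scalar-homo = scalar≈ᶜ n }

  ι-var : ∀ n (i : Fin (suc n)) → AlgebraHom.⟦_⟧ (ι n) (var i) C.≈ coordinate (toℕ i)
  ι-var n i = ≡.subst (λ x → (n , var i) C.≈ x) (≡.sym (coordinate≡wᶜ (toℕ i))) (var≈ᶜ n i)

  colimit-relation : CommutativeAlgebra._≈_ colimitAlgebra
    (relation colimitAlgebra f g d e (coordinate 0) (coordinate 1)) (CommutativeAlgebra.0# colimitAlgebra)
  colimit-relation = C.trans
    {relation colimitAlgebra f g d e (coordinate 0) (coordinate 1)} {AlgebraHom.⟦_⟧ (ι 1) r} {C.0#}
    (C.sym {AlgebraHom.⟦_⟧ (ι 1) r} {relation colimitAlgebra f g d e (coordinate 0) (coordinate 1)}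
      (relation-homo (seriesAlgebra 2) colimitAlgebra (ι 1) f g d e
        {var {2} zero} {var {2} (suc zero)} {coordinate 0} {coordinate 1} (ι-var 1 zero) (ι-var 1 (suc zero))))
    (C.trans {AlgebraHom.⟦_⟧ (ι 1) r} {1 , CommutativeRing.0# (series 2)} {C.0#}
      (at-level {1} {r} {CommutativeRing.0# (series 2)}
        (Ideal.∈-resp-≈ (relations 1) {r} {r S₂.- S₂.0#} (S₂.sym {r S₂.- S₂.0#} {r} (S₂.x-0≈x r)) (generator∈ (series 2) (relationAt 1) zero)))
      (RingHomomorphism.0#-homo (ιHom 1)))
    where
    module S₂ = RingLemmas (series 2)
    r : S₂.Carrier
    r = relationAt 1 zero

  monomial∈filtration : ∀ (X : Threshold) {n} (α : Vec ℕ n) → ¬ (weight α ℚ.≤ proj₁ X) →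
    monomialAt colimitAlgebra (λ i → coordinate (toℕ i)) α ∈ Member (filtration X)
  -- The empty monomial has weight 0, and thresholds are positive.
  monomial∈filtration (X , 0<X) []          α≰X = contradiction (ℚₚ.<⇒≤ 0<X) α≰X
  monomial∈filtration X {suc n} α@(_ ∷ _) α≰X =
    Ideal.∈-resp-≈ (filtration X) {ιHom.⟦ monomialSeries α ⟧} {monomialAt colimitAlgebra (λ i → coordinate (toℕ i)) α}
      (C.trans {ιHom.⟦ monomialSeries α ⟧} {monomialAt colimitAlgebra (λ i → ιHom.⟦ var i ⟧) α} {monomialAt colimitAlgebra (λ i → coordinate (toℕ i)) α}
        (monomialSeries-homo colimitAlgebra (ιHom n) α)
        (monomialAt-cong colimitAlgebra {x = λ i → ιHom.⟦ var i ⟧} {y = λ i → coordinate (toℕ i)} (ι-var n) α))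
      (heavy⇒filtration X n {monomialSeries α} (monomialSeries-vanishing {suc n} {λ α → weight α ℚ.≤ proj₁ X} α α≰X))
    where
    module ιHom = RingHomomorphism (ιHom n)

  module _ (B : CommutativeAlgebra K k (k ⊔ ℓ)) where
    private
      module B = CommutativeAlgebra B
    open SeriesHoms K B
    open RingLemmas B.ring using (zeroIdeal)

    colimit-ext : (φ ψ : AlgebraHom colimitAlgebra B) →
      (∀ i → AlgebraHom.⟦_⟧ φ (coordinate i) B.≈ AlgebraHom.⟦_⟧ ψ (coordinate i)) →
      (∀ i → ∃[ m ] AlgebraHom.⟦_⟧ φ (coordinate i) B.^ m B.≈ B.0#) →
      ∀ x → AlgebraHom.⟦_⟧ φ x B.≈ AlgebraHom.⟦_⟧ ψ x
    colimit-ext φ ψ φ≈ψ nil (n , p) = series-ext (suc n)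
      (compose (series (suc n)) colimit B.ring φ.ringHomomorphism (ιHom n))
      (compose (series (suc n)) colimit B.ring ψ.ringHomomorphism (ιHom n))
      (λ c → B.trans (φ-scalar φ c) (B.sym (φ-scalar ψ c)))
      (λ i → B.trans (φ.⟦⟧-cong {n , var i} {coordinate (toℕ i)} (ι-var n i))
        (B.trans (φ≈ψ (toℕ i)) (B.sym (ψ.⟦⟧-cong {n , var i} {coordinate (toℕ i)} (ι-var n i)))))
      (λ i → proj₁ (nil (toℕ i)) , B.trans (B.^-congˡ (proj₁ (nil (toℕ i))) (φ.⟦⟧-cong {n , var i} {coordinate (toℕ i)} (ι-var n i)))
        (proj₂ (nil (toℕ i))))
      p
      where
      module φ = AlgebraHom φ
      module ψ = AlgebraHom ψ
      φ-scalar : ∀ (χ : AlgebraHom colimitAlgebra B) c →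
        AlgebraHom.⟦_⟧ χ (n , RingHomomorphism.⟦_⟧ (scalarHom (suc n)) c) B.≈ B.scalar c
      φ-scalar χ c = B.trans
        (AlgebraHom.⟦⟧-cong χ {n , RingHomomorphism.⟦_⟧ (scalarHom (suc n)) c} {RingHomomorphism.⟦_⟧ colimitScalar c} (scalar≈ᶜ n c))
        (AlgebraHom.scalar-homo χ c)

    module _ (y : ℕ → B.Carrier) (m : ℕ) (nil : ∀ i → y i B.^ m B.≈ B.0#)
             (y-relation : ∀ i → relation B f g d e (y i) (y (suc i)) B.≈ B.0#) where

      evaluation : ∀ n → AlgebraHom (seriesAlgebra n) B
      evaluation n = record
        { ringHomomorphism = evaluateSeries m n (λ i → y (toℕ i)) (λ i → nil (toℕ i))
        ; scalar-homo      = evaluateSeries-scalar m n (λ i → y (toℕ i)) (λ i → nil (toℕ i)) }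

      evaluation-var : ∀ n (i : Fin n) → AlgebraHom.⟦_⟧ (evaluation n) (var i) B.≈ y (toℕ i)
      evaluation-var n = evaluateSeries-var m n (λ i → y (toℕ i)) (λ i → nil (toℕ i))

      evaluation-relations : ∀ n {x} → x ∈ Member (relations n) → AlgebraHom.⟦_⟧ (evaluation (suc n)) x B.≈ B.0#
      evaluation-relations n {x} = span-map (series (suc n)) B.ring (AlgebraHom.ringHomomorphism (evaluation (suc n)))
        zeroIdeal (relationAt n)
        (λ i → B.trans (relation-homo (seriesAlgebra (suc n)) B (evaluation (suc n)) f g d e
            {var (inject₁ i)} {var (suc i)} {y (toℕ i)} {y (suc (toℕ i))}
            (≡.subst (λ j → AlgebraHom.⟦_⟧ (evaluation (suc n)) (var (inject₁ i)) B.≈ y j) (Finₚ.toℕ-inject₁ i)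
              (evaluation-var (suc n) (inject₁ i)))
            (evaluation-var (suc n) (suc i)))
          (y-relation (toℕ i))) {x}

      evaluationS : ∀ n → RingHom (S n) B.ring
      evaluationS n = quotientLift (series (suc n)) B.ring (relations n)
        (AlgebraHom.ringHomomorphism (evaluation (suc n))) (λ {x} → evaluation-relations n {x})

      -- The inclusion adds a variable innermost while evaluation recurses from the outermost one.
      -- Agreement on the nilpotent values of the variables avoids matching the two recursions.
      evaluation-include : ∀ n x → AlgebraHom.⟦_⟧ (evaluation (suc n)) (RingHomomorphism.⟦_⟧ (includeHom n) x)
        B.≈ AlgebraHom.⟦_⟧ (evaluation n) x
      evaluation-include n = series-ext n
        (compose (series n) (series (suc n)) B.ring (AlgebraHom.ringHomomorphism (evaluation (suc n))) (includeHom n))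
        (AlgebraHom.ringHomomorphism (evaluation n))
        (λ c → B.trans (AlgebraHom.scalar-homo (evaluation (suc n) ∘ᴬ include n) c) (B.sym (AlgebraHom.scalar-homo (evaluation n) c)))
        (λ i → B.trans (included-var i) (B.sym (evaluation-var n i)))
        (λ i → m , B.trans (B.^-congˡ m (included-var i)) (nil (toℕ i)))
        where
        included-var : ∀ (i : Fin n) → AlgebraHom.⟦_⟧ (evaluation (suc n)) (RingHomomorphism.⟦_⟧ (includeHom n) (var i)) B.≈ y (toℕ i)
        included-var i = B.trans
          (AlgebraHom.⟦⟧-cong (evaluation (suc n)) {RingHomomorphism.⟦_⟧ (includeHom n) (var i)} {var (inject₁ i)} (include-var i))
          (≡.subst (λ j → AlgebraHom.⟦_⟧ (evaluation (suc n)) (var (inject₁ i)) B.≈ y j) (Finₚ.toℕ-inject₁ i)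
            (evaluation-var (suc n) (inject₁ i)))

      colimitEvaluation : RingHom colimit B.ring
      colimitEvaluation = colimitLift B.ring evaluationS (λ n x → evaluation-include (suc n) x)

      colimitEvaluation-scalar : ∀ c → RingHomomorphism.⟦_⟧ colimitEvaluation (RingHomomorphism.⟦_⟧ colimitScalar c) B.≈ B.scalar c
      colimitEvaluation-scalar = AlgebraHom.scalar-homo (evaluation 1)

      colimitEvaluation-coordinate : ∀ i → RingHomomorphism.⟦_⟧ colimitEvaluation (coordinate i) B.≈ y i
      colimitEvaluation-coordinate i = ≡.subst (λ x → RingHomomorphism.⟦_⟧ colimitEvaluation x B.≈ y i) (≡.sym (coordinate≡wᶜ i))
        (≡.subst (λ j → RingHomomorphism.⟦_⟧ colimitEvaluation (wᶜ i) B.≈ y j) (Finₚ.toℕ-fromℕ i)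
          (evaluation-var (suc i) (fromℕ i)))

      module _ (X : Threshold) (J : Ideal B.ring (k ⊔ ℓ))
               (monomials∈ : ∀ {n} (α : Vec ℕ n) → ¬ (weight α ℚ.≤ proj₁ X) → monomialAt B (λ i → y (toℕ i)) α ∈ Member J) where

        evaluation-heavy : ∀ n {x} → x ∈ Member (heavy n (proj₁ X)) → AlgebraHom.⟦_⟧ (evaluation (suc n)) x ∈ Member J
        evaluation-heavy n {x} x∈ = Ideal.∈-resp-≈ J (B.*-identityˡ _)
          (evaluateSeries-vanishing m J {suc n} (λ i → y (toℕ i)) (λ i → nil (toℕ i)) {λ α → weight α ℚ.≤ proj₁ X}
            (λ α → weight α ℚₚ.≤? proj₁ X) B.1#
            (λ α α≰X → Ideal.∈-resp-≈ J (B.sym (B.*-identityˡ _)) (monomials∈ α α≰X)) x x∈)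

        evaluation-𝔪 : ∀ n {x} → x ∈ Member (𝔪 n (proj₁ X)) → RingHomomorphism.⟦_⟧ (evaluationS n) x ∈ Member J
        evaluation-𝔪 n {x} (z , x≈z , z∈) = Ideal.∈-resp-≈ J
          (B.sym (RingHomomorphism.⟦⟧-cong (evaluationS n) {x} {z} x≈z)) (evaluation-heavy n {z} z∈)

        colimitEvaluation-filtration : ∀ {x} → x ∈ Member (filtration X) → RingHomomorphism.⟦_⟧ colimitEvaluation x ∈ Member J
        colimitEvaluation-filtration {x} = colimitLift-∈ B.ring evaluationS (λ n x → evaluation-include (suc n) x)
          (λ n → 𝔪 n (proj₁ X)) (include-𝔪 (proj₁ X)) J (λ n {z} → evaluation-𝔪 n {z}) {x}

      open PathAlgebras K d e 1≤e e<d using (Lift)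

      colimit-lift : Lift filteredAlgebra B y
      colimit-lift = record
        { hom            = record { ringHomomorphism = colimitEvaluation ; scalar-homo = colimitEvaluation-scalar }
        ; hom-coordinate = colimitEvaluation-coordinate
        ; hom-F          = λ X J monomials∈ {x} → colimitEvaluation-filtration X J monomials∈ {x} }

  pathAlgebra : PathAlgebras.PathAlgebra K d e 1≤e e<d f g
  pathAlgebra = record
    { filteredAlgebra = filteredAlgebra
    ; F-antitone      = λ X Y X≤Y {x} → filtration-antitone X Y X≤Y {x}
    ; F-*             = λ X Y Z Z≤X+Y {x} {y} → filtration-* X Y Z Z≤X+Y {x} {y}
    ; σ-F             = λ X Y α≤ {x} → shift-filtration X Y α≤ {x}
    ; w∈F             = w₀∈
    ; w-relation      = colimit-relation
    ; monomial∈F      = monomial∈filtration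
    ; lift            = colimit-lift
    ; ext             = colimit-ext
    }

-- Monic polynomials over K

module _ {a ℓa b ℓb} (A : CommutativeRing a ℓa) (B : CommutativeRing b ℓb) (φ : RingHom A B) where
  private
    module B = CommutativeRing B
  open HomLaws A B φ

  mapPolynomial-monic : ∀ {f n} → IsMonicOfDegree f n → IsMonicOfDegree (mapPolynomial A B φ f) n
  mapPolynomial-monic (lead , above) =
    B.trans (⟦⟧-cong lead) 1#-homo , λ n<m → B.trans (⟦⟧-cong (above n<m)) 0#-homo

-- The coefficients of monomial A n come from a local function that also takes n
-- as a parameter p; diagonal is that function, found by unification, with p freed
-- from n so that the induction goes through.
module _ {a ℓ} (A : CommutativeRing a ℓ) where
  open CommutativeRing A using (Carrier; _≈_; 1#; refl)

  mutual
    diagonal : ℕ → ℕ → Carrier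
    diagonal p n = _

    monomial-leading : ∀ n → coeff (monomial A n) n ≈ 1#
    monomial-leading zero = refl
    monomial-leading (suc n) with suc n
    ... | p = diagonal≈1 p n

    diagonal≈1 : ∀ p n → diagonal p n ≈ 1#
    diagonal≈1 p zero    = refl
    diagonal≈1 p (suc n) = diagonal≈1 p n

  monomial-monic : ∀ n → IsMonicOfDegree (monomial A n) n
  monomial-monic n = monomial-leading n , Polynomial.vanishes (monomial A n)

module _ {k ℓ} (K : CommutativeRing k ℓ) (d e : ℕ) (1≤e : 1 ℕ.≤ e) (e<d : e ℕ.< d) (f g : Polynomial K) where
  open PathSpace K d e 1≤e e<d f g using (S; includeS; filtration; 𝒪; shift)
  open Colimit S includeS using (colimit)
  open Completion colimit (λ (X , _) (Y , _) → X ℚ.≤ Y) filtration using (compatibleFamily; component; compatible)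
  open Completions K d e 1≤e e<d using (IsCompletion)
  open FormalNeighbourhood K d e 1≤e e<d f g using (pathAlgebra)
  private
    module C = RingLemmas colimit
    module CX X = CommutativeRing (colimit / filtration X)
    module 𝒪 = CommutativeAlgebra 𝒪

  -- Elements of the inverse limit are compatible families and its operations act on
  -- representatives, so each condition holds by definition or by reflexivity.
  𝒪-isCompletion : IsCompletion pathAlgebra 𝒪 shift
  𝒪-isCompletion = record
    { component            = component
    ; component-compatible = λ x X Y X≤Y → compatible x {X} {Y} X≤Y
    ; component-cong       = λ {x} {y} x≈y → x≈y
    ; component-injective  = λ {x} {y} x≈y → x≈y
    ; component-+          = λ x y X → CX.refl X {component x X C.+ component y X}
    ; component-*          = λ x y X → CX.refl X {component x X C.* component y X}
    ; component-1          = λ X → CX.refl X {C.1#}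
    ; component-scalar     = λ c X → CX.refl X {component (𝒪.scalar c) X}
    ; component-shift      = λ x X → CX.refl X {component (AlgebraHom.⟦_⟧ shift x) X}
    ; glue                 = λ z z-compatible → compatibleFamily z (λ {X} {Y} → z-compatible X Y)
    ; component-glue       = λ z _ X → CX.refl X {z X}
    }

-- The isomorphism of formal neighbourhoods

module _ {k ℓ} (K : CommutativeRing k ℓ) (d e : ℕ) (1≤e : 1 ℕ.≤ e) (e<d : e ℕ.< d)
         (c : CommutativeRing.Carrier K)
         (cd≈1 : CommutativeRing._≈_ K (CommutativeRing._*_ K c (natural K d)) (CommutativeRing.1# K)) where
  open PathAlgebras K d e 1≤e e<d
  open Comparison K d e 1≤e e<d c cd≈1
  open Completions K d e 1≤e e<d

  module _ {f₁ g₁ f₂ g₂ : Polynomial K} (P : PathAlgebra f₁ g₁) (Q : PathAlgebra f₂ g₂)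
           (f₁-monic : IsMonicOfDegree f₁ d) (g₁-monic : IsMonicOfDegree g₁ e)
           (f₂-monic : IsMonicOfDegree f₂ d) (g₂-monic : IsMonicOfDegree g₂ e) where

    comparison : TruncatedHoms P Q
    comparison = record
      { hom      = compare P Q f₁-monic g₁-monic f₂-monic g₂-monic
      ; descends = compare-descends P Q f₁-monic g₁-monic f₂-monic g₂-monic
      ; commutes = compare-σ P Q f₁-monic g₁-monic f₂-monic g₂-monic }

  module _ {f₁ g₁ f₂ g₂ : Polynomial K} (P : PathAlgebra f₁ g₁) (Q : PathAlgebra f₂ g₂)
           (f₁-monic : IsMonicOfDegree f₁ d) (g₁-monic : IsMonicOfDegree g₁ e)
           (f₂-monic : IsMonicOfDegree f₂ d) (g₂-monic : IsMonicOfDegree g₂ e)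
           {OP OQ : CommutativeAlgebra K (k ⊔ ℓ) (k ⊔ ℓ)} {σ : AlgebraHom OP OP} {τ : AlgebraHom OQ OQ}
           (CP : IsCompletion P OP σ) (CQ : IsCompletion Q OQ τ) where
    open FunctorOfPoints K (k ⊔ ℓ)

    Spec-≅-comparison : Σ (Spec OP ≅ Spec OQ) λ Ξ → (_≅_.to Ξ ∘⇒ Spec₁ σ) ≈⇒ (Spec₁ τ ∘⇒ _≅_.to Ξ)
    Spec-≅-comparison = Spec-completion-≅ CP CQ
      (comparison P Q f₁-monic g₁-monic f₂-monic g₂-monic)
      (comparison Q P f₂-monic g₂-monic f₁-monic g₁-monic)
      (compare-inverse P Q f₁-monic g₁-monic f₂-monic g₂-monic)
      (compare-inverse Q P f₂-monic g₂-monic f₁-monic g₁-monic)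

  module _ (f₁ g₁ f₂ g₂ : Polynomial K)
           (f₁-monic : IsMonicOfDegree f₁ d) (g₁-monic : IsMonicOfDegree g₁ e)
           (f₂-monic : IsMonicOfDegree f₂ d) (g₂-monic : IsMonicOfDegree g₂ e) where
    private
      module PS₁ = PathSpace K d e 1≤e e<d f₁ g₁
      module PS₂ = PathSpace K d e 1≤e e<d f₂ g₂
      P : PathAlgebra f₁ g₁
      P = FormalNeighbourhood.pathAlgebra K d e 1≤e e<d f₁ g₁
      Q : PathAlgebra f₂ g₂
      Q = FormalNeighbourhood.pathAlgebra K d e 1≤e e<d f₂ g₂
    open FunctorOfPoints K (k ⊔ ℓ)

    formalNeighbourhood-≅ : Σ (PS₁.formalNeighbourhood ≅ PS₂.formalNeighbourhood) λ Ξ →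
      (_≅_.to Ξ ∘⇒ PS₁.formalShift) ≈⇒ (PS₂.formalShift ∘⇒ _≅_.to Ξ)
    formalNeighbourhood-≅ = Spec-≅-comparison P Q f₁-monic g₁-monic f₂-monic g₂-monic
      {PS₁.𝒪} {PS₂.𝒪} {PS₁.shift} {PS₂.shift}
      (𝒪-isCompletion K d e 1≤e e<d f₁ g₁) (𝒪-isCompletion K d e 1≤e e<d f₂ g₂)

theorem3 :
    ∀ {r ℓr k ℓk ℓ#}
    (R : CommutativeRing r ℓr) (K : HeytingField k ℓk ℓ#)
    (ι : RingHom R (fieldRing K)) →
    IsDedekindWithFractionField R K ι →
    (d e : ℕ) (1≤e : 1 ≤ e) (e<d : e < d) →
    IsUnit R (natural R d) → IsUnit R (natural R e) →
    (f g : Polynomial R) → IsMonicOfDegree f d → IsMonicOfDegree g e →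
    let Kᵣ = fieldRing K
        module P = PathSpace Kᵣ d e 1≤e e<d (mapPolynomial R Kᵣ ι f) (mapPolynomial R Kᵣ ι g)
        module B = PathSpace Kᵣ d e 1≤e e<d (monomial Kᵣ d) (monomial Kᵣ e)
        open FunctorOfPoints Kᵣ (k ⊔ ℓk)
    in Σ (P.formalNeighbourhood ≅ B.formalNeighbourhood) λ Ξ →
         (_≅_.to Ξ ∘⇒ P.formalShift) ≈⇒ (B.formalShift ∘⇒ _≅_.to Ξ)
theorem3 R K ι _ d e 1≤e e<d (d⁻¹ , d⁻¹d≈1 , _) _ f g f-monic g-monic =
  -- The constant c of the iteration is the image in K of the inverse of d in R.
  formalNeighbourhood-≅ (fieldRing K) d e 1≤e e<d ι.⟦ d⁻¹ ⟧ inverse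
    (mapPolynomial R (fieldRing K) ι f) (mapPolynomial R (fieldRing K) ι g) (monomial (fieldRing K) d) (monomial (fieldRing K) e)
    (mapPolynomial-monic R (fieldRing K) ι {f} f-monic) (mapPolynomial-monic R (fieldRing K) ι {g} g-monic)
    (monomial-monic (fieldRing K) d) (monomial-monic (fieldRing K) e)
  where
  module K = CommutativeRing (fieldRing K)
  module ι = RingHomomorphism ι
  inverse : (ι.⟦ d⁻¹ ⟧ K.* natural (fieldRing K) d) K.≈ K.1#
  inverse = K.trans (K.*-congˡ (K.sym (natural-homo R (fieldRing K) ι d)))
    (K.trans (K.sym (ι.*-homo d⁻¹ (natural R d))) (K.trans (ι.⟦⟧-cong d⁻¹d≈1) ι.1#-homo))
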